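{- For an integer $n>1$ and a real number $\alpha$ with $1\le\alpha\le\sqrt n$ let $$g(n,\alpha)=\frac1\alpha\sqrt n\,\log n+2\left(1+\frac{0.6}{\alpha}\right)\sqrt n+\frac{2(2n-1)\alpha}{2\sqrt n-\alpha}.$$ Then for every $\varepsilon>0$ there is a constant $C_\varepsilon$, depending only on $\varepsilon$, such that for all integers $n>1$ and all real $\alpha$ with $1\le\alpha\le\sqrt n$: if $n$ is not a square, $$f(n)\le\frac12\theta(n)g(n,\alpha)\le C_\varepsilon n^{\varepsilon}\left(\frac1{2\alpha}\sqrt n\,\log n+\left(1+\frac{0.6}{\alpha}\right)\sqrt n+\frac{(2n-1)\alpha}{2\sqrt n-\alpha}\right);$$ if $n$ is a square, $$f(n)\le\frac12(\theta(n)+1)g(n,\alpha)\le (C_\varepsilon n^{\varepsilon}+1)\left(\frac1{2\alpha}\sqrt n\,\log n+\left(1+\frac{0.6}{\alpha}\right)\sqrt n+\frac{(2n-1)\alpha}{2\sqrt n-\alpha}\right).$$ In particular, $f(n)<n$ for all sufficiently large $n$.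
   Context: For an integer $n>1$, consider the equation $$n=\left(X+\frac1x\right)\left(Y+\frac1y\right)$$ in positive integers $X,x,Y,y$ with $x>1$ and $y>1$. Two solutions obtained from each other by transposing the pairs $(X,x)$ and $(Y,y)$ are identified, and $f(n)$ denotes the number of solutions up to this identification. Since $x\neq y$ in every solution, $f(n)$ is equivalently the number of quadruples $(X,x,Y,y)$ of positive integers satisfying the equation with $1<x<y$. $\theta(n)$ is the number of positive divisors of $n$, and $\log$ is the natural logarithm. -}

module Defs where

open import Algebra.Bundles using (CommutativeRing)
open import Data.Empty using (⊥-elim)
open import Data.Nat as ℕ using (ℕ; zero; suc; z≤n; s≤s)
import Data.Nat.Properties as ℕ
import Data.Nat.Divisibility as ℕ
open import Data.Nat.Tactic.RingSolver as ℕSolver using ()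
open import Data.Integer as ℤ using (+_; 1ℤ)
import Data.Integer.Properties as ℤ
open import Data.List.Base using (List; length; filter; upTo; map; cartesianProduct)
open import Data.List.Membership.Propositional using (_∈_)
open import Data.List.Membership.Propositional.Properties
  using (∈-filter⁺; ∈-filter⁻; ∈-cartesianProduct⁺; ∈-upTo⁺)
open import Data.List.Relation.Unary.Unique.Propositional using (Unique)
import Data.List.Relation.Unary.Unique.Propositional.Properties as Unique
open import Data.Product using (Σ; ∃; _×_; _,_; proj₁; proj₂)
open import Data.Rational as ℚ using (ℚ; 0ℚ; 1ℚ; ½)
import Data.Rational.Properties as ℚ
import Data.Rational.Unnormalised as ℚᵘ
import Data.Rational.Unnormalised.Properties as ℚᵘ
open import Data.Sum using (_⊎_; inj₁; inj₂; [_,_]′)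
import Relation.Binary.PropositionalEquality
open import Relation.Binary.PropositionalEquality
  using (_≡_; refl; sym; trans; cong; cong₂; subst; subst₂)
open import Relation.Nullary using (¬_; Dec; yes; no)
open import Relation.Nullary.Decidable using (dec⇒maybe; map′; _×-dec_)
open import Tactic.RingSolver as RingSolver using ()
open import Tactic.RingSolver.Core.AlmostCommutativeRing
  using (AlmostCommutativeRing; fromCommutativeRing)

module RationalLemmas where
  open import Data.Rational
  open import Data.Rational.Properties using (module ≤-Reasoning)
  open ≤-Reasoning

  ring : AlmostCommutativeRing _ _
  ring = fromCommutativeRing ℚ.+-*-commutativeRing λ q → dec⇒maybe (0ℚ ℚ.≟ q)

  fromℕ : ℕ → ℚ
  fromℕ n = + n / 1

  recip : ℕ → ℚ
  recip n = 1ℤ / suc n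

  toℚᵘ-/ : ∀ i d → toℚᵘ (i / suc d) ℚᵘ.≃ ℚᵘ.mkℚᵘ i d
  toℚᵘ-/ i d = ℚ.toℚᵘ-fromℚᵘ (ℚᵘ.mkℚᵘ i d)

  fromℕ-+ : ∀ m n → fromℕ (m ℕ.+ n) ≡ fromℕ m + fromℕ n
  fromℕ-+ m n = ℚ.toℚᵘ-injective (ℚᵘ.≃-trans (toℚᵘ-/ (+ (m ℕ.+ n)) 0)
    (ℚᵘ.≃-trans (ℚᵘ.*≡* (cong (ℤ._* 1ℤ) (sym (cong₂ ℤ._+_ (ℤ.*-identityʳ (+ m)) (ℤ.*-identityʳ (+ n))))))
    (ℚᵘ.≃-sym (ℚᵘ.≃-trans (ℚ.toℚᵘ-homo-+ (fromℕ m) (fromℕ n))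
      (ℚᵘ.+-cong (toℚᵘ-/ (+ m) 0) (toℚᵘ-/ (+ n) 0))))))

  fromℕ-* : ∀ m n → fromℕ (m ℕ.* n) ≡ fromℕ m * fromℕ n
  fromℕ-* m n = ℚ.toℚᵘ-injective (ℚᵘ.≃-trans (toℚᵘ-/ (+ (m ℕ.* n)) 0)
    (ℚᵘ.≃-trans (ℚᵘ.*≡* (cong (ℤ._* 1ℤ) (ℤ.pos-* m n)))
    (ℚᵘ.≃-sym (ℚᵘ.≃-trans (ℚ.toℚᵘ-homo-* (fromℕ m) (fromℕ n))
      (ℚᵘ.*-cong (toℚᵘ-/ (+ m) 0) (toℚᵘ-/ (+ n) 0))))))

  fromℕ-injective : ∀ {m n} → fromℕ m ≡ fromℕ n → m ≡ n
  fromℕ-injective {m} {n} eq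
    with ℚᵘ.≃-trans (ℚᵘ.≃-sym (toℚᵘ-/ (+ m) 0))
           (ℚᵘ.≃-trans (ℚᵘ.≃-reflexive (cong toℚᵘ eq)) (toℚᵘ-/ (+ n) 0))
  ... | ℚᵘ.*≡* e = ℤ.+-injective (ℤ.*-cancelʳ-≡ (+ m) (+ n) 1ℤ e)

  fromℕ-mono : ∀ {m n} → m ℕ.≤ n → fromℕ m ≤ fromℕ n
  fromℕ-mono {m} {n} m≤n = ℚ.toℚᵘ-cancel-≤
    (ℚᵘ.≤-respʳ-≃ (ℚᵘ.≃-sym (toℚᵘ-/ (+ n) 0))
    (ℚᵘ.≤-respˡ-≃ (ℚᵘ.≃-sym (toℚᵘ-/ (+ m) 0))
    (ℚᵘ.*≤* (ℤ.*-monoʳ-≤-nonNeg 1ℤ (ℤ.+≤+ m≤n)))))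

  0≤fromℕ : ∀ n → 0ℚ ≤ fromℕ n
  0≤fromℕ n = fromℕ-mono {0} {n} z≤n

  recip-fromℕ : ∀ n → recip n * fromℕ (suc n) ≡ 1ℚ
  recip-fromℕ n = ℚ.toℚᵘ-injective (ℚᵘ.≃-trans (ℚ.toℚᵘ-homo-* (recip n) (fromℕ (suc n)))
    (ℚᵘ.≃-trans (ℚᵘ.*-cong (toℚᵘ-/ 1ℤ n) (toℚᵘ-/ (+ suc n) 0))
      (ℚᵘ.*≡* (cong +_ (lem n)))))
    where
    lem : ∀ n → (1 ℕ.* suc n) ℕ.* 1 ≡ 1 ℕ.* (suc n ℕ.* 1)
    lem = ℕSolver.solve-∀

  /-fromℕ : ∀ x .{{_ : ℕ.NonZero x}} → (1ℤ / x) * fromℕ x ≡ 1ℚ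
  /-fromℕ (suc n) = recip-fromℕ n

  recip-pos : ∀ n → 0ℚ < recip n
  recip-pos n = ℚ.positive⁻¹ (recip n) {{ℚ.normalize-pos 1 (suc n)}}

  0≤recip : ∀ n → 0ℚ ≤ recip n
  0≤recip n = ℚ.<⇒≤ (recip-pos n)

  *-monoˡ : ∀ {r p q} → 0ℚ ≤ r → p ≤ q → r * p ≤ r * q
  *-monoˡ {r} 0≤r = ℚ.*-monoˡ-≤-nonNeg r {{nonNegative 0≤r}}

  *-monoʳ : ∀ {r p q} → 0ℚ ≤ r → p ≤ q → p * r ≤ q * r
  *-monoʳ {r} 0≤r = ℚ.*-monoʳ-≤-nonNeg r {{nonNegative 0≤r}}

  *-mono : ∀ {p q r s} → 0ℚ ≤ p → 0ℚ ≤ s → p ≤ q → r ≤ s → p * r ≤ q * s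
  *-mono 0≤p 0≤s p≤q r≤s = ℚ.≤-trans (*-monoˡ 0≤p r≤s) (*-monoʳ 0≤s p≤q)

  0≤* : ∀ {p q} → 0ℚ ≤ p → 0ℚ ≤ q → 0ℚ ≤ p * q
  0≤* {p} {q} 0≤p 0≤q = subst (_≤ p * q) (ℚ.*-zeroʳ p) (*-monoˡ 0≤p 0≤q)

  0<* : ∀ {p q} → 0ℚ < p → 0ℚ < q → 0ℚ < p * q
  0<* {p} {q} 0<p 0<q =
    subst (_< p * q) (ℚ.*-zeroʳ p) (ℚ.*-monoʳ-<-pos p {{positive 0<p}} 0<q)

  0≤+ : ∀ {p q} → 0ℚ ≤ p → 0ℚ ≤ q → 0ℚ ≤ p + q
  0≤+ = ℚ.+-mono-≤

  0<½ : 0ℚ < ½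
  0<½ = ℚ.positive⁻¹ ½

  half-pos : ∀ {ε} → 0ℚ < ε → 0ℚ < ε * ½
  half-pos 0<ε = 0<* 0<ε 0<½

  halves : ∀ ε → ε * ½ + ε * ½ ≡ ε
  halves = RingSolver.solve-∀ ring

  p≤p+q : ∀ {p q} → 0ℚ ≤ q → p ≤ p + q
  p≤p+q {p} {q} 0≤q = subst (_≤ p + q) (ℚ.+-identityʳ p) (ℚ.+-monoʳ-≤ p 0≤q)

  p≤∣p∣ : ∀ p → p ≤ ∣ p ∣
  p≤∣p∣ p with ℚ.≤-total 0ℚ p
  ... | inj₁ 0≤p = ℚ.≤-reflexive (sym (ℚ.0≤p⇒∣p∣≡p 0≤p))
  ... | inj₂ p≤0 = ℚ.≤-trans p≤0 (ℚ.0≤∣p∣ p)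

  ∣p-q∣≡∣q-p∣ : ∀ p q → ∣ p - q ∣ ≡ ∣ q - p ∣
  ∣p-q∣≡∣q-p∣ p q = trans (sym (ℚ.∣-p∣≡∣p∣ (p - q))) (cong ∣_∣ (lem p q))
    where
    lem : ∀ p q → - (p - q) ≡ q - p
    lem = RingSolver.solve-∀ ring

  dist-≤ : ∀ {p q e} → p ≤ q + e → q ≤ p + e → ∣ p - q ∣ ≤ e
  dist-≤ {p} {q} {e} p≤ q≤ with ℚ.∣p∣≡p∨∣p∣≡-p (p - q)
  ... | inj₁ eq = begin
    ∣ p - q ∣ ≡⟨ eq ⟩
    p - q     ≤⟨ ℚ.+-monoˡ-≤ (- q) p≤ ⟩
    q + e - q ≡⟨ lem q e ⟩
    e         ∎
    where
    lem : ∀ q e → q + e - q ≡ e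
    lem = RingSolver.solve-∀ ring
  ... | inj₂ eq = begin
    ∣ p - q ∣ ≡⟨ eq ⟩
    - (p - q) ≡⟨ lem′ p q ⟩
    q - p     ≤⟨ ℚ.+-monoˡ-≤ (- p) q≤ ⟩
    p + e - p ≡⟨ lem p e ⟩
    e         ∎
    where
    lem : ∀ q e → q + e - q ≡ e
    lem = RingSolver.solve-∀ ring
    lem′ : ∀ p q → - (p - q) ≡ q - p
    lem′ = RingSolver.solve-∀ ring

  dist-≤⁻ : ∀ {p q e} → ∣ p - q ∣ ≤ e → p ≤ q + e
  dist-≤⁻ {p} {q} {e} d = begin
    p           ≡⟨ lem p q ⟩
    q + (p - q) ≤⟨ ℚ.+-monoʳ-≤ q (ℚ.≤-trans (p≤∣p∣ (p - q)) d) ⟩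
    q + e       ∎
    where
    lem : ∀ p q → p ≡ q + (p - q)
    lem = RingSolver.solve-∀ ring

  archimedean : ∀ q → ∃ λ n → q ≤ fromℕ n
  archimedean q@(mkℚ i d c) = ℤ.∣ i ∣ , ℚ.toℚᵘ-cancel-≤
    (ℚᵘ.≤-respʳ-≃ (ℚᵘ.≃-sym (toℚᵘ-/ (+ ℤ.∣ i ∣) 0)) (ℚᵘ.*≤* (ℤ.≤-trans
      (ℤ.≤-reflexive (ℤ.*-identityʳ i)) (lem i))))
    where
    lem : ∀ i → i ℤ.≤ + ℤ.∣ i ∣ ℤ.* + suc d
    lem (+ n) = ℤ.≤-trans (ℤ.+≤+ (ℕ.m≤m*n n (suc d))) (ℤ.≤-reflexive (ℤ.pos-* n (suc d)))
    lem ℤ.-[1+ n ] = ℤ.-≤+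

  archimedean-recip : ∀ C {ε} → 0ℚ < ε →
    ∃ λ N → ∀ n → N ℕ.≤ n → C * recip n ≤ ε
  archimedean-recip C {ε} 0<ε with archimedean (C * 1/ε)
    where
    1/ε : ℚ
    1/ε = (1/ ε) {{ℚ.pos⇒nonZero ε {{positive 0<ε}}}}
  ... | N , C/ε≤N = N , λ n N≤n → begin
    C * recip n                          ≤⟨ *-monoʳ (0≤recip n) (C≤ n N≤n) ⟩
    ε * fromℕ (suc n) * recip n          ≡⟨ lem ε (fromℕ (suc n)) (recip n) ⟩
    ε * (recip n * fromℕ (suc n))        ≡⟨ cong (ε *_) (recip-fromℕ n) ⟩
    ε * 1ℚ                               ≡⟨ ℚ.*-identityʳ ε ⟩
    ε                                    ∎
    where
    instance
      ε≢0 : NonZero ε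
      ε≢0 = ℚ.pos⇒nonZero ε {{positive 0<ε}}
    lem : ∀ a b c → a * b * c ≡ a * (c * b)
    lem = RingSolver.solve-∀ ring
    lem′ : ∀ a b c → a * (b * c) ≡ c * (a * b)
    lem′ = RingSolver.solve-∀ ring
    C≤ : ∀ n → N ℕ.≤ n → C ≤ ε * fromℕ (suc n)
    C≤ n N≤n = begin
      C                   ≡⟨ sym (ℚ.*-identityʳ C) ⟩
      C * 1ℚ              ≡⟨ cong (C *_) (sym (ℚ.*-inverseˡ ε)) ⟩
      C * (1/ ε * ε)      ≡⟨ lem′ C (1/ ε) ε ⟩
      ε * (C * 1/ ε)      ≤⟨ *-monoˡ (ℚ.<⇒≤ 0<ε)
                               (ℚ.≤-trans C/ε≤N (fromℕ-mono (ℕ.m≤n⇒m≤1+n N≤n))) ⟩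
      ε * fromℕ (suc n)   ∎

  divide : ∀ K {ε} → 0ℚ ≤ K → 0ℚ < ε → ∃ λ δ → 0ℚ < δ × δ * K ≤ ε
  divide K {ε} 0≤K 0<ε = ε * r , 0<* 0<ε 0<r , (begin
    ε * r * K         ≤⟨ *-monoˡ (ℚ.<⇒≤ (0<* 0<ε 0<r)) (p≤p+q {K} (ℚ.<⇒≤ 0<1)) ⟩
    ε * r * (K + 1ℚ)  ≡⟨ ℚ.*-assoc ε r (K + 1ℚ) ⟩
    ε * (r * (K + 1ℚ)) ≡⟨ cong (ε *_) (ℚ.*-inverseˡ (K + 1ℚ)) ⟩
    ε * 1ℚ            ≡⟨ ℚ.*-identityʳ ε ⟩
    ε                 ∎)
    where
    0<1 : 0ℚ < 1ℚ
    0<1 = ℚ.positive⁻¹ 1ℚ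
    instance
      K+1>0 : Positive (K + 1ℚ)
      K+1>0 = positive (ℚ.+-mono-≤-< 0≤K 0<1)
      K+1≢0 : NonZero (K + 1ℚ)
      K+1≢0 = ℚ.pos⇒nonZero (K + 1ℚ)
    r : ℚ
    r = 1/ (K + 1ℚ)
    0<r : 0ℚ < r
    0<r = ℚ.positive⁻¹ r {{ℚ.1/pos⇒pos (K + 1ℚ)}}

Cauchy : (ℕ → ℚ) → Set
Cauchy u = ∀ ε → 0ℚ ℚ.< ε →
  ∃ λ N → ∀ m n → N ℕ.≤ m → N ℕ.≤ n → ℚ.∣ u m ℚ.- u n ∣ ℚ.≤ ε

module SequenceLemmas where
  open RationalLemmas
  open import Data.Rational
  open import Data.Rational.Properties using (module ≤-Reasoning)
  open ≤-Reasoning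

  cauchy-ordered : ∀ {u} →
    (∀ ε → 0ℚ < ε → ∃ λ N → ∀ m n → N ℕ.≤ m → m ℕ.≤ n → ∣ u n - u m ∣ ≤ ε) → Cauchy u
  cauchy-ordered {u} c ε 0<ε with c ε 0<ε
  ... | N , h = N , λ m n N≤m N≤n → [ (λ m≤n → subst (_≤ ε) (∣p-q∣≡∣q-p∣ (u n) (u m)) (h m n N≤m m≤n))
                                   , (λ n≤m → h n m N≤n n≤m) ]′ (ℕ.≤-total m n)

  cauchy-const : ∀ q → Cauchy (λ _ → q)
  cauchy-const q ε 0<ε = 0 , λ _ _ _ _ →
    subst (_≤ ε) (sym (cong ∣_∣ (ℚ.+-inverseʳ q))) (ℚ.<⇒≤ 0<ε)

  cauchy-+ : ∀ {u v} → Cauchy u → Cauchy v → Cauchy (λ n → u n + v n)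
  cauchy-+ {u} {v} cu cv ε 0<ε with cu (ε * ½) (half-pos 0<ε) | cv (ε * ½) (half-pos 0<ε)
  ... | M , hu | N , hv = M ℕ.⊔ N , λ m n m≥ n≥ → begin
    ∣ (u m + v m) - (u n + v n) ∣     ≡⟨ cong ∣_∣ (lem (u m) (v m) (u n) (v n)) ⟩
    ∣ (u m - u n) + (v m - v n) ∣     ≤⟨ ℚ.∣p+q∣≤∣p∣+∣q∣ (u m - u n) (v m - v n) ⟩
    ∣ u m - u n ∣ + ∣ v m - v n ∣     ≤⟨ ℚ.+-mono-≤
      (hu m n (ℕ.m⊔n≤o⇒m≤o M N m≥) (ℕ.m⊔n≤o⇒m≤o M N n≥))
      (hv m n (ℕ.m⊔n≤o⇒n≤o M N m≥) (ℕ.m⊔n≤o⇒n≤o M N n≥)) ⟩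
    ε * ½ + ε * ½                     ≡⟨ halves ε ⟩
    ε                                 ∎
    where
    lem : ∀ a b c d → (a + b) - (c + d) ≡ (a - c) + (b - d)
    lem = RingSolver.solve-∀ ring

  cauchy-neg : ∀ {u} → Cauchy u → Cauchy (λ n → - u n)
  cauchy-neg {u} cu ε 0<ε with cu ε 0<ε
  ... | N , h = N , λ m n m≥ n≥ →
    subst (_≤ ε) (trans (∣p-q∣≡∣q-p∣ (u m) (u n)) (cong ∣_∣ (lem (u m) (u n)))) (h m n m≥ n≥)
    where
    lem : ∀ a b → b - a ≡ - a - - b
    lem = RingSolver.solve-∀ ring

  EventuallyBounded : (ℕ → ℚ) → Set
  EventuallyBounded u = ∃ λ B → 0ℚ ≤ B × ∃ λ N → ∀ n → N ℕ.≤ n → ∣ u n ∣ ≤ B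

  bounded : ∀ {u} → Cauchy u → EventuallyBounded u
  bounded {u} cu with cu 1ℚ (ℚ.positive⁻¹ 1ℚ)
  ... | N , h = ∣ u N ∣ + 1ℚ , 0≤+ (ℚ.0≤∣p∣ (u N)) (ℚ.<⇒≤ (ℚ.positive⁻¹ 1ℚ)) , N , λ n n≥ → begin
    ∣ u n ∣                  ≡⟨ cong ∣_∣ (lem (u n) (u N)) ⟩
    ∣ u N + (u n - u N) ∣    ≤⟨ ℚ.∣p+q∣≤∣p∣+∣q∣ (u N) (u n - u N) ⟩
    ∣ u N ∣ + ∣ u n - u N ∣  ≤⟨ ℚ.+-monoʳ-≤ ∣ u N ∣ (h n N n≥ ℕ.≤-refl) ⟩
    ∣ u N ∣ + 1ℚ             ∎
    where
    lem : ∀ a b → a ≡ b + (a - b)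
    lem = RingSolver.solve-∀ ring

  prod-diff : ∀ a b c d → ∣ a * b - c * d ∣ ≤ ∣ b - d ∣ * ∣ a ∣ + ∣ a - c ∣ * ∣ d ∣
  prod-diff a b c d = begin
    ∣ a * b - c * d ∣                      ≡⟨ cong ∣_∣ (lem a b c d) ⟩
    ∣ (b - d) * a + (a - c) * d ∣          ≤⟨ ℚ.∣p+q∣≤∣p∣+∣q∣ ((b - d) * a) ((a - c) * d) ⟩
    ∣ (b - d) * a ∣ + ∣ (a - c) * d ∣      ≡⟨ cong₂ _+_ (ℚ.∣p*q∣≡∣p∣*∣q∣ (b - d) a)
                                                      (ℚ.∣p*q∣≡∣p∣*∣q∣ (a - c) d) ⟩
    ∣ b - d ∣ * ∣ a ∣ + ∣ a - c ∣ * ∣ d ∣  ∎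
    where
    lem : ∀ a b c d → a * b - c * d ≡ (b - d) * a + (a - c) * d
    lem = RingSolver.solve-∀ ring

  cauchy-* : ∀ {u v} → Cauchy u → Cauchy v → Cauchy (λ n → u n * v n)
  cauchy-* {u} {v} cu cv ε 0<ε =
    let A , 0≤A , Na , ha = bounded cu
        B , 0≤B , Nb , hb = bounded cv
        α , 0<α , αA≤ = divide A 0≤A (half-pos 0<ε)
        β , 0<β , βB≤ = divide B 0≤B (half-pos 0<ε)
        M , hu = cu β 0<β
        N , hv = cv α 0<α
    in (Na ℕ.⊔ Nb) ℕ.⊔ (M ℕ.⊔ N) , λ m n m≥ n≥ →
    let m≥₁ = ℕ.m⊔n≤o⇒m≤o (Na ℕ.⊔ Nb) (M ℕ.⊔ N) m≥
        m≥₂ = ℕ.m⊔n≤o⇒n≤o (Na ℕ.⊔ Nb) (M ℕ.⊔ N) m≥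
        n≥₁ = ℕ.m⊔n≤o⇒m≤o (Na ℕ.⊔ Nb) (M ℕ.⊔ N) n≥
        n≥₂ = ℕ.m⊔n≤o⇒n≤o (Na ℕ.⊔ Nb) (M ℕ.⊔ N) n≥
    in ℚ.≤-trans (prod-diff (u m) (v m) (u n) (v n)) (ℚ.≤-trans (ℚ.+-mono-≤
      (*-mono {∣ v m - v n ∣} {α} {∣ u m ∣} {A} (ℚ.0≤∣p∣ (v m - v n)) 0≤A
        (hv m n (ℕ.m⊔n≤o⇒n≤o M N m≥₂) (ℕ.m⊔n≤o⇒n≤o M N n≥₂)) (ha m (ℕ.m⊔n≤o⇒m≤o Na Nb m≥₁)))
      (*-mono {∣ u m - u n ∣} {β} {∣ v n ∣} {B} (ℚ.0≤∣p∣ (u m - u n)) 0≤B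
        (hu m n (ℕ.m⊔n≤o⇒m≤o M N m≥₂) (ℕ.m⊔n≤o⇒m≤o M N n≥₂)) (hb n (ℕ.m⊔n≤o⇒n≤o Na Nb n≥₁))))
      (subst (α * A + β * B ≤_) (halves ε) (ℚ.+-mono-≤ αA≤ βB≤)))

  -- The convention at 0 is immaterial: a positive real is eventually
  -- represented by positive rationals.
  inverse : ℚ → ℚ
  inverse q with q ℚ.≟ 0ℚ
  ... | yes _  = 0ℚ
  ... | no q≢0 = (1/ q) {{≢-nonZero q≢0}}

  inverse-* : ∀ {q} → 0ℚ < q → inverse q * q ≡ 1ℚ
  inverse-* {q} 0<q with q ℚ.≟ 0ℚ
  ... | yes q≡0 = ⊥-elim (ℚ.<-irrefl (sym q≡0) 0<q)
  ... | no q≢0  = ℚ.*-inverseˡ q {{≢-nonZero q≢0}}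

  inverse-pos : ∀ {q} → 0ℚ < q → 0ℚ < inverse q
  inverse-pos {q} 0<q with q ℚ.≟ 0ℚ
  ... | yes q≡0 = ⊥-elim (ℚ.<-irrefl (sym q≡0) 0<q)
  ... | no q≢0  = ℚ.positive⁻¹ ((1/ q) {{≢-nonZero q≢0}}) {{ℚ.1/pos⇒pos q {{positive 0<q}}}}

  inverse-anti : ∀ {p q} → 0ℚ < p → p ≤ q → inverse q ≤ inverse p
  inverse-anti {p} {q} 0<p p≤q = begin
    inverse q                     ≡⟨ lem₁ ⟩
    inverse q * inverse p * p     ≤⟨ *-monoˡ (ℚ.<⇒≤ (0<* (inverse-pos 0<q) (inverse-pos 0<p))) p≤q ⟩
    inverse q * inverse p * q     ≡⟨ lem₂ ⟩
    inverse p                     ∎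
    where
    0<q : 0ℚ < q
    0<q = ℚ.<-≤-trans 0<p p≤q
    swap : ∀ a b c → a * b * c ≡ b * (a * c)
    swap = RingSolver.solve-∀ ring
    lem₁ : inverse q ≡ inverse q * inverse p * p
    lem₁ = trans (sym (ℚ.*-identityʳ (inverse q))) (trans (cong (inverse q *_) (sym (inverse-* 0<p)))
             (sym (ℚ.*-assoc (inverse q) (inverse p) p)))
    lem₂ : inverse q * inverse p * q ≡ inverse p
    lem₂ = trans (swap (inverse q) (inverse p) q)
             (trans (cong (inverse p *_) (inverse-* 0<q)) (ℚ.*-identityʳ (inverse p)))

  inverse-diff : ∀ {δ} x y → 0ℚ < δ → δ ≤ x → δ ≤ y →
    ∣ inverse x - inverse y ∣ ≤ ∣ y - x ∣ * (inverse δ * inverse δ)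
  inverse-diff {δ} x y 0<δ δ≤x δ≤y = begin
    ∣ inverse x - inverse y ∣                ≡⟨ cong ∣_∣ expand ⟩
    ∣ (y - x) * (inverse x * inverse y) ∣    ≡⟨ ℚ.∣p*q∣≡∣p∣*∣q∣ (y - x) (inverse x * inverse y) ⟩
    ∣ y - x ∣ * ∣ inverse x * inverse y ∣    ≡⟨ cong (∣ y - x ∣ *_) (ℚ.0≤p⇒∣p∣≡p
                                                 (0≤* {inverse x} {inverse y} 0≤x⁻¹ 0≤y⁻¹)) ⟩
    ∣ y - x ∣ * (inverse x * inverse y)      ≤⟨ *-monoˡ {∣ y - x ∣} (ℚ.0≤∣p∣ (y - x))
      (*-mono {inverse x} {inverse δ} {inverse y} {inverse δ} 0≤x⁻¹ (ℚ.<⇒≤ (inverse-pos 0<δ))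
        (inverse-anti 0<δ δ≤x) (inverse-anti 0<δ δ≤y)) ⟩
    ∣ y - x ∣ * (inverse δ * inverse δ)      ∎
    where
    0<x : 0ℚ < x
    0<x = ℚ.<-≤-trans 0<δ δ≤x
    0<y : 0ℚ < y
    0<y = ℚ.<-≤-trans 0<δ δ≤y
    0≤x⁻¹ : 0ℚ ≤ inverse x
    0≤x⁻¹ = ℚ.<⇒≤ (inverse-pos 0<x)
    0≤y⁻¹ : 0ℚ ≤ inverse y
    0≤y⁻¹ = ℚ.<⇒≤ (inverse-pos 0<y)
    lem : ∀ a b x y → a * (b * y) - b * (a * x) ≡ (y - x) * (a * b)
    lem = RingSolver.solve-∀ ring
    expand : inverse x - inverse y ≡ (y - x) * (inverse x * inverse y)
    expand = trans (cong₂ _-_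
      (sym (trans (cong (inverse x *_) (inverse-* 0<y)) (ℚ.*-identityʳ (inverse x))))
      (sym (trans (cong (inverse y *_) (inverse-* 0<x)) (ℚ.*-identityʳ (inverse y)))))
      (lem (inverse x) (inverse y) x y)

  EventuallyPositive : (ℕ → ℚ) → Set
  EventuallyPositive u = ∃ λ δ → 0ℚ < δ × ∃ λ N → ∀ n → N ℕ.≤ n → 0ℚ + δ ≤ u n

  cauchy-inverse : ∀ {u} → Cauchy u → EventuallyPositive u → Cauchy (λ n → inverse (u n))
  cauchy-inverse {u} cu (δ , 0<δ , M , hδ) ε 0<ε =
    let η , 0<η , η≤ = divide (inverse δ * inverse δ) (ℚ.<⇒≤ (0<* (inverse-pos 0<δ) (inverse-pos 0<δ))) 0<ε
        N , hu = cu η 0<η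
    in M ℕ.⊔ N , λ m n m≥ n≥ →
    let um≥ = subst (_≤ u m) (ℚ.+-identityˡ δ) (hδ m (ℕ.m⊔n≤o⇒m≤o M N m≥))
        un≥ = subst (_≤ u n) (ℚ.+-identityˡ δ) (hδ n (ℕ.m⊔n≤o⇒m≤o M N n≥))
    in ℚ.≤-trans (inverse-diff (u m) (u n) 0<δ um≥ un≥) (ℚ.≤-trans
         (*-monoʳ {inverse δ * inverse δ} {∣ u n - u m ∣} {η} (ℚ.<⇒≤ (0<* (inverse-pos 0<δ) (inverse-pos 0<δ)))
           (hu n m (ℕ.m⊔n≤o⇒n≤o M N n≥) (ℕ.m⊔n≤o⇒n≤o M N m≥)))
         η≤)

sum : (ℕ → ℚ) → ℕ → ℚ
sum f zero    = 0ℚ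
sum f (suc n) = sum f n ℚ.+ f n

-- q ^ j / j !
expTerm : ℚ → ℕ → ℚ
expTerm q zero    = 1ℚ
expTerm q (suc j) = expTerm q j ℚ.* q ℚ.* (1ℤ ℚ./ suc j)

expSum : ℚ → ℕ → ℚ
expSum q n = sum (expTerm q) n

-- The right-endpoint Riemann sum of ∫₁ⁿ dt / t over (n - 1) M intervals of
-- length 1 / M, where M = k + 1:  ∑ (1 / M) (1 / (1 + i / M)) for
-- 1 ≤ i ≤ (n - 1) M, that is, ∑ 1 / (M + i).
logSeq : ℕ → ℕ → ℚ
logSeq n k = sum (λ i → 1ℤ ℚ./ suc (suc k ℕ.+ i)) ((n ℕ.∸ 1) ℕ.* suc k)

isqrt : ℕ → ℕ
isqrt zero    = 0
isqrt (suc n) with suc (isqrt n) ℕ.* suc (isqrt n) ℕ.≤? suc n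
... | yes _ = suc (isqrt n)
... | no _  = isqrt n

-- ⌊ √(n M²) ⌋ / M with M = k + 1
sqrtSeq : ℕ → ℕ → ℚ
sqrtSeq n k = + isqrt (n ℕ.* (suc k ℕ.* suc k)) ℚ./ suc k

module ExpLemmas where
  open RationalLemmas
  open SequenceLemmas
  open import Data.Rational
  open import Data.Rational.Properties using (module ≤-Reasoning)
  open ≤-Reasoning

  expTerm-nonNeg : ∀ {B} → 0ℚ ≤ B → ∀ j → 0ℚ ≤ expTerm B j
  expTerm-nonNeg 0≤B zero = ℚ.<⇒≤ (ℚ.positive⁻¹ 1ℚ)
  expTerm-nonNeg {B} 0≤B (suc j) =
    0≤* {expTerm B j * B} {recip j} (0≤* {expTerm B j} {B} (expTerm-nonNeg 0≤B j) 0≤B) (0≤recip j)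

  expTerm-∣∣ : ∀ {a B} → 0ℚ ≤ B → ∣ a ∣ ≤ B → ∀ j → ∣ expTerm a j ∣ ≤ expTerm B j
  expTerm-∣∣ 0≤B a≤B zero = ℚ.≤-refl
  expTerm-∣∣ {a} {B} 0≤B a≤B (suc j) = begin
    ∣ expTerm a j * a * recip j ∣           ≡⟨ ℚ.∣p*q∣≡∣p∣*∣q∣ (expTerm a j * a) (recip j) ⟩
    ∣ expTerm a j * a ∣ * ∣ recip j ∣       ≡⟨ cong₂ _*_ (ℚ.∣p*q∣≡∣p∣*∣q∣ (expTerm a j) a)
                                                          (ℚ.0≤p⇒∣p∣≡p (0≤recip j)) ⟩
    ∣ expTerm a j ∣ * ∣ a ∣ * recip j       ≤⟨ *-monoʳ {recip j} (0≤recip j)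
      (*-mono {∣ expTerm a j ∣} {expTerm B j} {∣ a ∣} {B} (ℚ.0≤∣p∣ (expTerm a j)) 0≤B
        (expTerm-∣∣ 0≤B a≤B j) a≤B) ⟩
    expTerm B j * B * recip j               ∎

  step-diff : ∀ s t a b r {B d S T} → 0ℚ ≤ r → 0ℚ ≤ B → 0ℚ ≤ d → ∣ b ∣ ≤ B → ∣ s ∣ ≤ S →
    ∣ a - b ∣ ≤ d → ∣ s - t ∣ ≤ T → ∣ s * a * r - t * b * r ∣ ≤ (d * S + T * B) * r
  step-diff s t a b r {B} {d} {S} {T} 0≤r 0≤B 0≤d b≤B s≤S ab≤d st≤T = begin
    ∣ s * a * r - t * b * r ∣                         ≡⟨ cong ∣_∣ (lem s t a b r) ⟩
    ∣ (s * a - t * b) * r ∣                           ≡⟨ ℚ.∣p*q∣≡∣p∣*∣q∣ (s * a - t * b) r ⟩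
    ∣ s * a - t * b ∣ * ∣ r ∣                         ≡⟨ cong (∣ s * a - t * b ∣ *_) (ℚ.0≤p⇒∣p∣≡p 0≤r) ⟩
    ∣ s * a - t * b ∣ * r                             ≤⟨ *-monoʳ {r} 0≤r (prod-diff s a t b) ⟩
    (∣ a - b ∣ * ∣ s ∣ + ∣ s - t ∣ * ∣ b ∣) * r       ≤⟨ *-monoʳ {r} 0≤r (ℚ.+-mono-≤
      (ℚ.≤-trans (*-monoˡ {∣ a - b ∣} (ℚ.0≤∣p∣ (a - b)) s≤S)
                 (*-monoʳ {S} (ℚ.≤-trans (ℚ.0≤∣p∣ s) s≤S) ab≤d))
      (*-mono {∣ s - t ∣} {T} {∣ b ∣} {B} (ℚ.0≤∣p∣ (s - t)) 0≤B st≤T b≤B)) ⟩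
    (d * S + T * B) * r                               ∎
    where
    lem : ∀ s t a b r → s * a * r - t * b * r ≡ (s * a - t * b) * r
    lem = RingSolver.solve-∀ ring

  collapse : ∀ d t B r r′ c → r * c ≡ 1ℚ → r′ * (1ℚ + c) ≡ 1ℚ →
    (d * (t * B * r) + d * t * B) * r′ ≡ d * (t * B * r)
  collapse d t B r r′ c rc r′c = begin-equality
    (d * (t * B * r) + d * t * B) * r′              ≡⟨ cong (λ z → (d * (t * B * r) + z) * r′)
                                                         (sym (ℚ.*-identityʳ (d * t * B))) ⟩
    (d * (t * B * r) + d * t * B * 1ℚ) * r′         ≡⟨ cong (λ z → (d * (t * B * r) + d * t * B * z) * r′) (sym rc) ⟩
    (d * (t * B * r) + d * t * B * (r * c)) * r′    ≡⟨ lem d t B r r′ c ⟩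
    d * (t * B * r) * (r′ * (1ℚ + c))               ≡⟨ cong (d * (t * B * r) *_) r′c ⟩
    d * (t * B * r) * 1ℚ                            ≡⟨ ℚ.*-identityʳ (d * (t * B * r)) ⟩
    d * (t * B * r)                                 ∎
    where
    lem : ∀ d t B r r′ c → (d * (t * B * r) + d * t * B * (r * c)) * r′ ≡ d * (t * B * r) * (r′ * (1ℚ + c))
    lem = RingSolver.solve-∀ ring

  expTerm-diff : ∀ {a b B} → 0ℚ ≤ B → ∣ a ∣ ≤ B → ∣ b ∣ ≤ B →
    ∀ j → ∣ expTerm a (suc j) - expTerm b (suc j) ∣ ≤ ∣ a - b ∣ * expTerm B j
  expTerm-diff {a} {b} {B} 0≤B a≤B b≤B zero = ℚ.≤-reflexive (trans (cong ∣_∣ eq) (sym (ℚ.*-identityʳ ∣ a - b ∣)))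
    where
    lem : ∀ a b → 1ℚ * a * 1ℚ - 1ℚ * b * 1ℚ ≡ a - b
    lem = RingSolver.solve-∀ ring
    eq : expTerm a 1 - expTerm b 1 ≡ a - b
    eq = lem a b
  expTerm-diff {a} {b} {B} 0≤B a≤B b≤B (suc j) = ℚ.≤-trans
    (step-diff (expTerm a (suc j)) (expTerm b (suc j)) a b (recip (suc j))
      {B} {∣ a - b ∣} {expTerm B (suc j)} {∣ a - b ∣ * expTerm B j}
      (0≤recip (suc j)) 0≤B (ℚ.0≤∣p∣ (a - b)) b≤B (expTerm-∣∣ 0≤B a≤B (suc j)) ℚ.≤-refl
      (expTerm-diff 0≤B a≤B b≤B j))
    (ℚ.≤-reflexive (collapse ∣ a - b ∣ (expTerm B j) B (recip j) (recip (suc j)) (fromℕ (suc j))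
      (recip-fromℕ j)
      (trans (cong (recip (suc j) *_) (sym (fromℕ-+ 1 (suc j)))) (recip-fromℕ (suc j)))))

  sum-mono : ∀ {f} → (∀ j → 0ℚ ≤ f j) → ∀ {m n} → m ℕ.≤ n → sum f m ≤ sum f n
  sum-mono {f} 0≤f {m} {n} m≤n = go (ℕ.≤⇒≤′ m≤n)
    where
    go : ∀ {n} → m ℕ.≤′ n → sum f m ≤ sum f n
    go ℕ.≤′-refl = ℚ.≤-refl
    go {suc n} (ℕ.≤′-step m≤n) = ℚ.≤-trans (go m≤n) (p≤p+q {sum f n} {f n} (0≤f n))

  sub-+ : ∀ p q r s → (p + q) - (r + s) ≡ (p - r) + (q - s)
  sub-+ = RingSolver.solve-∀ ring

  -- The first term of the exponential series is constant, so the partial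
  -- sums with m + 1 terms are compared with those of the bound with m terms.
  expSum-diff : ∀ {a b B} → 0ℚ ≤ B → ∣ a ∣ ≤ B → ∣ b ∣ ≤ B →
    ∀ m → ∣ expSum a (suc m) - expSum b (suc m) ∣ ≤ ∣ a - b ∣ * expSum B m
  expSum-diff {a} {b} 0≤B a≤B b≤B zero = ℚ.≤-reflexive (sym (ℚ.*-zeroʳ ∣ a - b ∣))
  expSum-diff {a} {b} {B} 0≤B a≤B b≤B (suc m) = go (expSum a (suc m)) (expTerm a (suc m)) (expSum b (suc m))
    (expTerm b (suc m)) (expSum-diff 0≤B a≤B b≤B m) (expTerm-diff 0≤B a≤B b≤B m)
    where
    go : ∀ p q r s → ∣ p - r ∣ ≤ ∣ a - b ∣ * expSum B m → ∣ q - s ∣ ≤ ∣ a - b ∣ * expTerm B m →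
      ∣ (p + q) - (r + s) ∣ ≤ ∣ a - b ∣ * (expSum B m + expTerm B m)
    go p q r s pr qs = begin
      ∣ (p + q) - (r + s) ∣                               ≡⟨ cong ∣_∣ (sub-+ p q r s) ⟩
      ∣ (p - r) + (q - s) ∣                               ≤⟨ ℚ.∣p+q∣≤∣p∣+∣q∣ (p - r) (q - s) ⟩
      ∣ p - r ∣ + ∣ q - s ∣                               ≤⟨ ℚ.+-mono-≤ pr qs ⟩
      ∣ a - b ∣ * expSum B m + ∣ a - b ∣ * expTerm B m    ≡⟨ sym (ℚ.*-distribˡ-+ ∣ a - b ∣ (expSum B m) (expTerm B m)) ⟩
      ∣ a - b ∣ * (expSum B m + expTerm B m)              ∎

  expSum-tail : ∀ {a B} → 0ℚ ≤ B → ∣ a ∣ ≤ B →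
    ∀ {m n} → m ℕ.≤ n → ∣ expSum a n - expSum a m ∣ ≤ expSum B n - expSum B m
  expSum-tail {a} {B} 0≤B a≤B {m} {n} m≤n = go (ℕ.≤⇒≤′ m≤n)
    where
    step : ∀ p q r p′ q′ r′ → ∣ p - r ∣ ≤ p′ - r′ → ∣ q ∣ ≤ q′ → ∣ (p + q) - r ∣ ≤ (p′ + q′) - r′
    step p q r p′ q′ r′ pr qq = begin
      ∣ (p + q) - r ∣       ≡⟨ cong ∣_∣ (lem p q r) ⟩
      ∣ (p - r) + q ∣       ≤⟨ ℚ.∣p+q∣≤∣p∣+∣q∣ (p - r) q ⟩
      ∣ p - r ∣ + ∣ q ∣     ≤⟨ ℚ.+-mono-≤ pr qq ⟩
      (p′ - r′) + q′        ≡⟨ sym (lem p′ q′ r′) ⟩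
      (p′ + q′) - r′        ∎
      where
      lem : ∀ p q r → (p + q) - r ≡ (p - r) + q
      lem = RingSolver.solve-∀ ring
    go : ∀ {n} → m ℕ.≤′ n → ∣ expSum a n - expSum a m ∣ ≤ expSum B n - expSum B m
    go ℕ.≤′-refl = ℚ.≤-reflexive (trans (cong ∣_∣ (ℚ.+-inverseʳ (expSum a m)))
                                        (sym (ℚ.+-inverseʳ (expSum B m))))
    go {suc n} (ℕ.≤′-step m≤n) = step (expSum a n) (expTerm a n) (expSum a m)
      (expSum B n) (expTerm B n) (expSum B m) (go m≤n) (expTerm-∣∣ 0≤B a≤B n)

  module Tail {B : ℚ} (0≤B : 0ℚ ≤ B) (J : ℕ) (B/j≤½ : ∀ j → J ℕ.≤ j → B * recip j ≤ ½) where

    halving : ∀ j → J ℕ.≤ j → expTerm B (suc j) + expTerm B (suc j) ≤ expTerm B j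
    halving j J≤j = go (expTerm B j) (recip j) (expTerm-nonNeg 0≤B j) (B/j≤½ j J≤j)
      where
      lem : ∀ t r → t * B * r + t * B * r ≡ t * (B * r) + t * (B * r)
      lem t r = cong₂ _+_ (ℚ.*-assoc t B r) (ℚ.*-assoc t B r)
      go : ∀ t r → 0ℚ ≤ t → B * r ≤ ½ → t * B * r + t * B * r ≤ t
      go t r 0≤t h = begin
        t * B * r + t * B * r        ≡⟨ lem t r ⟩
        t * (B * r) + t * (B * r)    ≤⟨ ℚ.+-mono-≤ (*-monoˡ {t} 0≤t h) (*-monoˡ {t} 0≤t h) ⟩
        t * ½ + t * ½                ≡⟨ halves t ⟩
        t                            ∎

    twice : ℕ → ℚ
    twice j = expTerm B j + expTerm B j

    0≤twice : ∀ j → 0ℚ ≤ twice j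
    0≤twice j = 0≤+ (expTerm-nonNeg 0≤B j) (expTerm-nonNeg 0≤B j)

    potential : ∀ {m n} → J ℕ.≤ m → m ℕ.≤ n → expSum B n + twice n ≤ expSum B m + twice m
    potential {m} {n} J≤m m≤n = go (ℕ.≤⇒≤′ m≤n)
      where
      step : ∀ e t t′ → t′ + t′ ≤ t → (e + t) + (t′ + t′) ≤ e + (t + t)
      step e t t′ h = ℚ.≤-trans (ℚ.+-monoʳ-≤ (e + t) h) (ℚ.≤-reflexive (ℚ.+-assoc e t t))
      go : ∀ {n} → m ℕ.≤′ n → expSum B n + twice n ≤ expSum B m + twice m
      go ℕ.≤′-refl = ℚ.≤-refl
      go {suc n} (ℕ.≤′-step m≤n) = ℚ.≤-trans
        (step (expSum B n) (expTerm B n) (expTerm B (suc n)) (halving n (ℕ.≤-trans J≤m (ℕ.≤′⇒≤ m≤n))))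
        (go m≤n)

    expTerm-anti : ∀ {m} → J ℕ.≤ m → expTerm B m ≤ expTerm B J
    expTerm-anti {m} J≤m = go (ℕ.≤⇒≤′ J≤m)
      where
      go : ∀ {m} → J ℕ.≤′ m → expTerm B m ≤ expTerm B J
      go ℕ.≤′-refl = ℚ.≤-refl
      go {suc m} (ℕ.≤′-step J≤m) = ℚ.≤-trans (p≤p+q {expTerm B (suc m)} (expTerm-nonNeg 0≤B (suc m)))
        (ℚ.≤-trans (halving m (ℕ.≤′⇒≤ J≤m)) (go J≤m))

    K : ℚ
    K = expSum B J + twice J

    0≤K : 0ℚ ≤ K
    0≤K = 0≤+ (sum-mono {expTerm B} (expTerm-nonNeg 0≤B) {0} {J} z≤n) (0≤twice J)

    expSum≤K : ∀ {n} → J ℕ.≤ n → expSum B n ≤ K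
    expSum≤K {n} J≤n = ℚ.≤-trans (p≤p+q {expSum B n} {twice n} (0≤twice n)) (potential ℕ.≤-refl J≤n)

    tail≤twice : ∀ {m n} → J ℕ.≤ m → m ℕ.≤ n → expSum B n - expSum B m ≤ twice m
    tail≤twice {m} {n} J≤m m≤n = go (expSum B n) (expSum B m) (twice n) (twice m)
        (0≤twice n) (potential J≤m m≤n)
      where
      go : ∀ e e′ t t′ → 0ℚ ≤ t → e + t ≤ e′ + t′ → e - e′ ≤ t′
      go e e′ t t′ 0≤t h = begin
        e - e′             ≤⟨ ℚ.+-monoˡ-≤ (- e′) (ℚ.≤-trans (p≤p+q {e} {t} 0≤t) h) ⟩
        (e′ + t′) - e′     ≡⟨ lem e′ t′ ⟩
        t′                 ∎
        where
        lem : ∀ a b → (a + b) - a ≡ b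
        lem = RingSolver.solve-∀ ring

    C : ℚ
    C = (expTerm B J + expTerm B J) * B

    twice≤ : ∀ {m} → J ℕ.≤ m → twice (suc m) ≤ C * recip m
    twice≤ {m} J≤m = go (expTerm B m) (expTerm B J) (recip m) (0≤recip m) (expTerm-anti J≤m)
      where
      go : ∀ t T r → 0ℚ ≤ r → t ≤ T → t * B * r + t * B * r ≤ (T + T) * B * r
      go t T r 0≤r t≤T = begin
        t * B * r + t * B * r   ≡⟨ lem t B r ⟩
        (t + t) * B * r         ≤⟨ *-monoʳ {r} 0≤r (*-monoʳ {B} 0≤B (ℚ.+-mono-≤ t≤T t≤T)) ⟩
        (T + T) * B * r         ∎
        where
        lem : ∀ t B r → t * B * r + t * B * r ≡ (t + t) * B * r
        lem = RingSolver.solve-∀ ring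

  cauchy-exp : ∀ {u} → Cauchy u → Cauchy (λ k → expSum (u k) k)
  cauchy-exp {u} cu = cauchy-ordered {λ k → expSum (u k) k} λ ε 0<ε →
    let B , 0≤B , N₀ , hB = bounded cu
        J , hJ = archimedean-recip B 0<½
        open Tail {B} 0≤B J hJ
        N₁ , hC = archimedean-recip C (half-pos 0<ε)
        δ , 0<δ , δK≤ = divide K 0≤K (half-pos 0<ε)
        N₂ , hu = cu δ 0<δ
        N = (N₀ ℕ.⊔ N₂) ℕ.⊔ (J ℕ.⊔ N₁)
        N₀≤N = ℕ.≤-trans (ℕ.m≤m⊔n N₀ N₂) (ℕ.m≤m⊔n (N₀ ℕ.⊔ N₂) (J ℕ.⊔ N₁))
        N₂≤N = ℕ.≤-trans (ℕ.m≤n⊔m N₀ N₂) (ℕ.m≤m⊔n (N₀ ℕ.⊔ N₂) (J ℕ.⊔ N₁))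
        J≤N  = ℕ.≤-trans (ℕ.m≤m⊔n J N₁) (ℕ.m≤n⊔m (N₀ ℕ.⊔ N₂) (J ℕ.⊔ N₁))
        N₁≤N = ℕ.≤-trans (ℕ.m≤n⊔m J N₁) (ℕ.m≤n⊔m (N₀ ℕ.⊔ N₂) (J ℕ.⊔ N₁))
    in suc N , λ { (suc m) n (s≤s N≤m) m<n →
      let N≤n = ℕ.≤-trans N≤m (ℕ.≤-trans (ℕ.n≤1+n m) m<n)
          N≤sm = ℕ.m≤n⇒m≤1+n N≤m
      in close ε (expSum (u n) n) (expSum (u n) (suc m)) (expSum (u (suc m)) (suc m))
        (ℚ.≤-trans (expSum-tail 0≤B (hB n (ℕ.≤-trans N₀≤N N≤n)) m<n)
          (ℚ.≤-trans (tail≤twice (ℕ.≤-trans J≤N N≤sm) m<n)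
          (ℚ.≤-trans (twice≤ (ℕ.≤-trans J≤N N≤m)) (hC m (ℕ.≤-trans N₁≤N N≤m)))))
        (ℚ.≤-trans (expSum-diff {u n} {u (suc m)} 0≤B (hB n (ℕ.≤-trans N₀≤N N≤n)) (hB (suc m) (ℕ.≤-trans N₀≤N N≤sm)) m)
          (ℚ.≤-trans (*-mono {∣ u n - u (suc m) ∣} {δ} {expSum B m} {K} (ℚ.0≤∣p∣ (u n - u (suc m))) 0≤K
            (hu n (suc m) (ℕ.≤-trans N₂≤N N≤n) (ℕ.≤-trans N₂≤N N≤sm)) (expSum≤K (ℕ.≤-trans J≤N N≤m)))
          δK≤)) }
    where
    close : ∀ ε p q r → ∣ p - q ∣ ≤ ε * ½ → ∣ q - r ∣ ≤ ε * ½ → ∣ p - r ∣ ≤ ε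
    close ε p q r pq qr = begin
      ∣ p - r ∣               ≡⟨ cong ∣_∣ (lem p q r) ⟩
      ∣ (p - q) + (q - r) ∣   ≤⟨ ℚ.∣p+q∣≤∣p∣+∣q∣ (p - q) (q - r) ⟩
      ∣ p - q ∣ + ∣ q - r ∣   ≤⟨ ℚ.+-mono-≤ pq qr ⟩
      ε * ½ + ε * ½           ≡⟨ halves ε ⟩
      ε                       ∎
      where
      lem : ∀ p q r → p - r ≡ (p - q) + (q - r)
      lem = RingSolver.solve-∀ ring

module SqrtLemmas where
  open RationalLemmas
  open SequenceLemmas
  open import Data.Rational
  open import Data.Rational.Properties using (module ≤-Reasoning)

  isqrt-lower : ∀ n → isqrt n ℕ.* isqrt n ℕ.≤ n
  isqrt-lower zero = z≤n
  isqrt-lower (suc n) with suc (isqrt n) ℕ.* suc (isqrt n) ℕ.≤? suc n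
  ... | yes p = p
  ... | no _  = ℕ.m≤n⇒m≤1+n (isqrt-lower n)

  isqrt-upper : ∀ n → n ℕ.< suc (isqrt n) ℕ.* suc (isqrt n)
  isqrt-upper zero = s≤s z≤n
  isqrt-upper (suc n) with suc (isqrt n) ℕ.* suc (isqrt n) ℕ.≤? suc n
  ... | yes _ = ℕ.≤-<-trans (isqrt-upper n) (ℕ.*-mono-< (ℕ.n<1+n (suc (isqrt n))) (ℕ.n<1+n (suc (isqrt n))))
  ... | no p  = ℕ.≰⇒> p

  square-cancel-< : ∀ {m n} → m ℕ.* m ℕ.< n ℕ.* n → m ℕ.< n
  square-cancel-< {m} {n} h with m ℕ.<? n
  ... | yes p = p
  ... | no p  = ⊥-elim (ℕ.<-irrefl refl (ℕ.<-≤-trans h (ℕ.*-mono-≤ (ℕ.≮⇒≥ p) (ℕ.≮⇒≥ p))))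

  isqrt-cross : ∀ n j k →
    isqrt (n ℕ.* (suc j ℕ.* suc j)) ℕ.* suc k ℕ.≤ suc (isqrt (n ℕ.* (suc k ℕ.* suc k))) ℕ.* suc j
  isqrt-cross n j k = ℕ.<⇒≤ (square-cancel-< (begin-strict
    (a ℕ.* suc k) ℕ.* (a ℕ.* suc k)           ≡⟨ lem a (suc k) ⟩
    (a ℕ.* a) ℕ.* (suc k ℕ.* suc k)           ≤⟨ ℕ.*-monoˡ-≤ (suc k ℕ.* suc k) (isqrt-lower (n ℕ.* (suc j ℕ.* suc j))) ⟩
    n ℕ.* (suc j ℕ.* suc j) ℕ.* (suc k ℕ.* suc k) ≡⟨ lem′ n (suc j ℕ.* suc j) (suc k ℕ.* suc k) ⟩
    n ℕ.* (suc k ℕ.* suc k) ℕ.* (suc j ℕ.* suc j) <⟨ ℕ.*-monoˡ-< (suc j ℕ.* suc j) (isqrt-upper (n ℕ.* (suc k ℕ.* suc k))) ⟩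
    (suc b ℕ.* suc b) ℕ.* (suc j ℕ.* suc j)   ≡⟨ sym (lem (suc b) (suc j)) ⟩
    (suc b ℕ.* suc j) ℕ.* (suc b ℕ.* suc j)   ∎))
    where
    open ℕ.≤-Reasoning
    a b : ℕ
    a = isqrt (n ℕ.* (suc j ℕ.* suc j))
    b = isqrt (n ℕ.* (suc k ℕ.* suc k))
    lem : ∀ x y → (x ℕ.* y) ℕ.* (x ℕ.* y) ≡ (x ℕ.* x) ℕ.* (y ℕ.* y)
    lem = ℕSolver.solve-∀
    lem′ : ∀ x y z → x ℕ.* y ℕ.* z ≡ x ℕ.* z ℕ.* y
    lem′ = ℕSolver.solve-∀

  /-recip : ∀ a k → + a / suc k ≡ fromℕ a * recip k
  /-recip a k = ℚ.toℚᵘ-injective (ℚᵘ.≃-trans (toℚᵘ-/ (+ a) k) (ℚᵘ.≃-sym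
    (ℚᵘ.≃-trans (ℚ.toℚᵘ-homo-* (fromℕ a) (recip k))
    (ℚᵘ.≃-trans (ℚᵘ.*-cong (toℚᵘ-/ (+ a) 0) (toℚᵘ-/ 1ℤ k)) (ℚᵘ.*≡*
      (cong₂ ℤ._*_ (ℤ.*-identityʳ (+ a)) (cong +_ (sym (ℕ.*-identityˡ (suc k))))))))))

  cross-≤ : ∀ a b j k → a ℕ.* suc k ℕ.≤ suc b ℕ.* suc j → + a / suc j ≤ + b / suc k + recip k
  cross-≤ a b j k h = begin
    + a / suc j                                              ≡⟨ /-recip a j ⟩
    fromℕ a * recip j                                        ≡⟨ lem₁ (fromℕ a) (recip j) (recip k) (fromℕ (suc k)) (recip-fromℕ k) ⟩
    (fromℕ a * fromℕ (suc k)) * (recip j * recip k)          ≡⟨ cong (_* (recip j * recip k)) (sym (fromℕ-* a (suc k))) ⟩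
    fromℕ (a ℕ.* suc k) * (recip j * recip k)                ≤⟨ *-monoʳ {recip j * recip k}
        (0≤* {recip j} {recip k} (0≤recip j) (0≤recip k)) (fromℕ-mono h) ⟩
    fromℕ (suc b ℕ.* suc j) * (recip j * recip k)            ≡⟨ cong (_* (recip j * recip k)) (fromℕ-* (suc b) (suc j)) ⟩
    (fromℕ (suc b) * fromℕ (suc j)) * (recip j * recip k)    ≡⟨ cong (λ z → (z * fromℕ (suc j)) * (recip j * recip k)) (fromℕ-+ 1 b) ⟩
    ((1ℚ + fromℕ b) * fromℕ (suc j)) * (recip j * recip k)   ≡⟨ lem₂ (fromℕ b) (recip k) (recip j) (fromℕ (suc j)) (recip-fromℕ j) ⟩
    fromℕ b * recip k + recip k                              ≡⟨ cong (_+ recip k) (sym (/-recip b k)) ⟩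
    + b / suc k + recip k                                    ∎
    where
    open ≤-Reasoning
    lem₁ : ∀ x r s c → s * c ≡ 1ℚ → x * r ≡ (x * c) * (r * s)
    lem₁ x r s c sc = trans (sym (ℚ.*-identityʳ (x * r))) (trans (cong (x * r *_) (sym sc)) (lem x r s c))
      where
      lem : ∀ x r s c → x * r * (s * c) ≡ (x * c) * (r * s)
      lem = RingSolver.solve-∀ ring
    lem₂ : ∀ y s r c → r * c ≡ 1ℚ → ((1ℚ + y) * c) * (r * s) ≡ y * s + s
    lem₂ y s r c rc = trans (lem y s r c) (trans (cong ((y * s + s) *_) rc) (ℚ.*-identityʳ (y * s + s)))
      where
      lem : ∀ y s r c → ((1ℚ + y) * c) * (r * s) ≡ (y * s + s) * (r * c)
      lem = RingSolver.solve-∀ ring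

  recip-anti : ∀ {j k} → j ℕ.≤ k → recip k ≤ recip j
  recip-anti {j} {k} j≤k = ℚ.toℚᵘ-cancel-≤ (ℚᵘ.≤-respʳ-≃ (ℚᵘ.≃-sym (toℚᵘ-/ 1ℤ j))
    (ℚᵘ.≤-respˡ-≃ (ℚᵘ.≃-sym (toℚᵘ-/ 1ℤ k)) (ℚᵘ.*≤* (ℤ.*-monoˡ-≤-nonNeg 1ℤ (ℤ.+≤+ (s≤s j≤k))))))

  recip-eventually-≤ : ∀ {ε} → 0ℚ < ε → ∃ λ N → ∀ n → N ℕ.≤ n → recip n ≤ ε
  recip-eventually-≤ {ε} 0<ε = let N , h = archimedean-recip 1ℚ 0<ε in
    N , λ n N≤n → subst (_≤ ε) (ℚ.*-identityˡ (recip n)) (h n N≤n)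

  cauchy-recip : ∀ {u} → (∀ m n → u m ≤ u n + recip n) → Cauchy u
  cauchy-recip {u} h ε 0<ε = let N , r≤ = recip-eventually-≤ 0<ε in
    N , λ m n N≤m N≤n → dist-≤ {u m} {u n} {ε}
      (ℚ.≤-trans (h m n) (ℚ.+-monoʳ-≤ (u n) (r≤ n N≤n)))
      (ℚ.≤-trans (h n m) (ℚ.+-monoʳ-≤ (u m) (r≤ m N≤m)))

  cauchy-sqrt : ∀ n → Cauchy (sqrtSeq n)
  cauchy-sqrt n = cauchy-recip {sqrtSeq n} λ j k →
    cross-≤ (isqrt (n ℕ.* (suc j ℕ.* suc j))) (isqrt (n ℕ.* (suc k ℕ.* suc k))) j k (isqrt-cross n j k)

module LogLemmas where
  open RationalLemmas
  open SqrtLemmas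
  open import Data.Rational
  open import Data.Rational.Properties using (module ≤-Reasoning)
  open ≤-Reasoning

  sum-≤ : ∀ {f g : ℕ → ℚ} → (∀ i → f i ≤ g i) → ∀ n → sum f n ≤ sum g n
  sum-≤ h zero = ℚ.≤-refl
  sum-≤ {f} {g} h (suc n) = ℚ.+-mono-≤ {sum f n} {sum g n} {f n} {g n} (sum-≤ h n) (h n)

  sum-cong : ∀ {f g : ℕ → ℚ} → (∀ i → f i ≡ g i) → ∀ n → sum f n ≡ sum g n
  sum-cong h zero = refl
  sum-cong h (suc n) = cong₂ _+_ (sum-cong h n) (h n)

  sum-+ : ∀ f m n → sum f (m ℕ.+ n) ≡ sum f m + sum (λ i → f (m ℕ.+ i)) n
  sum-+ f m zero = trans (cong (sum f) (ℕ.+-identityʳ m)) (sym (ℚ.+-identityʳ (sum f m)))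
  sum-+ f m (suc n) = begin-equality
    sum f (m ℕ.+ suc n)                                       ≡⟨ cong (sum f) (ℕ.+-suc m n) ⟩
    sum f (m ℕ.+ n) + f (m ℕ.+ n)                             ≡⟨ cong (_+ f (m ℕ.+ n)) (sum-+ f m n) ⟩
    sum f m + sum (λ i → f (m ℕ.+ i)) n + f (m ℕ.+ n)         ≡⟨ ℚ.+-assoc (sum f m) (sum (λ i → f (m ℕ.+ i)) n) (f (m ℕ.+ n)) ⟩
    sum f m + (sum (λ i → f (m ℕ.+ i)) n + f (m ℕ.+ n))       ∎

  sum-blocks : ∀ f a K → sum f (a ℕ.* K) ≡ sum (λ i → sum (λ r → f (i ℕ.* K ℕ.+ r)) K) a
  sum-blocks f zero K = refl
  sum-blocks f (suc a) K = begin-equality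
    sum f (K ℕ.+ a ℕ.* K)                                       ≡⟨ cong (sum f) (ℕ.+-comm K (a ℕ.* K)) ⟩
    sum f (a ℕ.* K ℕ.+ K)                                       ≡⟨ sum-+ f (a ℕ.* K) K ⟩
    sum f (a ℕ.* K) + sum (λ r → f (a ℕ.* K ℕ.+ r)) K           ≡⟨ cong (_+ sum (λ r → f (a ℕ.* K ℕ.+ r)) K) (sum-blocks f a K) ⟩
    sum (λ i → sum (λ r → f (i ℕ.* K ℕ.+ r)) K) a + sum (λ r → f (a ℕ.* K ℕ.+ r)) K ∎

  sum-const : ∀ c n → sum (λ _ → c) n ≡ fromℕ n * c
  sum-const c zero = sym (ℚ.*-zeroˡ c)
  sum-const c (suc n) = begin-equality
    sum (λ _ → c) n + c     ≡⟨ cong (_+ c) (sum-const c n) ⟩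
    fromℕ n * c + c         ≡⟨ lem (fromℕ n) c ⟩
    (1ℚ + fromℕ n) * c      ≡⟨ cong (_* c) (sym (fromℕ-+ 1 n)) ⟩
    fromℕ (suc n) * c       ∎
    where
    lem : ∀ x c → x * c + c ≡ (1ℚ + x) * c
    lem = RingSolver.solve-∀ ring

  recip-* : ∀ p q → recip p * recip q ≡ recip (q ℕ.+ p ℕ.* suc q)
  recip-* p q = ℚ.toℚᵘ-injective (ℚᵘ.≃-trans (ℚ.toℚᵘ-homo-* (recip p) (recip q))
    (ℚᵘ.≃-trans (ℚᵘ.*-cong (toℚᵘ-/ 1ℤ p) (toℚᵘ-/ 1ℤ q)) (ℚᵘ.≃-sym (toℚᵘ-/ 1ℤ (q ℕ.+ p ℕ.* suc q)))))

  sum-recip : ∀ p k → sum (λ _ → recip (k ℕ.+ p ℕ.* suc k)) (suc k) ≡ recip p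
  sum-recip p k = begin-equality
    sum (λ _ → recip (k ℕ.+ p ℕ.* suc k)) (suc k)   ≡⟨ sum-const (recip (k ℕ.+ p ℕ.* suc k)) (suc k) ⟩
    fromℕ (suc k) * recip (k ℕ.+ p ℕ.* suc k)       ≡⟨ cong (fromℕ (suc k) *_) (sym (recip-* p k)) ⟩
    fromℕ (suc k) * (recip p * recip k)             ≡⟨ lem (fromℕ (suc k)) (recip p) (recip k) ⟩
    recip p * (recip k * fromℕ (suc k))             ≡⟨ cong (recip p *_) (recip-fromℕ k) ⟩
    recip p * 1ℚ                                    ≡⟨ ℚ.*-identityʳ (recip p) ⟩
    recip p                                         ∎
    where
    lem : ∀ a b c → a * (b * c) ≡ b * (c * a)
    lem = RingSolver.solve-∀ ring

  sum-≤-below : ∀ {f : ℕ → ℚ} {g : ℕ → ℚ} n → (∀ i → i ℕ.< n → f i ≤ g i) → sum f n ≤ sum g n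
  sum-≤-below zero h = ℚ.≤-refl
  sum-≤-below {f} {g} (suc n) h = ℚ.+-mono-≤ {sum f n} {sum g n} {f n} {g n}
    (sum-≤-below n (λ i i<n → h i (ℕ.m<n⇒m<1+n i<n))) (h n ℕ.≤-refl)

  riemann : ℕ → ℕ → ℚ
  riemann c m = sum (λ i → recip (suc m ℕ.+ i)) (c ℕ.* suc m)

  -- index of the common refinement: suc (refine m k) ≡ suc m * suc k
  refine : ℕ → ℕ → ℕ
  refine m k = k ℕ.+ m ℕ.* suc k

  refine-comm : ∀ m k → refine m k ≡ refine k m
  refine-comm m k = lem m k
    where
    lem : ∀ m k → k ℕ.+ m ℕ.* (1 ℕ.+ k) ≡ m ℕ.+ k ℕ.* (1 ℕ.+ m)
    lem = ℕSolver.solve-∀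

  riemann-blocks : ∀ c m k → riemann c (refine m k) ≡
    sum (λ i → sum (λ r → recip (suc (refine m k) ℕ.+ (i ℕ.* suc k ℕ.+ r))) (suc k)) (c ℕ.* suc m)
  riemann-blocks c m k = trans
    (cong (sum (λ i → recip (suc (refine m k) ℕ.+ i))) (sym (ℕ.*-assoc c (suc m) (suc k))))
    (sum-blocks (λ i → recip (suc (refine m k) ℕ.+ i)) (c ℕ.* suc m) (suc k))

  riemann-refine : ∀ c m k → riemann c m ≤ riemann c (refine m k)
  riemann-refine c m k = ℚ.≤-trans
    (sum-≤ block (c ℕ.* suc m))
    (ℚ.≤-reflexive (sym (riemann-blocks c m k)))
    where
    index : ∀ i r → r ℕ.< suc k →
      suc (refine m k) ℕ.+ (i ℕ.* suc k ℕ.+ r) ℕ.≤ k ℕ.+ (suc m ℕ.+ i) ℕ.* suc k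
    index i r (s≤s r≤k) = ℕ.≤-trans
      (ℕ.+-monoʳ-≤ (suc (refine m k)) (ℕ.+-monoʳ-≤ (i ℕ.* suc k) r≤k))
      (ℕ.≤-reflexive (lem m k i))
      where
      lem : ∀ m k i → (1 ℕ.+ (k ℕ.+ m ℕ.* (1 ℕ.+ k))) ℕ.+ (i ℕ.* (1 ℕ.+ k) ℕ.+ k) ≡ k ℕ.+ (1 ℕ.+ m ℕ.+ i) ℕ.* (1 ℕ.+ k)
      lem = ℕSolver.solve-∀
    block : ∀ i → recip (suc m ℕ.+ i) ≤ sum (λ r → recip (suc (refine m k) ℕ.+ (i ℕ.* suc k ℕ.+ r))) (suc k)
    block i = ℚ.≤-trans (ℚ.≤-reflexive (sym (sum-recip (suc m ℕ.+ i) k)))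
      (sum-≤-below (suc k) (λ r r<k → recip-anti (index i r r<k)))

  shift : ∀ m a → sum (λ i → recip (m ℕ.+ i)) a + recip (m ℕ.+ a) ≡ recip m + sum (λ i → recip (suc m ℕ.+ i)) a
  shift m zero = trans (ℚ.+-identityˡ (recip (m ℕ.+ 0)))
    (trans (cong recip (ℕ.+-identityʳ m)) (sym (ℚ.+-identityʳ (recip m))))
  shift m (suc a) = trans
    (cong₂ _+_ (shift m a) (cong recip (ℕ.+-suc m a)))
    (ℚ.+-assoc (recip m) (sum (λ i → recip (suc m ℕ.+ i)) a) (recip (suc m ℕ.+ a)))

  riemann-upper : ∀ c m k → riemann c (refine m k) ≤ riemann c m + recip m
  riemann-upper c m k = begin
    riemann c (refine m k)                                      ≡⟨ riemann-blocks c m k ⟩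
    sum (λ i → sum (λ r → recip (suc (refine m k) ℕ.+ (i ℕ.* suc k ℕ.+ r))) (suc k)) a
                                                                ≤⟨ sum-≤ block a ⟩
    sum (λ i → recip (m ℕ.+ i)) a                               ≤⟨ p≤p+q {sum (λ i → recip (m ℕ.+ i)) a} (0≤recip (m ℕ.+ a)) ⟩
    sum (λ i → recip (m ℕ.+ i)) a + recip (m ℕ.+ a)             ≡⟨ shift m a ⟩
    recip m + riemann c m                                       ≡⟨ ℚ.+-comm (recip m) (riemann c m) ⟩
    riemann c m + recip m                                       ∎
    where
    a : ℕ
    a = c ℕ.* suc m
    index : ∀ i r → k ℕ.+ (m ℕ.+ i) ℕ.* suc k ℕ.≤ suc (refine m k) ℕ.+ (i ℕ.* suc k ℕ.+ r)
    index i r = ℕ.≤-trans (ℕ.m≤m+n (k ℕ.+ (m ℕ.+ i) ℕ.* suc k) (1 ℕ.+ r)) (ℕ.≤-reflexive (lem m k i r))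
      where
      lem : ∀ m k i r → k ℕ.+ (m ℕ.+ i) ℕ.* (1 ℕ.+ k) ℕ.+ (1 ℕ.+ r) ≡ (1 ℕ.+ (k ℕ.+ m ℕ.* (1 ℕ.+ k))) ℕ.+ (i ℕ.* (1 ℕ.+ k) ℕ.+ r)
      lem = ℕSolver.solve-∀
    block : ∀ i → sum (λ r → recip (suc (refine m k) ℕ.+ (i ℕ.* suc k ℕ.+ r))) (suc k) ≤ recip (m ℕ.+ i)
    block i = ℚ.≤-trans (sum-≤-below (suc k) (λ r _ → recip-anti (index i r)))
      (ℚ.≤-reflexive (sum-recip (m ℕ.+ i) k))

  cauchy-log : ∀ n → Cauchy (logSeq n)
  cauchy-log n = cauchy-recip {logSeq n} λ m k → ℚ.≤-trans (riemann-refine (n ℕ.∸ 1) m k)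
    (subst (_≤ logSeq n k + recip k) (cong (riemann (n ℕ.∸ 1)) (refine-comm k m))
      (riemann-upper (n ℕ.∸ 1) k m))

-- Equality of reals is not _≡_ but mutual _≤_, i.e. the difference of the
-- approximations tends to 0.
record ℝ : Set where
  constructor mkℝ
  field
    approx : ℕ → ℚ
    cauchy : Cauchy approx

open ℝ public

infix  4 _≤_ _<_
infixl 6 _+_ _-_
infixl 7 _*_ _/_[_]
infix  8 √_ -_

record _≤_ (x y : ℝ) : Set where
  constructor ≤-intro
  field
    ≤-elim : ∀ ε → 0ℚ ℚ.< ε →
      ∃ λ N → ∀ n → N ℕ.≤ n → approx x n ℚ.≤ approx y n ℚ.+ ε

record _<_ (x y : ℝ) : Set where
  constructor <-intro
  field
    <-elim : ∃ λ δ → 0ℚ ℚ.< δ ×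
      ∃ λ N → ∀ n → N ℕ.≤ n → approx x n ℚ.+ δ ℚ.≤ approx y n

open _≤_ public
open _<_ public

ℚ→ℝ : ℚ → ℝ
ℚ→ℝ q = mkℝ (λ _ → q) (SequenceLemmas.cauchy-const q)

ℕ→ℝ : ℕ → ℝ
ℕ→ℝ n = ℚ→ℝ (+ n ℚ./ 1)

0ℝ 1ℝ 2ℝ : ℝ
0ℝ = ℚ→ℝ 0ℚ
1ℝ = ℚ→ℝ 1ℚ
2ℝ = ℕ→ℝ 2

_+_ : ℝ → ℝ → ℝ
x + y = mkℝ (λ n → approx x n ℚ.+ approx y n)
            (SequenceLemmas.cauchy-+ {approx x} {approx y} (cauchy x) (cauchy y))

-_ : ℝ → ℝ
- x = mkℝ (λ n → ℚ.- approx x n) (SequenceLemmas.cauchy-neg {approx x} (cauchy x))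

_-_ : ℝ → ℝ → ℝ
x - y = x + (- y)

_*_ : ℝ → ℝ → ℝ
x * y = mkℝ (λ n → approx x n ℚ.* approx y n)
            (SequenceLemmas.cauchy-* {approx x} {approx y} (cauchy x) (cauchy y))

inv : (x : ℝ) → 0ℝ < x → ℝ
inv x 0<x = mkℝ (λ n → SequenceLemmas.inverse (approx x n))
                (SequenceLemmas.cauchy-inverse {approx x} (cauchy x) (<-elim 0<x))

_/_[_] : ℝ → (y : ℝ) → 0ℝ < y → ℝ
x / y [ 0<y ] = x * inv y 0<y

exp : ℝ → ℝ
exp x = mkℝ (λ k → expSum (approx x k) k) (ExpLemmas.cauchy-exp {approx x} (cauchy x))

-- natural logarithm ∫₁ⁿ dt / t, meaningful for n ≥ 1
log : ℕ → ℝ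
log n = mkℝ (logSeq n) (LogLemmas.cauchy-log n)

√_ : ℕ → ℝ
√ n = mkℝ (sqrtSeq n) (SqrtLemmas.cauchy-sqrt n)

infixr 8 _^_

-- meaningful for n ≥ 1 (logSeq 0 is constantly 0)
_^_ : ℕ → ℝ → ℝ
n ^ x = exp (x * log n)

Quadruple : Set
Quadruple = ℕ × ℕ × ℕ × ℕ

reciprocal : (x : ℕ) → 1 ℕ.< x → ℚ
reciprocal x x>1 = (1ℤ ℚ./ x) {{ℕ.>-nonZero (ℕ.<-trans ℕ.z<s x>1)}}

record IsSolution (n : ℕ) (q : Quadruple) : Set where
  private
    X = proj₁ q
    x = proj₁ (proj₂ q)
    Y = proj₁ (proj₂ (proj₂ q))
    y = proj₂ (proj₂ (proj₂ q))
  field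
    X>0 : 0 ℕ.< X
    x>1 : 1 ℕ.< x
    Y>0 : 0 ℕ.< Y
    y>1 : 1 ℕ.< y
    equation : + n ℚ./ 1 ≡
      (+ X ℚ./ 1 ℚ.+ reciprocal x x>1) ℚ.* (+ Y ℚ./ 1 ℚ.+ reciprocal y y>1)

-- A representative of each class of solutions under (X,x,Y,y) ~ (Y,y,X,x);
-- the case x ≡ y does not occur, see x≢y below.
IsOrderedSolution : ℕ → Quadruple → Set
IsOrderedSolution n q@(X , x , Y , y) = IsSolution n q × x ℕ.< y

isSolution? : ∀ n q → Dec (IsSolution n q)
isSolution? n (X , x , Y , y) with 0 ℕ.<? X | 1 ℕ.<? x | 0 ℕ.<? Y | 1 ℕ.<? y
... | no ¬p | _ | _ | _ = no λ s → ¬p (IsSolution.X>0 s)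
... | yes _ | no ¬p | _ | _ = no λ s → ¬p (IsSolution.x>1 s)
... | yes _ | yes _ | no ¬p | _ = no λ s → ¬p (IsSolution.Y>0 s)
... | yes _ | yes _ | yes _ | no ¬p = no λ s → ¬p (IsSolution.y>1 s)
... | yes p | yes q | yes r | yes t = map′
  (λ e → record { X>0 = p ; x>1 = q ; Y>0 = r ; y>1 = t ; equation = e })
  IsSolution.equation
  (+ n ℚ./ 1 ℚ.≟ (+ X ℚ./ 1 ℚ.+ reciprocal x q) ℚ.* (+ Y ℚ./ 1 ℚ.+ reciprocal y t))

isOrderedSolution? : ∀ n q → Dec (IsOrderedSolution n q)
isOrderedSolution? n q@(X , x , Y , y) = isSolution? n q ×-dec (x ℕ.<? y)

-- Every ordered solution lies in this box: X Y < n, x ≤ X + Y ≤ n and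
-- y ≤ X x + 1 ≤ n² + 1 (see solutions-complete).
box : ℕ → List Quadruple
box n = cartesianProduct (upTo (1 ℕ.+ n)) (cartesianProduct (upTo (1 ℕ.+ n))
          (cartesianProduct (upTo (1 ℕ.+ n)) (upTo (2 ℕ.+ n ℕ.* n))))

solutions : ℕ → List Quadruple
solutions n = filter (isOrderedSolution? n) (box n)

f : ℕ → ℕ
f n = length (solutions n)

module SolutionLemmas where
  open RationalLemmas using (ring; fromℕ; fromℕ-*; fromℕ-+; fromℕ-injective; /-fromℕ)

  cleared : ∀ {n X x Y y} → IsSolution n (X , x , Y , y) →
    n ℕ.* (x ℕ.* y) ≡ (X ℕ.* x ℕ.+ 1) ℕ.* (Y ℕ.* y ℕ.+ 1)
  cleared {n} {X} {x} {Y} {y} s = fromℕ-injective (begin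
    fromℕ (n ℕ.* (x ℕ.* y))
      ≡⟨ trans (fromℕ-* n (x ℕ.* y)) (cong (fromℕ n ℚ.*_) (fromℕ-* x y)) ⟩
    fromℕ n ℚ.* (fromℕ x ℚ.* fromℕ y)
      ≡⟨ cong (ℚ._* (fromℕ x ℚ.* fromℕ y)) equation ⟩
    (fromℕ X ℚ.+ rx) ℚ.* (fromℕ Y ℚ.+ ry) ℚ.* (fromℕ x ℚ.* fromℕ y)
      ≡⟨ lem (fromℕ X) (fromℕ Y) rx ry (fromℕ x) (fromℕ y) ⟩
    (fromℕ X ℚ.* fromℕ x ℚ.+ rx ℚ.* fromℕ x) ℚ.* (fromℕ Y ℚ.* fromℕ y ℚ.+ ry ℚ.* fromℕ y)
      ≡⟨ cong₂ (λ a b → (fromℕ X ℚ.* fromℕ x ℚ.+ a) ℚ.* (fromℕ Y ℚ.* fromℕ y ℚ.+ b))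
           (/-fromℕ x {{ℕ.>-nonZero (ℕ.<-trans ℕ.z<s x>1)}})
           (/-fromℕ y {{ℕ.>-nonZero (ℕ.<-trans ℕ.z<s y>1)}}) ⟩
    (fromℕ X ℚ.* fromℕ x ℚ.+ 1ℚ) ℚ.* (fromℕ Y ℚ.* fromℕ y ℚ.+ 1ℚ)
      ≡⟨ sym (cong₂ ℚ._*_ (linear X x) (linear Y y)) ⟩
    fromℕ (X ℕ.* x ℕ.+ 1) ℚ.* fromℕ (Y ℕ.* y ℕ.+ 1)
      ≡⟨ sym (fromℕ-* (X ℕ.* x ℕ.+ 1) (Y ℕ.* y ℕ.+ 1)) ⟩
    fromℕ ((X ℕ.* x ℕ.+ 1) ℕ.* (Y ℕ.* y ℕ.+ 1)) ∎)
    where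
    open IsSolution s
    open Relation.Binary.PropositionalEquality.≡-Reasoning
    rx ry : ℚ
    rx = reciprocal x x>1
    ry = reciprocal y y>1
    lem : ∀ A B r t a b →
      (A ℚ.+ r) ℚ.* (B ℚ.+ t) ℚ.* (a ℚ.* b) ≡ (A ℚ.* a ℚ.+ r ℚ.* a) ℚ.* (B ℚ.* b ℚ.+ t ℚ.* b)
    lem = RingSolver.solve-∀ ring
    linear : ∀ A a → fromℕ (A ℕ.* a ℕ.+ 1) ≡ fromℕ A ℚ.* fromℕ a ℚ.+ 1ℚ
    linear A a = trans (fromℕ-+ (A ℕ.* a) 1) (cong (ℚ._+ 1ℚ) (fromℕ-* A a))

  divides-linear : ∀ n X x Y y → n ℕ.* (x ℕ.* y) ≡ (X ℕ.* x ℕ.+ 1) ℕ.* (Y ℕ.* y ℕ.+ 1) →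
    y ℕ.∣ X ℕ.* x ℕ.+ 1
  divides-linear n X x Y y eq =
    ℕ.∣m+n∣m⇒∣n {y} {(X ℕ.* x ℕ.+ 1) ℕ.* Y ℕ.* y} {X ℕ.* x ℕ.+ 1}
      (ℕ.divides (n ℕ.* x) (trans (lem (X ℕ.* x ℕ.+ 1) Y y) (trans (sym eq) (sym (ℕ.*-assoc n x y)))))
      (ℕ.divides ((X ℕ.* x ℕ.+ 1) ℕ.* Y) refl)
    where
    lem : ∀ a b c → a ℕ.* b ℕ.* c ℕ.+ a ≡ a ℕ.* (b ℕ.* c ℕ.+ 1)
    lem = ℕSolver.solve-∀

  cofactor-eq : ∀ n X x Y y c .{{_ : ℕ.NonZero y}} →
    n ℕ.* (x ℕ.* y) ≡ (X ℕ.* x ℕ.+ 1) ℕ.* (Y ℕ.* y ℕ.+ 1) →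
    X ℕ.* x ℕ.+ 1 ≡ c ℕ.* y → n ℕ.* x ≡ Y ℕ.* (X ℕ.* x ℕ.+ 1) ℕ.+ c
  cofactor-eq n X x Y y c eq Xx+1≡cy =
    ℕ.*-cancelʳ-≡ (n ℕ.* x) (Y ℕ.* (X ℕ.* x ℕ.+ 1) ℕ.+ c) y (begin
    n ℕ.* x ℕ.* y                             ≡⟨ ℕ.*-assoc n x y ⟩
    n ℕ.* (x ℕ.* y)                           ≡⟨ eq ⟩
    (X ℕ.* x ℕ.+ 1) ℕ.* (Y ℕ.* y ℕ.+ 1)       ≡⟨ lem (X ℕ.* x ℕ.+ 1) Y y ⟩
    Y ℕ.* (X ℕ.* x ℕ.+ 1) ℕ.* y ℕ.+ (X ℕ.* x ℕ.+ 1) ≡⟨ cong (Y ℕ.* (X ℕ.* x ℕ.+ 1) ℕ.* y ℕ.+_) Xx+1≡cy ⟩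
    Y ℕ.* (X ℕ.* x ℕ.+ 1) ℕ.* y ℕ.+ c ℕ.* y   ≡⟨ sym (ℕ.*-distribʳ-+ y (Y ℕ.* (X ℕ.* x ℕ.+ 1)) c) ⟩
    (Y ℕ.* (X ℕ.* x ℕ.+ 1) ℕ.+ c) ℕ.* y       ∎)
    where
    open Relation.Binary.PropositionalEquality.≡-Reasoning
    lem : ∀ a b c → a ℕ.* (b ℕ.* c ℕ.+ 1) ≡ b ℕ.* a ℕ.* c ℕ.+ a
    lem = ℕSolver.solve-∀

  x≢y : ∀ {n X x Y y} → IsSolution n (X , x , Y , y) → ¬ x ≡ y
  x≢y {n} {X} {x} {Y} s refl = ℕ.<-irrefl (sym (x≡1 (divides-linear n X x Y x (cleared s)))) (IsSolution.x>1 s)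
    where
    x≡1 : x ℕ.∣ X ℕ.* x ℕ.+ 1 → x ≡ 1
    x≡1 d = ℕ.∣1⇒≡1 (ℕ.∣m+n∣m⇒∣n {x} {X ℕ.* x} {1} d (ℕ.divides X refl))

  X+Y≤1+XY : ∀ X Y → 0 ℕ.< X → 0 ℕ.< Y → X ℕ.+ Y ℕ.≤ 1 ℕ.+ X ℕ.* Y
  X+Y≤1+XY (suc a) (suc b) _ _ = ℕ.≤-trans (ℕ.m≤m+n (suc a ℕ.+ suc b) (a ℕ.* b)) (ℕ.≤-reflexive (lem a b))
    where
    lem : ∀ a b → (1 ℕ.+ a) ℕ.+ (1 ℕ.+ b) ℕ.+ a ℕ.* b ≡ 1 ℕ.+ (1 ℕ.+ a) ℕ.* (1 ℕ.+ b)
    lem = ℕSolver.solve-∀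

  XY<n : ∀ {n X x Y y} → IsSolution n (X , x , Y , y) → X ℕ.* Y ℕ.< n
  XY<n {n} {X} {x} {Y} {y} s with X ℕ.* Y ℕ.<? n
  ... | yes p = p
  ... | no ¬p = ⊥-elim (ℕ.<-irrefl (cleared s) (begin-strict
    n ℕ.* (x ℕ.* y)                         ≤⟨ ℕ.*-monoˡ-≤ (x ℕ.* y) (ℕ.≮⇒≥ ¬p) ⟩
    X ℕ.* Y ℕ.* (x ℕ.* y)                   <⟨ ℕ.s≤s (ℕ.m≤m+n (X ℕ.* Y ℕ.* (x ℕ.* y)) (X ℕ.* x ℕ.+ Y ℕ.* y)) ⟩
    1 ℕ.+ (X ℕ.* Y ℕ.* (x ℕ.* y) ℕ.+ (X ℕ.* x ℕ.+ Y ℕ.* y)) ≡⟨ lem X Y x y ⟩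
    (X ℕ.* x ℕ.+ 1) ℕ.* (Y ℕ.* y ℕ.+ 1)     ∎))
    where
    open ℕ.≤-Reasoning
    lem : ∀ X Y x y → 1 ℕ.+ (X ℕ.* Y ℕ.* (x ℕ.* y) ℕ.+ (X ℕ.* x ℕ.+ Y ℕ.* y)) ≡ (X ℕ.* x ℕ.+ 1) ℕ.* (Y ℕ.* y ℕ.+ 1)
    lem = ℕSolver.solve-∀

  X≤n : ∀ {n X x Y y} → IsSolution n (X , x , Y , y) → X ℕ.≤ n
  X≤n {n} {X} {x} {Y} s = ℕ.≤-trans (ℕ.m≤m*n X Y {{ℕ.>-nonZero (IsSolution.Y>0 s)}}) (ℕ.<⇒≤ (XY<n s))

  Y≤n : ∀ {n X x Y y} → IsSolution n (X , x , Y , y) → Y ℕ.≤ n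
  Y≤n {n} {X} {x} {Y} s = ℕ.≤-trans (ℕ.m≤n*m Y X {{ℕ.>-nonZero (IsSolution.X>0 s)}}) (ℕ.<⇒≤ (XY<n s))

  cofactor≤X : ∀ X x y c → 1 ℕ.< x → x ℕ.< y → X ℕ.* x ℕ.+ 1 ≡ c ℕ.* y → c ℕ.≤ X
  cofactor≤X X x y c x>1 x<y eq with c ℕ.≤? X
  ... | yes p = p
  ... | no ¬p = ⊥-elim (ℕ.<-irrefl eq (begin-strict
    X ℕ.* x ℕ.+ 1           ≤⟨ ℕ.+-monoˡ-≤ 1 (ℕ.*-monoʳ-≤ X (ℕ.n≤1+n x)) ⟩
    X ℕ.* suc x ℕ.+ 1       <⟨ ℕ.+-monoʳ-< (X ℕ.* suc x) (ℕ.s≤s (ℕ.<-trans ℕ.z<s x>1)) ⟩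
    X ℕ.* suc x ℕ.+ suc x   ≡⟨ ℕ.+-comm (X ℕ.* suc x) (suc x) ⟩
    suc X ℕ.* suc x         ≤⟨ ℕ.*-mono-≤ (ℕ.≰⇒> ¬p) x<y ⟩
    c ℕ.* y                 ∎))
    where open ℕ.≤-Reasoning

  x∣Y+c : ∀ n X x Y c → n ℕ.* x ≡ Y ℕ.* (X ℕ.* x ℕ.+ 1) ℕ.+ c → x ℕ.∣ Y ℕ.+ c
  x∣Y+c n X x Y c eq = ℕ.∣m+n∣m⇒∣n {x} {Y ℕ.* X ℕ.* x} {Y ℕ.+ c}
    (ℕ.divides n (trans (sym (lem X x Y c)) (sym eq))) (ℕ.divides (Y ℕ.* X) refl)
    where
    lem : ∀ X x Y c → Y ℕ.* (X ℕ.* x ℕ.+ 1) ℕ.+ c ≡ Y ℕ.* X ℕ.* x ℕ.+ (Y ℕ.+ c)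
    lem = ℕSolver.solve-∀

  x≤n : ∀ {n X x Y y} → IsOrderedSolution n (X , x , Y , y) → x ℕ.≤ n
  x≤n {n} {X} {x} {Y} {y} (s , x<y) = go (divides-linear n X x Y y (cleared s))
    where
    open IsSolution s
    open ℕ.≤-Reasoning
    instance
      y≢0 : ℕ.NonZero y
      y≢0 = ℕ.>-nonZero (ℕ.<-trans ℕ.z<s y>1)
    go : y ℕ.∣ X ℕ.* x ℕ.+ 1 → x ℕ.≤ n
    go (ℕ.divides c eq) = begin
      x             ≤⟨ ℕ.∣⇒≤ {{ℕ.>-nonZero (ℕ.<-≤-trans Y>0 (ℕ.m≤m+n Y c))}}
                         (x∣Y+c n X x Y c (cofactor-eq n X x Y y c (cleared s) eq)) ⟩
      Y ℕ.+ c       ≤⟨ ℕ.+-monoʳ-≤ Y (cofactor≤X X x y c x>1 x<y eq) ⟩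
      Y ℕ.+ X       ≡⟨ ℕ.+-comm Y X ⟩
      X ℕ.+ Y       ≤⟨ X+Y≤1+XY X Y X>0 Y>0 ⟩
      1 ℕ.+ X ℕ.* Y ≤⟨ XY<n s ⟩
      n             ∎

  y≤1+n² : ∀ {n X x Y y} → IsOrderedSolution n (X , x , Y , y) → y ℕ.≤ 1 ℕ.+ n ℕ.* n
  y≤1+n² {n} {X} {x} {Y} {y} o@(s , _) = begin
    y               ≤⟨ ℕ.∣⇒≤ {{ℕ.>-nonZero (ℕ.≤-trans (ℕ.s≤s z≤n) (ℕ.m≤n+m 1 (X ℕ.* x)))}}
                         (divides-linear n X x Y y (cleared s)) ⟩
    X ℕ.* x ℕ.+ 1   ≤⟨ ℕ.+-monoˡ-≤ 1 (ℕ.*-mono-≤ (X≤n s) (x≤n o)) ⟩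
    n ℕ.* n ℕ.+ 1   ≡⟨ ℕ.+-comm (n ℕ.* n) 1 ⟩
    1 ℕ.+ n ℕ.* n   ∎
    where open ℕ.≤-Reasoning

  solutions-complete : ∀ {n q} → IsOrderedSolution n q → q ∈ solutions n
  solutions-complete {n} {X , x , Y , y} o@(s , _) = ∈-filter⁺ (isOrderedSolution? n)
    (∈-cartesianProduct⁺ (∈-upTo⁺ (ℕ.s≤s (X≤n s)))
      (∈-cartesianProduct⁺ (∈-upTo⁺ (ℕ.s≤s (x≤n o)))
        (∈-cartesianProduct⁺ (∈-upTo⁺ (ℕ.s≤s (Y≤n s))) (∈-upTo⁺ (ℕ.s≤s (y≤1+n² o))))))
    o

  solutions-sound : ∀ {n q} → q ∈ solutions n → IsOrderedSolution n q
  solutions-sound {n} q∈ = proj₂ (∈-filter⁻ (isOrderedSolution? n) {xs = box n} q∈)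

  solutions-unique : ∀ n → Unique (solutions n)
  solutions-unique n = Unique.filter⁺ (isOrderedSolution? n)
    (Unique.cartesianProduct⁺ (Unique.upTo⁺ (1 ℕ.+ n)) (Unique.cartesianProduct⁺ (Unique.upTo⁺ (1 ℕ.+ n))
      (Unique.cartesianProduct⁺ (Unique.upTo⁺ (1 ℕ.+ n)) (Unique.upTo⁺ (2 ℕ.+ n ℕ.* n)))))

θ : ℕ → ℕ
θ n = length (filter (ℕ._∣? n) (map suc (upTo n)))

IsSquare : ℕ → Set
IsSquare n = ∃ λ m → n ≡ m ℕ.* m

module _ (α : ℝ) (1≤α : 1ℝ ≤ α) where

  α>0 : 0ℝ < α
  α>0 = let N , h = ≤-elim 1≤α ½ RationalLemmas.0<½ in
    <-intro (½ , RationalLemmas.0<½ , N , λ k N≤k → cancel (approx α k) (h k N≤k))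
    where
    cancel : ∀ a → 1ℚ ℚ.≤ a ℚ.+ ½ → 0ℚ ℚ.+ ½ ℚ.≤ a
    cancel a h = subst₂ ℚ._≤_ refl (lem a) (ℚ.+-monoˡ-≤ (ℚ.- ½) h)
      where
      lem : ∀ a → a ℚ.+ ½ ℚ.+ (ℚ.- ½) ≡ a
      lem = RingSolver.solve-∀ RationalLemmas.ring

  2α>0 : 0ℝ < 2ℝ * α
  2α>0 = let δ , 0<δ , N , h = <-elim α>0 in
    <-intro (δ , 0<δ , N , λ k N≤k → double δ (approx α k) 0<δ (h k N≤k))
    where
    double : ∀ δ a → 0ℚ ℚ.< δ → 0ℚ ℚ.+ δ ℚ.≤ a → 0ℚ ℚ.+ δ ℚ.≤ + 2 ℚ./ 1 ℚ.* a
    double δ a 0<δ h = ℚ.≤-trans h (subst (a ℚ.≤_) (lem a) (RationalLemmas.p≤p+q {a} {a}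
      (ℚ.≤-trans (ℚ.<⇒≤ 0<δ) (subst (ℚ._≤ a) (ℚ.+-identityˡ δ) h))))
      where
      lem : ∀ a → a ℚ.+ a ≡ + 2 ℚ./ 1 ℚ.* a
      lem = RingSolver.solve-∀ RationalLemmas.ring

  2√n-α>0 : ∀ n → α ≤ √ n → 0ℝ < 2ℝ * √ n - α
  2√n-α>0 n α≤√n =
    let M , h₁ = ≤-elim 1≤α ¼ 0<¼
        N , h₂ = ≤-elim α≤√n ¼ 0<¼
    in <-intro (¼ , 0<¼ , M ℕ.⊔ N , λ k k≥ → combine (approx α k) (approx (√ n) k)
      (h₁ k (ℕ.m⊔n≤o⇒m≤o M N k≥)) (h₂ k (ℕ.m⊔n≤o⇒n≤o M N k≥)))
    where
    ¼ : ℚ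
    ¼ = ½ ℚ.* ½
    0<¼ : 0ℚ ℚ.< ¼
    0<¼ = ℚ.positive⁻¹ ¼
    combine : ∀ a s → 1ℚ ℚ.≤ a ℚ.+ ¼ → a ℚ.≤ s ℚ.+ ¼ → 0ℚ ℚ.+ ¼ ℚ.≤ + 2 ℚ./ 1 ℚ.* s ℚ.+ (ℚ.- a)
    combine a s h₁ h₂ = subst₂ ℚ._≤_ (lem₁ a) (lem₂ a s)
      (ℚ.+-monoˡ-≤ (ℚ.- (a ℚ.+ a) ℚ.- (¼ ℚ.+ ¼ ℚ.+ ¼)) (ℚ.+-mono-≤ (ℚ.+-mono-≤ h₂ h₂) h₁))
      where
      lem₁ : ∀ a → (a ℚ.+ a ℚ.+ 1ℚ) ℚ.+ (ℚ.- (a ℚ.+ a) ℚ.- (¼ ℚ.+ ¼ ℚ.+ ¼)) ≡ 0ℚ ℚ.+ ¼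
      lem₁ = RingSolver.solve-∀ RationalLemmas.ring
      lem₂ : ∀ a s → (s ℚ.+ ¼ ℚ.+ (s ℚ.+ ¼) ℚ.+ (a ℚ.+ ¼)) ℚ.+ (ℚ.- (a ℚ.+ a) ℚ.- (¼ ℚ.+ ¼ ℚ.+ ¼))
        ≡ + 2 ℚ./ 1 ℚ.* s ℚ.+ (ℚ.- a)
      lem₂ = RingSolver.solve-∀ RationalLemmas.ring

coeff : (α : ℝ) → 0ℝ < α → ℝ
coeff α α>0 = 1ℝ + ℚ→ℝ (+ 3 ℚ./ 5) / α [ α>0 ]

module _ (n : ℕ) (α : ℝ) (1≤α : 1ℝ ≤ α) (α≤√n : α ≤ √ n) where

  g : ℝ
  g = 1ℝ / α [ α>0 α 1≤α ] * √ n * log n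
    + 2ℝ * coeff α (α>0 α 1≤α) * √ n
    + 2ℝ * (2ℝ * ℕ→ℝ n - 1ℝ) * α / (2ℝ * √ n - α) [ 2√n-α>0 α 1≤α n α≤√n ]

  h : ℝ
  h = 1ℝ / (2ℝ * α) [ 2α>0 α 1≤α ] * √ n * log n
    + coeff α (α>0 α 1≤α) * √ n
    + (2ℝ * ℕ→ℝ n - 1ℝ) * α / (2ℝ * √ n - α) [ 2√n-α>0 α 1≤α n α≤√n ]

{-# OPTIONS --safe #-}

-- Clearing denominators, cy = Xx + 1 and dx = Yy + 1 with cd = n, and there is
-- k > 0 with kx = Y + c, ky = X + d and XY + k = n.  For fixed c a solution is
-- determined by (X, k), by (Y, k), by x when y < x, and by y when x < y.  Since
-- XY < n, X or Y is at most m = ⌊√n⌋, and k is fixed modulo X and modulo Y, so at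
-- most 2 ∑ (1 + (κ - 1) / j) solutions over 1 ≤ j ≤ m have k ≤ κ = √n / α; since
-- x (2k - 1) and y (2k - 1) are at most 2n - 1, at most 2 (2n - 1) / (2κ - 1) have
-- k > κ.  Counting each solution in both orders and summing over c gives θ(n) g / 2;
-- here the harmonic sum is compared with ½ log n by the midpoint rule.  Taking k
-- with cut-off n^¼ instead, together with θ(n) = O(n^ε), gives f(n) < n.

module Submission where

-- Rounding shapes the proof. The count is valid for an integer K only, and with K + 1 ≤ κ the small
-- k cost at most K H + m, where H is the m-th harmonic number. For small m this H can exceed ½ log
-- n + 0.6, as for n = 2. The 1 lost in K ≤ κ - 1 saves the bound: it suffices that κ (H - 0.6 - ½
-- log n) ≤ H, and κ ≤ √n < m + 1. Real inequalities are proved between rational approximants, for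
-- all large k. There α is only known to be at least 0.9, so what is proved is (m + 1) (H - 0.6 - ½
-- log n) ≤ 0.9 H. The divisor bound stays in integers: θ(n) ≤ D (1 + 1/K)^t for some t with 2^t ≤
-- n, where D depends on K alone. It is read once through exp, giving C n^ε, and once as θ(n)^8 ≤
-- D^8 n.

-- Counting the solutions by codes.

module Counting where
  open import Data.Empty using (⊥-elim)
  open import Data.List.Base
    using (List; []; _∷_; _++_; length; map; filter; upTo; cartesianProduct)
  open import Data.List.Membership.Propositional using (_∈_)
  open import Data.List.Membership.Propositional.Properties
  open import Data.List.Properties
    using (length-map; length-++; length-upTo; length-++-sucʳ)
  open import Data.List.Relation.Unary.All as All using ()
  open import Data.List.Relation.Unary.AllPairs as AllPairs using ()
  open import Data.List.Relation.Unary.Any using (here; there)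
  open import Data.List.Relation.Unary.Unique.Propositional using (Unique)
  import Data.List.Relation.Unary.Unique.Propositional.Properties as Unique
  open import Data.Nat
  open import Data.Nat.Divisibility
  open import Data.Nat.DivMod
  open import Data.Nat.Properties
  open import Data.Nat.Tactic.RingSolver using (solve-∀)
  open import Data.Product using (∃; _×_; _,_; proj₁; proj₂; uncurry)
  open import Data.Sum using (_⊎_; inj₁; inj₂; [_,_]′)
  open import Function using (_∘_)
  open import Relation.Binary.PropositionalEquality
  open import Relation.Nullary using (¬_; yes; no)
  open import Relation.Binary.Definitions using (tri<; tri≈; tri>)
  open import Defs using (Quadruple; IsSolution; solutions; f; θ)
  open Defs.SolutionLemmas

  -- The code of the head is deleted from `ys`; functionality of `R` ensures that no later element
  -- uses it. Coding is a relation because a code fixes a solution only through a uniqueness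
  -- argument.
  length-≤-codes : ∀ {a b r} {A : Set a} {B : Set b} (R : B → A → Set r) {xs : List A} (ys : List B) →
    Unique xs → (∀ {x} → x ∈ xs → ∃ λ y → y ∈ ys × R y x) →
    (∀ {y x x′} → x ∈ xs → x′ ∈ xs → R y x → R y x′ → x ≡ x′) → length xs ≤ length ys
  length-≤-codes R {[]} ys _ _ _ = z≤n
  length-≤-codes R {x ∷ xs} ys (x∉ AllPairs.∷ u) code functional
    with code (here refl)
  ... | y , y∈ys , Ryx with ∈-∃++ y∈ys
  ... | as , bs , refl = ≤-trans
    (s≤s (length-≤-codes R (as ++ bs) u code′ λ p q → functional (there p) (there q)))
    (≤-reflexive (sym (length-++-sucʳ as y bs)))
    where
    code′ : ∀ {x′} → x′ ∈ xs → ∃ λ y′ → y′ ∈ as ++ bs × R y′ x′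
    code′ x′∈ with code (there x′∈)
    ... | y′ , y′∈ , Ry′x′ with ∈-++⁻ as y′∈
    ... | inj₁ p = y′ , ∈-++⁺ˡ p , Ry′x′
    ... | inj₂ (there p) = y′ , ∈-++⁺ʳ as p , Ry′x′
    ... | inj₂ (here refl) =
      ⊥-elim (All.lookup x∉ x′∈ (functional (here refl) (there x′∈) Ryx Ry′x′))

  length-cartesianProduct : ∀ {a b} {A : Set a} {B : Set b} (xs : List A) (ys : List B) →
    length (cartesianProduct xs ys) ≡ length xs * length ys
  length-cartesianProduct [] ys = refl
  length-cartesianProduct (x ∷ xs) ys = trans (length-++ (map (x ,_) ys))
    (cong₂ _+_ (length-map (x ,_) ys) (length-cartesianProduct xs ys))

  -- `c` and `k` are indices because codes and blocks refer to them; `d` is a field, being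
  -- determined by c d = n.
  record Parameters (n c k X x Y y : ℕ) : Set where
    field
      d       : ℕ
      X>0     : 0 < X
      Y>0     : 0 < Y
      x>1     : 1 < x
      y>1     : 1 < y
      k>0     : 0 < k
      cd≡n    : c * d ≡ n
      cy≡Xx+1 : c * y ≡ X * x + 1
      dx≡Yy+1 : d * x ≡ Y * y + 1
      kx≡Y+c  : k * x ≡ Y + c
      ky≡X+d  : k * y ≡ X + d
      XY+k≡n  : X * Y + k ≡ n

  -- Exchanging the two pairs exchanges `c` and `d`. Statements about Y and y follow from those
  -- about X and x in this way.
  swap-parameters : ∀ {n c k X x Y y} (p : Parameters n c k X x Y y) →
    Parameters n (Parameters.d p) k Y y X x
  swap-parameters {c = c} {k} {X} {x} {Y} {y} p = record
    { d = c ; X>0 = Y>0 ; Y>0 = X>0 ; x>1 = y>1 ; y>1 = x>1 ; k>0 = k>0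
    ; cd≡n = trans (*-comm d c) cd≡n
    ; cy≡Xx+1 = dx≡Yy+1 ; dx≡Yy+1 = cy≡Xx+1 ; kx≡Y+c = ky≡X+d ; ky≡X+d = kx≡Y+c
    ; XY+k≡n = trans (cong (_+ k) (*-comm Y X)) XY+k≡n }
    where open Parameters p

  parameters′ : ∀ {n X x Y y} → 0 < X → 1 < x → 0 < Y → 1 < y →
    n * (x * y) ≡ (X * x + 1) * (Y * y + 1) → ∀ c → c * y ≡ X * x + 1 → ∀ d → d * x ≡ Y * y + 1 →
    ∀ k → k * x ≡ Y + c → Parameters n c k X x Y y
  parameters′ {n} {X} {x} {Y} {y} X>0 x>1 Y>0 y>1 eq c cy≡ d dx≡ k kx≡ = record
    { d = d ; X>0 = X>0 ; Y>0 = Y>0 ; x>1 = x>1 ; y>1 = y>1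
    ; k>0 = k>0 k kx≡ ; cd≡n = cd≡n
    ; cy≡Xx+1 = cy≡ ; dx≡Yy+1 = dx≡ ; kx≡Y+c = kx≡
    ; ky≡X+d = ky≡X+d ; XY+k≡n = XY+k≡n }
    where
    instance
      x≢0 : NonZero x
      x≢0 = >-nonZero (<-trans z<s x>1)
      y≢0 : NonZero y
      y≢0 = >-nonZero (<-trans z<s y>1)
      xy≢0 : NonZero (x * y)
      xy≢0 = m*n≢0 x y
    open ≡-Reasoning
    k>0 : ∀ k → k * x ≡ Y + c → 0 < k
    k>0 zero eq = ⊥-elim (<-irrefl eq (≤-trans Y>0 (m≤m+n Y c)))
    k>0 (suc _) _ = z<s
    cd≡n : c * d ≡ n
    cd≡n = *-cancelʳ-≡ (c * d) n (x * y) (begin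
      c * d * (x * y)             ≡⟨ lem c d x y ⟩
      c * y * (d * x)             ≡⟨ cong₂ _*_ cy≡ dx≡ ⟩
      (X * x + 1) * (Y * y + 1)   ≡⟨ sym eq ⟩
      n * (x * y)                 ∎)
      where
      lem : ∀ c d x y → c * d * (x * y) ≡ c * y * (d * x)
      lem = solve-∀
    XY+k≡n : X * Y + k ≡ n
    XY+k≡n = *-cancelʳ-≡ (X * Y + k) n x (begin
      (X * Y + k) * x             ≡⟨ *-distribʳ-+ x (X * Y) k ⟩
      X * Y * x + k * x           ≡⟨ cong (X * Y * x +_) kx≡ ⟩
      X * Y * x + (Y + c)         ≡⟨ lem X x Y c ⟩
      Y * (X * x + 1) + c         ≡⟨ sym (cofactor-eq n X x Y y c eq (sym cy≡)) ⟩
      n * x                       ∎)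
      where
      lem : ∀ X x Y c → X * Y * x + (Y + c) ≡ Y * (X * x + 1) + c
      lem = solve-∀
    ky≡X+d : k * y ≡ X + d
    ky≡X+d = *-cancelʳ-≡ (k * y) (X + d) x (begin
      k * y * x                   ≡⟨ lem₁ k y x ⟩
      k * x * y                   ≡⟨ cong (_* y) kx≡ ⟩
      (Y + c) * y                 ≡⟨ *-distribʳ-+ y Y c ⟩
      Y * y + c * y               ≡⟨ cong (Y * y +_) cy≡ ⟩
      Y * y + (X * x + 1)         ≡⟨ lem₂ (Y * y) (X * x) ⟩
      X * x + (Y * y + 1)         ≡⟨ cong (X * x +_) (sym dx≡) ⟩
      X * x + d * x               ≡⟨ sym (*-distribʳ-+ x X d) ⟩
      (X + d) * x                 ∎)
      where
      lem₁ : ∀ k y x → k * y * x ≡ k * x * y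
      lem₁ = solve-∀
      lem₂ : ∀ a b → a + (b + 1) ≡ b + (a + 1)
      lem₂ = solve-∀

  parameters : ∀ {n X x Y y} → IsSolution n (X , x , Y , y) →
    ∃ λ c → ∃ λ k → Parameters n c k X x Y y
  parameters {n} {X} {x} {Y} {y} s = go X>0 x>1 Y>0 y>1 (cleared s)
    where
    open IsSolution s
    go : 0 < X → 1 < x → 0 < Y → 1 < y → n * (x * y) ≡ (X * x + 1) * (Y * y + 1) →
      ∃ λ c → ∃ λ k → Parameters n c k X x Y y
    go X>0 x>1 Y>0 y>1 eq with divides-linear n X x Y y eq
      | divides-linear n Y y X x (trans (cong (n *_) (*-comm y x))
          (trans eq (*-comm (X * x + 1) (Y * y + 1))))
    ... | divides c cy | divides d dx
      with x∣Y+c n X x Y c (cofactor-eq n X x Y y c {{>-nonZero (<-trans z<s y>1)}} eq cy)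
    ... | divides k kx = c , k , parameters′ X>0 x>1 Y>0 y>1 eq c (sym cy) d (sym dx) k (sym kx)

  -- x (2k - 1) ≤ 2n - 1, free of subtraction.
  2kx≤2n+x : ∀ {n c k X x Y y} → Parameters n c k X x Y y → 1 + 2 * (k * x) ≤ 2 * n + x
  2kx≤2n+x {n} {c} {k} {X} {x} {Y} {y} p = subst (λ z → 1 + 2 * z ≤ 2 * n + x) (sym kx≡Y+c)
    (go X d X>0 cd≡n cy≡Xx+1 dx≡Yy+1 XY+k≡n)
    where
    open Parameters p
    open ≤-Reasoning
    -- XY + k = n bounds Y, and c ≤ n / 2 unless d = 1.
    go : ∀ X d → 0 < X → c * d ≡ n → c * y ≡ X * x + 1 → d * x ≡ Y * y + 1 → X * Y + k ≡ n →
      1 + 2 * (Y + c) ≤ 2 * n + x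
    go X 0 _ _ _ dx _ = ⊥-elim (0≢1+n (trans dx (+-comm (Y * y) 1)))
    go X 1 _ cd _ dx _ = begin
      1 + 2 * (Y + c)             ≡⟨ lem₁ Y c ⟩
      2 * (c * 1) + (Y * 2 + 1)   ≤⟨ +-monoʳ-≤ (2 * (c * 1)) (+-monoˡ-≤ 1 (*-monoʳ-≤ Y y>1)) ⟩
      2 * (c * 1) + (Y * y + 1)   ≡⟨ cong₂ (λ u v → 2 * u + v) cd (trans (sym dx) (*-identityˡ x)) ⟩
      2 * n + x                   ∎
      where
      lem₁ : ∀ Y c → 1 + 2 * (Y + c) ≡ 2 * (c * 1) + (Y * 2 + 1)
      lem₁ = solve-∀
    go 1 d _ cd cy dx XY = begin
      1 + 2 * (Y + c)             ≡⟨ lem₁ Y c ⟩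
      2 * Y + (c * 2 + 1)         ≤⟨ +-monoʳ-≤ (2 * Y) (+-monoˡ-≤ 1 (*-monoʳ-≤ c y>1)) ⟩
      2 * Y + (c * y + 1)         ≡⟨ cong (λ z → 2 * Y + (z + 1)) cy ⟩
      2 * Y + (1 * x + 1 + 1)     ≡⟨ lem₂ Y x ⟩
      2 * (1 * Y + 1) + x         ≤⟨ +-monoˡ-≤ x (*-monoʳ-≤ 2 (+-monoʳ-≤ (1 * Y) k>0)) ⟩
      2 * (1 * Y + k) + x         ≡⟨ cong (λ z → 2 * z + x) XY ⟩
      2 * n + x                   ∎
      where
      lem₁ : ∀ Y c → 1 + 2 * (Y + c) ≡ 2 * Y + (c * 2 + 1)
      lem₁ = solve-∀
      lem₂ : ∀ Y x → 2 * Y + (1 * x + 1 + 1) ≡ 2 * (1 * Y + 1) + x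
      lem₂ = solve-∀
    go X@(suc (suc X′)) d@(suc (suc d′)) _ cd _ _ XY = begin
      1 + 2 * (Y + c)             ≡⟨ lem₁ Y c ⟩
      2 * Y + c * 2 + 1           ≤⟨ +-mono-≤ (+-mono-≤ (*-monoˡ-≤ Y {2} {X} (s≤s (s≤s z≤n)))
                                       (*-monoʳ-≤ c {2} {d} (s≤s (s≤s z≤n)))) (<⇒≤ x>1) ⟩
      X * Y + c * d + x           ≤⟨ +-monoˡ-≤ x (+-monoˡ-≤ (c * d) (m≤m+n (X * Y) k)) ⟩
      X * Y + k + c * d + x       ≡⟨ cong₂ (λ u v → u + v + x) XY cd ⟩
      n + n + x                   ≡⟨ lem₂ n x ⟩
      2 * n + x                   ∎
      where
      lem₁ : ∀ Y c → 1 + 2 * (Y + c) ≡ 2 * Y + c * 2 + 1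
      lem₁ = solve-∀
      lem₂ : ∀ n x → n + n + x ≡ 2 * n + x
      lem₂ = solve-∀

  same-residue-≡ : ∀ {a b m u v} → m ≢ 0 → a < m → b < m → u * m + a ≡ v * m + b → a ≡ b
  same-residue-≡ {m = zero} m≢0 = ⊥-elim (m≢0 refl)
  same-residue-≡ {a} {b} {m@(suc _)} {u} {v} _ a<m b<m eq = begin
    a                   ≡⟨ sym (m<n⇒m%n≡m a<m) ⟩
    a % m               ≡⟨ sym (mod u a) ⟩
    (u * m + a) % m     ≡⟨ cong (_% m) eq ⟩
    (v * m + b) % m     ≡⟨ mod v b ⟩
    b % m               ≡⟨ m<n⇒m%n≡m b<m ⟩
    b                   ∎
    where
    open ≡-Reasoning
    mod : ∀ u a → (u * m + a) % m ≡ a % m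
    mod u a = trans (cong (_% m) (+-comm (u * m) a)) ([m+kn]%n≡m%n a u m)

  -- `suc a` and `suc b` are two values of k, both congruent to n modulo m. Lowering them by 1 turns
  -- the block ]qm, (q + 1)m] into a full set of residues, on which they must agree.
  quotient-residue-≡ : ∀ {a b m n q u v} → m ≢ 0 → m * u + suc a ≡ n → m * v + suc b ≡ n →
    q * m ≤ a → a < suc q * m → q * m ≤ b → b < suc q * m → a ≡ b
  quotient-residue-≡ {a} {b} {m} {n} {q} {u} {v} m≢0 eqa eqb qa aq qb bq = begin
    a                   ≡⟨ sym (m∸n+n≡m qa) ⟩
    (a ∸ q * m) + q * m ≡⟨ cong (_+ q * m) (same-residue-≡ {u = u + q} {v + q} m≢0 (small a qa aq) (small b qb bq)
                             (trans (residue a u qa) (trans (suc-injective (trans (sym (+-suc (m * u) a))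
                               (trans eqa (trans (sym eqb) (+-suc (m * v) b))))) (sym (residue b v qb))))) ⟩
    (b ∸ q * m) + q * m ≡⟨ m∸n+n≡m qb ⟩
    b                   ∎
    where
    open ≡-Reasoning
    small : ∀ a → q * m ≤ a → a < suc q * m → a ∸ q * m < m
    small a qa aq = +-cancelʳ-< (q * m) (a ∸ q * m) m (subst (_< m + q * m) (sym (m∸n+n≡m qa)) aq)
    residue : ∀ a u → q * m ≤ a → (u + q) * m + (a ∸ q * m) ≡ m * u + a
    residue a u qa = trans (lem u q m (a ∸ q * m)) (cong (m * u +_) (m∸n+n≡m qa))
      where
      lem : ∀ u q m r → (u + q) * m + r ≡ m * u + (r + q * m)
      lem = solve-∀

  -- Codes for the solutions with a given c.

  data Code : Set where
    viaX viaY : ℕ → ℕ → Code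
    viax viay : ℕ → Code

  data Encodes (k X x Y y : ℕ) : Code → Set where
    byX : ∀ q → q * X < k → k ≤ suc q * X → Encodes k X x Y y (viaX X q)
    byY : ∀ q → q * Y < k → k ≤ suc q * Y → Encodes k X x Y y (viaY Y q)
    byx : y < x → Encodes k X x Y y (viax x)
    byy : x < y → Encodes k X x Y y (viay y)

  Decodes : ℕ → ℕ × Code → Quadruple → Set
  Decodes n (c , w) (X , x , Y , y) = ∃ λ k → Parameters n c k X x Y y × Encodes k X x Y y w

  c≢0 : ∀ {n c k X x Y y} → Parameters n c k X x Y y → NonZero c
  c≢0 {c = zero} {X = X} {x} p = ⊥-elim (0≢1+n (trans (Parameters.cy≡Xx+1 p) (+-comm (X * x) 1)))
  c≢0 {c = suc _} p = _

  d-unique : ∀ {n c k k′ X X′ x x′ Y Y′ y y′} (p : Parameters n c k X x Y y)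
    (p′ : Parameters n c k′ X′ x′ Y′ y′) → Parameters.d p ≡ Parameters.d p′
  d-unique {c = c} p p′ = *-cancelˡ-≡ _ _ c {{c≢0 p}} (trans (Parameters.cd≡n p) (sym (Parameters.cd≡n p′)))

  -- XY + k = n yields Y, then ky = X + d yields y, and cy = Xx + 1 yields x.
  unique-given-k : ∀ {n c k X x x′ Y Y′ y y′} → Parameters n c k X x Y y → Parameters n c k X x′ Y′ y′ →
    x ≡ x′ × Y ≡ Y′ × y ≡ y′
  unique-given-k {n} {c} {k} {X} {x} {x′} {Y} {Y′} {y} {y′} p p′ = x≡x′ , Y≡Y′ , y≡y′
    where
    module P = Parameters p
    module P′ = Parameters p′
    instance
      X≢0 : NonZero X
      X≢0 = >-nonZero P.X>0
      k≢0 : NonZero k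
      k≢0 = >-nonZero P.k>0
    Y≡Y′ : Y ≡ Y′
    Y≡Y′ = *-cancelˡ-≡ Y Y′ X (+-cancelʳ-≡ k _ _ (trans P.XY+k≡n (sym P′.XY+k≡n)))
    y≡y′ : y ≡ y′
    y≡y′ = *-cancelˡ-≡ y y′ k (trans P.ky≡X+d (trans (cong (X +_) (d-unique p p′)) (sym P′.ky≡X+d)))
    x≡x′ : x ≡ x′
    x≡x′ = *-cancelˡ-≡ x x′ X (+-cancelʳ-≡ 1 _ _
      (trans (sym P.cy≡Xx+1) (trans (cong (c *_) y≡y′) P′.cy≡Xx+1)))

  -- k ≡ n modulo X, so k is determined by its block ]qX, (q + 1)X].
  unique-via-X : ∀ {n c k k′ X x x′ Y Y′ y y′} q → Parameters n c k X x Y y → Parameters n c k′ X x′ Y′ y′ →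
    q * X < k → k ≤ suc q * X → q * X < k′ → k′ ≤ suc q * X → x ≡ x′ × Y ≡ Y′ × y ≡ y′
  unique-via-X {k = suc k} {suc k′} {X = X} q p p′ (s≤s l) h (s≤s l′) h′
    with quotient-residue-≡ {k} {k′} {X} {q = q} (m<n⇒n≢0 (Parameters.X>0 p))
           (Parameters.XY+k≡n p) (Parameters.XY+k≡n p′) l h l′ h′
  ... | refl = unique-given-k p p′
  unique-via-X {k = zero} _ p _ = ⊥-elim (n≮0 (Parameters.k>0 p))
  unique-via-X {k′ = zero} _ _ p′ = ⊥-elim (n≮0 (Parameters.k>0 p′))

  -- y is the inverse of c modulo x.
  unique-via-x : ∀ {n c k k′ X X′ x Y Y′ y y′} → Parameters n c k X x Y y → Parameters n c k′ X′ x Y′ y′ →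
    y < x → y′ < x → X ≡ X′ × Y ≡ Y′ × y ≡ y′
  unique-via-x {c = c} {X = X} {X′} {x} {Y} {Y′} {y} {y′} p p′ y<x y′<x = X≡X′ , Y≡Y′ , y≡y′
    where
    module P = Parameters p
    module P′ = Parameters p′
    instance
      x≢0 : NonZero x
      x≢0 = >-nonZero (<-trans z<s P.x>1)
      y≢0 : NonZero y
      y≢0 = >-nonZero (<-trans z<s P.y>1)
    y≡y′ : y ≡ y′
    y≡y′ = same-residue-≡ {u = y * X′} {y′ * X} (≢-nonZero⁻¹ x) y<x y′<x (begin
      y * X′ * x + y      ≡⟨ lem₁ y X′ x ⟩
      y * (X′ * x + 1)    ≡⟨ cong (y *_) (sym P′.cy≡Xx+1) ⟩
      y * (c * y′)        ≡⟨ lem₂ y c y′ ⟩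
      y′ * (c * y)        ≡⟨ cong (y′ *_) P.cy≡Xx+1 ⟩
      y′ * (X * x + 1)    ≡⟨ sym (lem₁ y′ X x) ⟩
      y′ * X * x + y′     ∎)
      where
      open ≡-Reasoning
      lem₁ : ∀ y X x → y * X * x + y ≡ y * (X * x + 1)
      lem₁ = solve-∀
      lem₂ : ∀ y c y′ → y * (c * y′) ≡ y′ * (c * y)
      lem₂ = solve-∀
    X≡X′ : X ≡ X′
    X≡X′ = *-cancelʳ-≡ X X′ x (+-cancelʳ-≡ 1 _ _
      (trans (sym P.cy≡Xx+1) (trans (cong (c *_) y≡y′) P′.cy≡Xx+1)))
    Y≡Y′ : Y ≡ Y′
    Y≡Y′ = *-cancelʳ-≡ Y Y′ y (+-cancelʳ-≡ 1 _ _ (trans (sym P.dx≡Yy+1)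
      (trans (cong (_* x) (d-unique p p′)) (trans P′.dx≡Yy+1 (cong (λ z → Y′ * z + 1) (sym y≡y′))))))

  quadruple-≡ : ∀ {X X′ x x′ Y Y′ y y′ : ℕ} → X ≡ X′ → x ≡ x′ → Y ≡ Y′ → y ≡ y′ →
    (X , x , Y , y) ≡ (X′ , x′ , Y′ , y′)
  quadruple-≡ refl refl refl refl = refl

  -- After the exchange each solution is indexed by its own d. These agree because c is common, so
  -- both are put over one index before a uniqueness lemma is applied.
  transport-swapped : ∀ {n c k k′ X X′ x x′ Y Y′ y y′} (p : Parameters n c k X x Y y)
    (p′ : Parameters n c k′ X′ x′ Y′ y′) → Parameters n (Parameters.d p) k′ Y′ y′ X′ x′
  transport-swapped {n} {k′ = k′} {X′ = X′} {x′ = x′} {Y′ = Y′} {y′ = y′} p p′ =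
    subst (λ d → Parameters n d k′ Y′ y′ X′ x′) (sym (d-unique p p′)) (swap-parameters p′)

  decodes-functional : ∀ {n w q q′} → Decodes n w q → Decodes n w q′ → q ≡ q′
  decodes-functional (k , p , byX q l h) (k′ , p′ , byX .q l′ h′) =
    let x≡ , Y≡ , y≡ = unique-via-X q p p′ l h l′ h′ in quadruple-≡ refl x≡ Y≡ y≡
  decodes-functional (k , p , byY q l h) (k′ , p′ , byY .q l′ h′) =
    let y≡ , X≡ , x≡ = unique-via-X q (swap-parameters p) (transport-swapped p p′) l h l′ h′
    in quadruple-≡ X≡ x≡ refl y≡
  decodes-functional (k , p , byx l) (k′ , p′ , byx l′) =
    let X≡ , Y≡ , y≡ = unique-via-x p p′ l l′ in quadruple-≡ X≡ refl Y≡ y≡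
  decodes-functional (k , p , byy l) (k′ , p′ , byy l′) =
    let Y≡ , X≡ , x≡ = unique-via-x (swap-parameters p) (transport-swapped p p′) l l′
    in quadruple-≡ X≡ x≡ Y≡ refl

  -- For 1 ≤ k ≤ K + 1 the index (k - 1) / j of the block of length j containing k ranges over 0,
  -- ..., K / j. Hence the row of j has 1 + K / j entries.
  blocks : ℕ → ℕ → List (ℕ × ℕ)
  blocks K zero    = []
  blocks K (suc j) = map (suc j ,_) (upTo (suc (K / suc j))) ++ blocks K j

  blockCount : ℕ → ℕ → ℕ
  blockCount K zero    = 0
  blockCount K (suc j) = suc (K / suc j) + blockCount K j

  length-blocks : ∀ K m → length (blocks K m) ≡ blockCount K m
  length-blocks K zero    = refl
  length-blocks K (suc j) = trans (length-++ row) (cong₂ _+_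
    (trans (length-map pair (upTo (suc (K / suc j)))) (length-upTo (suc (K / suc j))))
    (length-blocks K j))
    where
    pair : ℕ → ℕ × ℕ
    pair q = suc j , q
    row : List (ℕ × ℕ)
    row = map pair (upTo (suc (K / suc j)))

  ∈-blocks : ∀ {K m j q} → suc j ≤ m → q ≤ K / suc j → (suc j , q) ∈ blocks K m
  ∈-blocks {K} {suc m} {j} {q} (s≤s j≤m) q≤ with j ≟ m
  ... | yes refl = ∈-++⁺ˡ (∈-map⁺ (suc j ,_) (∈-upTo⁺ (s≤s q≤)))
  ... | no j≢m   = ∈-++⁺ʳ (map (suc m ,_) (upTo (suc (K / suc m)))) (∈-blocks (≤∧≢⇒< j≤m j≢m) q≤)

  divisors : ℕ → List ℕ
  divisors n = filter (_∣? n) (map suc (upTo n))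

  ∈-divisors : ∀ {n c} .{{_ : NonZero n}} → c ∣ n → c ∈ divisors n
  ∈-divisors {n} {zero} 0∣n = ⊥-elim (≢-nonZero⁻¹ n (0∣⇒≡0 0∣n))
  ∈-divisors {n} {suc c} c∣n = ∈-filter⁺ (_∣? n) (∈-map⁺ suc (∈-upTo⁺ (∣⇒≤ c∣n))) c∣n

  -- Solutions are separated by k ≤ K + 1, so K + 1 plays the role of √n / α.
  module _ (n m K : ℕ) (n<[1+m]² : n < suc m * suc m) where

    -- For k ≥ K + 2 the factor 2k - 1 is at least 3 + 2K, so x (2k - 1) ≤ 2n - 1 confines x to this
    -- range.
    reach : ℕ
    reach = (2 * n ∸ 1) / (3 + 2 * K)

    shapes : List Code
    shapes = (map (uncurry viaX) (blocks K m) ++ map (uncurry viaY) (blocks K m))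
      ++ (map (viax ∘ suc) (upTo reach) ++ map (viay ∘ suc) (upTo reach))

    length-shapes : length shapes ≡ (blockCount K m + blockCount K m) + (reach + reach)
    length-shapes = trans (length-++ (map (uncurry viaX) (blocks K m) ++ map (uncurry viaY) (blocks K m)))
      (cong₂ _+_
      (trans (length-++ (map (uncurry viaX) (blocks K m)))
        (cong₂ _+_ (trans (length-map _ (blocks K m)) (length-blocks K m))
                   (trans (length-map _ (blocks K m)) (length-blocks K m))))
      (trans (length-++ (map (viax ∘ suc) (upTo reach)))
        (cong₂ _+_ (trans (length-map _ (upTo reach)) (length-upTo reach))
                   (trans (length-map _ (upTo reach)) (length-upTo reach)))))

    block-of : ∀ {k X} → 0 < k → 0 < X → k ≤ suc K → X ≤ m →
      ∃ λ q → q * X < k × k ≤ suc q * X × (X , q) ∈ blocks K m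
    block-of {suc k} {X@(suc j)} _ _ (s≤s k≤K) X≤m = k / X , s≤s (m/n*n≤m k X) , upper , ∈-blocks X≤m (/-monoˡ-≤ X k≤K)
      where
      open ≤-Reasoning
      upper : suc k ≤ suc (k / X) * X
      upper = begin
        suc k                     ≡⟨ cong suc (m≡m%n+[m/n]*n k X) ⟩
        suc (k % X) + k / X * X   ≤⟨ +-monoˡ-≤ (k / X * X) (m%n<n k X) ⟩
        X + k / X * X             ∎

    within-reach : ∀ {c k X x Y y} → Parameters n c k X x Y y → suc (suc K) ≤ k → x ≤ reach
    within-reach {k = k} {x = x} p K+2≤k = begin
      x                                 ≡⟨ sym (m*n/n≡m x (3 + 2 * K)) ⟩
      x * (3 + 2 * K) / (3 + 2 * K)     ≤⟨ /-monoˡ-≤ (3 + 2 * K) (∸-monoˡ-≤ 1 1+x[3+2K]≤2n) ⟩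
      (2 * n ∸ 1) / (3 + 2 * K)         ∎
      where
      open ≤-Reasoning
      1+x[3+2K]≤2n : 1 + x * (3 + 2 * K) ≤ 2 * n
      1+x[3+2K]≤2n = +-cancelʳ-≤ x _ _ (begin
        1 + x * (3 + 2 * K) + x         ≡⟨ cong suc (lem x K) ⟩
        1 + 2 * ((2 + K) * x)           ≤⟨ +-monoʳ-≤ 1 (*-monoʳ-≤ 2 (*-monoˡ-≤ x K+2≤k)) ⟩
        1 + 2 * (k * x)                 ≤⟨ 2kx≤2n+x p ⟩
        2 * n + x                       ∎)
        where
        lem : ∀ x K → x * (3 + 2 * K) + x ≡ 2 * ((2 + K) * x)
        lem = solve-∀

    via : ∀ (v : ℕ → Code) {x} → 1 < x → x ≤ reach → v x ∈ map (v ∘ suc) (upTo reach)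
    via v {suc x} _ x≤ = ∈-map⁺ (v ∘ suc) (∈-upTo⁺ x≤)

    shape-of : ∀ {c k X x Y y} → Parameters n c k X x Y y → x ≢ y → ∃ λ w → w ∈ shapes × Encodes k X x Y y w
    shape-of {c} {k} {X} {x} {Y} {y} p x≢y with k ≤? suc K
    ... | yes k≤ = [ via-X , via-Y ]′ X≤m⊎Y≤m
      where
      open Parameters p
      X≤m⊎Y≤m : X ≤ m ⊎ Y ≤ m
      X≤m⊎Y≤m with X ≤? m | Y ≤? m
      ... | yes X≤m | _ = inj₁ X≤m
      ... | no _ | yes Y≤m = inj₂ Y≤m
      ... | no X≰m | no Y≰m = ⊥-elim (<⇒≱ n<[1+m]² (≤-trans (*-mono-≤ (≰⇒> X≰m) (≰⇒> Y≰m))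
              (subst (X * Y ≤_) XY+k≡n (m≤m+n (X * Y) k))))
      via-X : X ≤ m → ∃ λ w → w ∈ shapes × Encodes k X x Y y w
      via-X X≤m = let q , l , h , q∈ = block-of k>0 X>0 k≤ X≤m in
        viaX X q , ∈-++⁺ˡ (∈-++⁺ˡ (∈-map⁺ (uncurry viaX) q∈)) , byX q l h
      via-Y : Y ≤ m → ∃ λ w → w ∈ shapes × Encodes k X x Y y w
      via-Y Y≤m = let q , l , h , q∈ = block-of k>0 Y>0 k≤ Y≤m in
        viaY Y q , ∈-++⁺ˡ (∈-++⁺ʳ (map (uncurry viaX) (blocks K m))
          (∈-map⁺ (uncurry viaY) q∈)) , byY q l h
    ... | no k≰ with <-cmp x y
    ... | tri< x<y _ _ = viay y , ∈-++⁺ʳ (map (uncurry viaX) (blocks K m) ++ map (uncurry viaY) (blocks K m))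
            (∈-++⁺ʳ (map (viax ∘ suc) (upTo reach)) (via viay (Parameters.y>1 p) (within-reach (swap-parameters p) (≰⇒> k≰)))) , byy x<y
    ... | tri≈ _ x≡y _ = ⊥-elim (x≢y x≡y)
    ... | tri> _ _ y<x = viax x , ∈-++⁺ʳ (map (uncurry viaX) (blocks K m) ++ map (uncurry viaY) (blocks K m))
            (∈-++⁺ˡ (via viax (Parameters.x>1 p) (within-reach p (≰⇒> k≰)))) , byx y<x

    codes : List (ℕ × Code)
    codes = cartesianProduct (divisors n) shapes

    swap : Quadruple → Quadruple
    swap (X , x , Y , y) = Y , y , X , x

    swap-injective : ∀ {q q′} → swap q ≡ swap q′ → q ≡ q′
    swap-injective = cong swap

    -- The codes separate solutions with x < y and with y < x alike. Letting both orientations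
    -- compete for the same codes gains a factor 2.
    orientedSolutions : List Quadruple
    orientedSolutions = solutions n ++ map swap (solutions n)

    orientedSolutions-unique : Unique orientedSolutions
    orientedSolutions-unique = Unique.++⁺ (solutions-unique n) (Unique.map⁺ swap-injective (solutions-unique n)) disjoint
      where
      disjoint : ∀ {q} → ¬ (q ∈ solutions n × q ∈ map swap (solutions n))
      disjoint (q∈ , q∈′) with ∈-map⁻ swap q∈′
      ... | q′ , q′∈ , refl = <-asym (proj₂ (solutions-sound {n} q∈)) (proj₂ (solutions-sound {n} q′∈))

    code-of : ∀ {q} → q ∈ orientedSolutions → ∃ λ w → w ∈ codes × Decodes n w q
    code-of {q} q∈ = [ direct , swapped ]′ (∈-++⁻ (solutions n) q∈)
      where
      encode : ∀ {c k X x Y y} → Parameters n c k X x Y y → x ≢ y → ∃ λ w → w ∈ codes × Decodes n w (X , x , Y , y)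
      encode {c} {k} p x≢y = let w , w∈ , e = shape-of p x≢y in
        (c , w) , ∈-cartesianProduct⁺ (∈-divisors {{n≢0}} (divides d (trans (sym cd≡n) (*-comm c d)))) w∈ , k , p , e
        where
        open Parameters p
        n≢0 : NonZero n
        n≢0 = >-nonZero (≤-trans k>0 (subst (k ≤_) XY+k≡n (m≤n+m k _)))
      direct : q ∈ solutions n → ∃ λ w → w ∈ codes × Decodes n w q
      direct q∈ = let s , x<y = solutions-sound {n} q∈ ; c , k , p = parameters s in encode p (<⇒≢ x<y)
      swapped : q ∈ map swap (solutions n) → ∃ λ w → w ∈ codes × Decodes n w q
      swapped q∈ with ∈-map⁻ swap q∈
      ... | _ , q′∈ , refl = let s , x<y = solutions-sound {n} q′∈ ; c , k , p = parameters s
        in encode (swap-parameters p) (<⇒≢ x<y ∘ sym)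

    f-bound : f n ≤ θ n * (blockCount K m + reach)
    f-bound = *-cancelˡ-≤ 2 (begin
      2 * f n                                                 ≡⟨ lem₁ (f n) ⟩
      f n + f n                                               ≡⟨ cong (f n +_) (sym (length-map swap (solutions n))) ⟩
      f n + length (map swap (solutions n))                   ≡⟨ sym (length-++ (solutions n)) ⟩
      length orientedSolutions                                ≤⟨ length-≤-codes (Decodes n) codes orientedSolutions-unique
                                                                   code-of (λ _ _ → decodes-functional) ⟩
      length codes                                            ≡⟨ length-cartesianProduct (divisors n) shapes ⟩
      θ n * length shapes                                     ≡⟨ cong (θ n *_) length-shapes ⟩
      θ n * ((blockCount K m + blockCount K m) + (reach + reach)) ≡⟨ lem₂ (θ n) (blockCount K m) reach ⟩
      2 * (θ n * (blockCount K m + reach))                    ∎)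
      where
      open ≤-Reasoning
      lem₁ : ∀ a → 2 * a ≡ a + a
      lem₁ = solve-∀
      lem₂ : ∀ t b r → t * ((b + b) + (r + r)) ≡ 2 * (t * (b + r))
      lem₂ = solve-∀

-- The divisor function grows more slowly than any power of n.

module DivisorBound where
  open import Data.List.Base using ([]; _∷_; map; upTo; cartesianProduct)
  open import Data.List.Membership.Propositional using (_∈_)
  open import Data.List.Membership.Propositional.Properties
  open import Data.List.Properties using (length-upTo)
  open import Data.List.Relation.Unary.All as All using (All)
  open import Data.List.Relation.Unary.Unique.Propositional using (Unique)
  import Data.List.Relation.Unary.Unique.Propositional.Properties as Unique
  open import Data.Nat
  open import Data.Nat.Divisibility
  open import Data.Nat.Induction using (Acc; acc; <-wellFounded)
  open import Data.Nat.ListAction using (product)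
  open import Data.Nat.Primality
  open import Data.Nat.Primality.Factorisation using (PrimeFactorisation; factorise)
  open import Data.Nat.Properties
  open import Data.Nat.Tactic.RingSolver using (solve-∀)
  open import Data.Product using (∃; _×_; _,_; proj₁; proj₂)
  open import Data.Sum using (_⊎_; inj₁; inj₂)
  open import Relation.Binary.PropositionalEquality
  open import Relation.Nullary using (yes; no)
  open import Defs using (θ)
  open Counting using (length-≤-codes; length-cartesianProduct; divisors; ∈-divisors)

  divisors-unique : ∀ n → Unique (divisors n)
  divisors-unique n = Unique.filter⁺ (_∣? n) (Unique.map⁺ suc-injective (Unique.upTo⁺ n))

  -- Induction on a: p divides e d, so by Euclid's lemma a factor p comes off either the cofactor e,
  -- leaving d alone, or d itself, raising i.
  split-divisor : ∀ {p d} a m → Prime p → d ∣ p ^ a * m → ∃ λ i → ∃ λ e → i ≤ a × e ∣ m × d ≡ p ^ i * e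
  split-divisor {p} {d} zero m _ d∣ = 0 , d , z≤n , subst (d ∣_) (*-identityˡ m) d∣ , sym (*-identityˡ d)
  split-divisor {p} {d} (suc a) m pr (divides e pN≡ed) = go (euclidsLemma e d pr (divides (p ^ a * m)
    (trans (sym pN≡ed) (trans (*-assoc p (p ^ a) m) (*-comm p (p ^ a * m))))))
    where
    instance
      p≢0 : NonZero p
      p≢0 = prime⇒nonZero pr
    go : p ∣ e ⊎ p ∣ d → ∃ λ i → ∃ λ e → i ≤ suc a × e ∣ m × d ≡ p ^ i * e
    go (inj₁ (divides e′ refl)) =
      let i , e″ , i≤a , e″∣m , d≡ = split-divisor a m pr
            (divides e′ (*-cancelˡ-≡ (p ^ a * m) (e′ * d) p
              (trans (sym (*-assoc p (p ^ a) m)) (trans pN≡ed (lem p e′ d)))))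
      in i , e″ , m≤n⇒m≤1+n i≤a , e″∣m , d≡
      where
      lem : ∀ p e d → e * p * d ≡ p * (e * d)
      lem = solve-∀
    go (inj₂ (divides d′ refl)) =
      let i , e″ , i≤a , e″∣m , d≡ = split-divisor a m pr
            (divides e (*-cancelˡ-≡ (p ^ a * m) (e * d′) p
              (trans (sym (*-assoc p (p ^ a) m)) (trans pN≡ed (lem p e d′)))))
      in suc i , e″ , s≤s i≤a , e″∣m , trans (*-comm d′ p) (trans (cong (p *_) d≡) (sym (*-assoc p (p ^ i) e″)))
      where
      lem : ∀ p e d → e * (d * p) ≡ p * (e * d)
      lem = solve-∀

  -- An inequality, since m may itself contain p; this lets `rough-bound` take repeated primes one
  -- at a time.
  θ-prime-power : ∀ {p} a m .{{_ : NonZero m}} → Prime p → θ (p ^ a * m) ≤ suc a * θ m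
  θ-prime-power {p} a m pr = ≤-trans
    (length-≤-codes (λ (i , e) d → d ≡ p ^ i * e) (cartesianProduct (upTo (suc a)) (divisors m))
      (divisors-unique (p ^ a * m)) code λ { _ _ refl refl → refl })
    (≤-reflexive (trans (length-cartesianProduct (upTo (suc a)) (divisors m))
      (cong (_* θ m) (length-upTo (suc a)))))
    where
    code : ∀ {d} → d ∈ divisors (p ^ a * m) → ∃ λ (i , e) → (i , e) ∈ cartesianProduct (upTo (suc a)) (divisors m) × d ≡ p ^ i * e
    code d∈ =
      let i , e , i≤a , e∣m , d≡ = split-divisor a m pr (proj₂ (∈-filter⁻ (_∣? (p ^ a * m)) {xs = map suc (upTo (p ^ a * m))} d∈))
      in (i , e) , ∈-cartesianProduct⁺ (∈-upTo⁺ (s≤s i≤a)) (∈-divisors e∣m) , d≡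

  strip : ∀ p n .{{_ : NonZero n}} → 1 < p → Acc _<_ n → ∃ λ a → ∃ λ m → n ≡ p ^ a * m × p ∤ m
  strip p n 1<p (acc rec) with p ∣? n
  ... | no p∤n = 0 , n , sym (*-identityˡ n) , p∤n
  ... | yes (divides m refl) = go m (rec (subst (m <_) (*-comm p m) (m<n*m {p} {{m≢0}} 1<p))) {{m≢0}}
    where
    m≢0 : NonZero m
    m≢0 = m*n≢0⇒m≢0 m
    m<n*m : ∀ {p m} .{{_ : NonZero m}} → 1 < p → m < p * m
    m<n*m {p} {m} 1<p = subst (_< p * m) (*-identityˡ m) (*-monoˡ-< m 1<p)
    go : ∀ m → Acc _<_ m → .{{_ : NonZero m}} → ∃ λ a → ∃ λ m′ → m * p ≡ p ^ a * m′ × p ∤ m′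
    go m ac = let a , m′ , m≡ , p∤m′ = strip p m 1<p ac in
      suc a , m′ , trans (*-comm m p) (trans (cong (p *_) m≡) (sym (*-assoc p (p ^ a) m′))) , p∤m′

  -- Bernoulli's inequality 1 + a/K ≤ (1 + 1/K)^a, multiplied by K^(a + 1).
  bernoulli : ∀ K a → (K + a) * K ^ a ≤ K * suc K ^ a
  bernoulli K zero = ≤-reflexive (cong (_* 1) (+-identityʳ K))
  bernoulli K (suc a) = begin
    (K + suc a) * (K * K ^ a)               ≤⟨ m≤m+n _ (a * K ^ a) ⟩
    (K + suc a) * (K * K ^ a) + a * K ^ a   ≡⟨ lem₁ K a (K ^ a) ⟩
    suc K * ((K + a) * K ^ a)               ≤⟨ *-monoʳ-≤ (suc K) (bernoulli K a) ⟩
    suc K * (K * suc K ^ a)                 ≡⟨ lem₂ (suc K) K (suc K ^ a) ⟩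
    K * (suc K * suc K ^ a)                 ∎
    where
    open ≤-Reasoning
    lem₁ : ∀ K a P → (K + (1 + a)) * (K * P) + a * P ≡ (1 + K) * ((K + a) * P)
    lem₁ = solve-∀
    lem₂ : ∀ L K P → L * (K * P) ≡ K * (L * P)
    lem₂ = solve-∀

  module _ (K : ℕ) .{{_ : NonZero K}} where

    -- θ n ≤ D (1 + 1/K) ^ t for some t ≤ log₂ n
    Bounded : ℕ → ℕ → Set
    Bounded D n = ∃ λ t → 2 ^ t ≤ n × θ n * K ^ t ≤ D * suc K ^ t

    -- Passing from m to u m with u ≥ 2^a, the exponents a and t add and the constants multiply, as
    -- soon as θ grows by a factor of at most E + 1 ≤ D (1 + 1/K)^a.
    extend : ∀ {D E} u a n m → 2 ^ a ≤ u → θ (u * m) ≤ suc E * θ m → suc E * K ^ a ≤ D * suc K ^ a →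
      n ≡ u * m → ∀ {D′} → Bounded D′ m → Bounded (D * D′) n
    extend {D} {E} u a n m 2^a≤u θ≤ E≤ refl {D′} (t , 2^t≤m , θm≤) = a + t ,
      subst (_≤ u * m) (sym (^-distribˡ-+-* 2 a t)) (*-mono-≤ 2^a≤u 2^t≤m) , (begin
      θ (u * m) * K ^ (a + t)                       ≤⟨ *-monoˡ-≤ (K ^ (a + t)) θ≤ ⟩
      suc E * θ m * K ^ (a + t)                     ≡⟨ cong (suc E * θ m *_) (^-distribˡ-+-* K a t) ⟩
      suc E * θ m * (K ^ a * K ^ t)                 ≡⟨ lem (suc E) (θ m) (K ^ a) (K ^ t) ⟩
      (suc E * K ^ a) * (θ m * K ^ t)               ≤⟨ *-mono-≤ E≤ θm≤ ⟩
      (D * suc K ^ a) * (D′ * suc K ^ t)            ≡⟨ lem D (suc K ^ a) D′ (suc K ^ t) ⟩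
      D * D′ * (suc K ^ a * suc K ^ t)              ≡⟨ cong (D * D′ *_) (sym (^-distribˡ-+-* (suc K) a t)) ⟩
      D * D′ * suc K ^ (a + t)                      ∎)
      where
      open ≤-Reasoning
      lem : ∀ a b c d → a * b * (c * d) ≡ (a * c) * (b * d)
      lem = solve-∀

    -- A prime p ≥ 2^K at most doubles θ, and 2 ≤ (1 + 1/K)^K. As p pays for K more factors in 2^t,
    -- large primes leave the constant at 1.
    rough-bound : ∀ ps → All Prime ps → (2 ^ K) Rough (product ps) → Bounded 1 (product ps)
    rough-bound [] _ _ = 0 , ≤-refl , ≤-refl
    rough-bound (p ∷ ps) (pr All.∷ prs) r = extend {1} {1} p K (p * product ps) (product ps)
      (rough⇒≤ {{prime⇒nonTrivial pr}} (rough∧∣⇒rough r (m∣m*n (product ps))))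
      (subst (λ z → θ (z * product ps) ≤ 2 * θ (product ps)) (*-identityʳ p)
        (θ-prime-power 1 (product ps) {{productOfPrimes≢0 prs}} pr))
      2K^K≤ refl {1} (rough-bound ps prs (rough∧∣⇒rough r (n∣m*n p)))
      where
      2K^K≤ : 2 * K ^ K ≤ 1 * suc K ^ K
      2K^K≤ = *-cancelˡ-≤ K (begin
        K * (2 * K ^ K)       ≡⟨ lem K (K ^ K) ⟩
        (K + K) * K ^ K       ≤⟨ bernoulli K K ⟩
        K * suc K ^ K         ≡⟨ cong (K *_) (sym (*-identityˡ (suc K ^ K))) ⟩
        K * (1 * suc K ^ K)   ∎)
        where
        open ≤-Reasoning
        lem : ∀ K P → K * (2 * P) ≡ (K + K) * P
        lem = solve-∀

    -- Trial division by i from 2 up to 2^K. Removing i^a divides θ by at most a + 1 ≤ K (1 +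
    -- 1/K)^a, so each of the j remaining values of i puts one factor K into the constant; the final
    -- cofactor is 2^K-rough.
    sieve : ∀ j i n .{{_ : NonZero n}} → i + j ≡ 2 ^ K → 1 < i → i Rough n → Bounded (K ^ j * 1) n
    sieve zero i n i≡ 1<i r = subst (Bounded 1) (sym isFactorisation)
      (rough-bound factors factorsPrime (subst (_Rough product factors) (trans (sym (+-identityʳ i)) i≡)
        (subst (i Rough_) isFactorisation r)))
      where open PrimeFactorisation (factorise n)
    sieve (suc j) i n i+j≡ 1<i r with strip i n 1<i (<-wellFounded n)
    ... | a , m , n≡ , i∤m = subst (λ D → Bounded D n) (sym (*-assoc K (K ^ j) 1))
      (extend {K} {a} (i ^ a) a n m (^-monoˡ-≤ a 1<i) (θ≤ a n≡)
        (≤-trans (*-monoˡ-≤ (K ^ a) (+-monoˡ-≤ a (>-nonZero⁻¹ K))) (bernoulli K a)) n≡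
        (sieve j (suc i) m {{m≢0}} (trans (sym (+-suc i j)) i+j≡) (m<n⇒m<1+n 1<i)
          (∤⇒rough-suc i∤m (rough∧∣⇒rough r (divides (i ^ a) n≡)))))
      where
      m≢0 : NonZero m
      m≢0 = m*n≢0⇒n≢0 (i ^ a) {{subst NonZero n≡ it}}
        where
        it : NonZero n
        it = ≢-nonZero (≢-nonZero⁻¹ n)
      -- If a > 0, then i is prime, because i divides the i-rough n; a composite i occurs only with
      -- a = 0.
      θ≤ : ∀ a → n ≡ i ^ a * m → θ (i ^ a * m) ≤ suc a * θ m
      θ≤ zero _ = ≤-reflexive (trans (cong θ (*-identityˡ m)) (sym (*-identityˡ (θ m))))
      θ≤ (suc a) n≡ = θ-prime-power (suc a) m {{m≢0}} (rough∧∣⇒prime {{n>1⇒nonTrivial 1<i}} r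
        (divides (i ^ a * m) (trans n≡ (trans (*-assoc i (i ^ a) m) (*-comm i (i ^ a * m))))))

  -- The constant has one factor K + 1 for each i with 2 ≤ i < 2^(K + 1).
  θ-bound : ∀ K → ∃ λ D → ∀ n .{{_ : NonZero n}} → Bounded (suc K) D n
  θ-bound K = suc K ^ (2 ^ suc K ∸ 2) * 1 , λ n →
    sieve (suc K) (2 ^ suc K ∸ 2) 2 n (m+[n∸m]≡n (*-monoʳ-≤ 2 (m^n>0 2 K))) ≤-refl 2-rough

-- f(n) < n for large n.

module Asymptotics where
  open import Data.Empty using (⊥-elim)
  open import Data.Nat
  open import Data.Nat.DivMod using (m/n*n≤m; m/n≤m)
  open import Data.Nat.Properties
  open import Data.Nat.Tactic.RingSolver using (solve-∀)
  open import Data.Product using (∃; _×_; _,_)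
  open import Relation.Binary.PropositionalEquality
  open import Relation.Nullary using (yes; no)
  open import Defs using (f; θ; isqrt)
  open Defs.SqrtLemmas using (isqrt-lower; isqrt-upper; square-cancel-<)
  open Counting using (blockCount; f-bound)
  open DivisorBound using (θ-bound)

  ^-swap : ∀ a b c → (a ^ b) ^ c ≡ (a ^ c) ^ b
  ^-swap a b c = trans (^-*-assoc a b c) (trans (cong (a ^_) (*-comm b c)) (sym (^-*-assoc a c b)))

  ^-cancelˡ-≤ : ∀ {a b} k .{{_ : NonZero k}} → a ^ k ≤ b ^ k → a ≤ b
  ^-cancelˡ-≤ {a} {b} k h with a ≤? b
  ... | yes a≤b = a≤b
  ... | no a≰b  = ⊥-elim (<⇒≱ (^-monoˡ-< k (≰⇒> a≰b)) h)

  ^-distribʳ-* : ∀ a b k → (a * b) ^ k ≡ a ^ k * b ^ k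
  ^-distribʳ-* a b zero    = refl
  ^-distribʳ-* a b (suc k) = trans (cong (a * b *_) (^-distribʳ-* a b k)) (lem a b (a ^ k) (b ^ k))
    where
    lem : ∀ a b c d → a * b * (c * d) ≡ a * c * (b * d)
    lem = solve-∀

  -- If (1 + 1/(K + 1))^8 ≤ 2, the eighth power of the factor (1 + 1/(K + 1))^t in `θ-bound` is at
  -- most 2^t ≤ n. This states θ(n) = O(n^(1/8)) without real exponents.
  θ⁸-bound : ∀ K → suc (suc K) ^ 8 ≤ 2 * suc K ^ 8 → ∃ λ D → ∀ n .{{_ : NonZero n}} → θ n ^ 8 ≤ D ^ 8 * n
  θ⁸-bound K [K+2]⁸≤2[K+1]⁸ = let D , bound = θ-bound K in D , λ n → let t , 2^t≤n , θ≤ = bound n in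
      power D n t (θ n) (suc K ^ t) (suc (suc K) ^ t) {{m^n≢0 (suc K) t}} 2^t≤n θ≤ (ratio t)
    where
    open ≤-Reasoning
    ratio : ∀ t → (suc (suc K) ^ t) ^ 8 ≤ 2 ^ t * (suc K ^ t) ^ 8
    ratio t = begin
      (suc (suc K) ^ t) ^ 8     ≡⟨ ^-swap (suc (suc K)) t 8 ⟩
      (suc (suc K) ^ 8) ^ t     ≤⟨ ^-monoˡ-≤ t [K+2]⁸≤2[K+1]⁸ ⟩
      (2 * suc K ^ 8) ^ t       ≡⟨ ^-distribʳ-* 2 (suc K ^ 8) t ⟩
      2 ^ t * (suc K ^ 8) ^ t   ≡⟨ cong (2 ^ t *_) (^-swap (suc K) 8 t) ⟩
      2 ^ t * (suc K ^ t) ^ 8   ∎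
    power : ∀ D n t x u v .{{_ : NonZero u}} → 2 ^ t ≤ n → x * u ≤ D * v → v ^ 8 ≤ 2 ^ t * u ^ 8 → x ^ 8 ≤ D ^ 8 * n
    power D n t x u v 2^t≤n xu≤ v≤ = *-cancelʳ-≤ _ _ (u ^ 8) {{m^n≢0 u 8}} (begin
      x ^ 8 * u ^ 8             ≡⟨ sym (^-distribʳ-* x u 8) ⟩
      (x * u) ^ 8               ≤⟨ ^-monoˡ-≤ 8 xu≤ ⟩
      (D * v) ^ 8               ≡⟨ ^-distribʳ-* D v 8 ⟩
      D ^ 8 * v ^ 8             ≤⟨ *-monoʳ-≤ (D ^ 8) (≤-trans v≤ (*-monoˡ-≤ (u ^ 8) 2^t≤n)) ⟩
      D ^ 8 * (n * u ^ 8)       ≡⟨ sym (*-assoc (D ^ 8) n (u ^ 8)) ⟩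
      D ^ 8 * n * u ^ 8         ∎)

  blockCount-≤ : ∀ K m → blockCount K m ≤ m * suc K
  blockCount-≤ K zero    = z≤n
  blockCount-≤ K (suc m) = +-mono-≤ (s≤s (m/n≤m K (suc m))) (blockCount-≤ K m)

  module _ (D : ℕ) (θ⁸≤ : ∀ n .{{_ : NonZero n}} → θ n ^ 8 ≤ D ^ 8 * n) (n : ℕ) .{{_ : NonZero n}} where

    m r s : ℕ
    m = isqrt n
    r = isqrt m
    s = suc r

    m<s² : m < s * s
    m<s² = isqrt-upper m

    n<s⁴ : n < s ^ 4
    n<s⁴ = begin-strict
      n                 <⟨ isqrt-upper n ⟩
      suc m * suc m     ≤⟨ *-mono-≤ m<s² m<s² ⟩
      (s * s) * (s * s) ≡⟨ lem s ⟩
      s ^ 4             ∎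
      where
      open ≤-Reasoning
      lem : ∀ s → (s * s) * (s * s) ≡ s * (s * (s * (s * 1)))
      lem = solve-∀

    r⁴≤n : r ^ 4 ≤ n
    r⁴≤n = begin
      r ^ 4             ≡⟨ lem r ⟩
      (r * r) * (r * r) ≤⟨ *-mono-≤ (isqrt-lower m) (isqrt-lower m) ⟩
      m * m             ≤⟨ isqrt-lower n ⟩
      n                 ∎
      where
      open ≤-Reasoning
      lem : ∀ s → s * (s * (s * (s * 1))) ≡ (s * s) * (s * s)
      lem = solve-∀

    -- The cut-off k ≤ s, with s just above n^¼, balances the two parts: at most m s ≤ s³ blocks,
    -- and a reach of at most 2n / (2s) ≤ s³.
    f≤ : f n ≤ θ n * (2 * s ^ 3)
    f≤ = ≤-trans (f-bound n m r (isqrt-upper n)) (*-monoʳ-≤ (θ n) (begin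
      blockCount r m + Z    ≤⟨ +-mono-≤ blocks≤ Z≤ ⟩
      s ^ 3 + s ^ 3         ≡⟨ lem (s ^ 3) ⟩
      2 * s ^ 3             ∎))
      where
      open ≤-Reasoning
      Z : ℕ
      Z = (2 * n ∸ 1) / (3 + 2 * r)
      lem : ∀ a → a + a ≡ 2 * a
      lem = solve-∀
      blocks≤ : blockCount r m ≤ s ^ 3
      blocks≤ = begin
        blockCount r m      ≤⟨ blockCount-≤ r m ⟩
        m * s               ≤⟨ *-monoˡ-≤ s (<⇒≤ m<s²) ⟩
        s * s * s           ≡⟨ cube s ⟩
        s ^ 3               ∎
        where
        cube : ∀ s → s * s * s ≡ s * (s * (s * 1))
        cube = solve-∀
      Z≤ : Z ≤ s ^ 3
      Z≤ = *-cancelʳ-≤ Z (s ^ 3) (2 * s) (begin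
        Z * (2 * s)         ≤⟨ *-monoʳ-≤ Z (≤-trans (n≤1+n (2 * s)) (≤-reflexive (3+2r r))) ⟩
        Z * (3 + 2 * r)     ≤⟨ m/n*n≤m (2 * n ∸ 1) (3 + 2 * r) ⟩
        2 * n ∸ 1           ≤⟨ m∸n≤m (2 * n) 1 ⟩
        2 * n               ≤⟨ *-monoʳ-≤ 2 (<⇒≤ n<s⁴) ⟩
        2 * s ^ 4           ≡⟨ power s ⟩
        s ^ 3 * (2 * s)     ∎)
        where
        3+2r : ∀ r → 1 + 2 * (1 + r) ≡ 3 + 2 * r
        3+2r = solve-∀
        power : ∀ s → 2 * (s * (s * (s * (s * 1)))) ≡ (s * (s * (s * 1))) * (2 * s)
        power = solve-∀

    θ²≤ : θ n ^ 2 ≤ D ^ 2 * s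
    θ²≤ = ^-cancelˡ-≤ 4 (begin
      (θ n ^ 2) ^ 4         ≡⟨ ^-*-assoc (θ n) 2 4 ⟩
      θ n ^ 8               ≤⟨ θ⁸≤ n ⟩
      D ^ 8 * n             ≤⟨ *-monoʳ-≤ (D ^ 8) (<⇒≤ n<s⁴) ⟩
      D ^ 8 * s ^ 4         ≡⟨ cong (_* s ^ 4) (sym (^-*-assoc D 2 4)) ⟩
      (D ^ 2) ^ 4 * s ^ 4   ≡⟨ sym (^-distribʳ-* (D ^ 2) s 4) ⟩
      (D ^ 2 * s) ^ 4       ∎)
      where open ≤-Reasoning

    -- Squaring turns the bound n^(1/8) for θ into the integral power s. Then f(n)² ≤ 4 D² s^7 has
    -- degree 7 in n^¼, against n² ≥ r^8; the factor 2^7 comes from s ≤ 2r.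
    f<n : 4 * 2 ^ 7 * D ^ 2 < r → f n < n
    f<n h = square-cancel-< (begin-strict
      f n * f n                                     ≤⟨ *-mono-≤ f≤ f≤ ⟩
      θ n * (2 * s ^ 3) * (θ n * (2 * s ^ 3))       ≡⟨ lem₁ (θ n) s ⟩
      θ n ^ 2 * (4 * s ^ 6)                         ≤⟨ *-monoˡ-≤ (4 * s ^ 6) θ²≤ ⟩
      D ^ 2 * s * (4 * s ^ 6)                       ≡⟨ lem₂ (D ^ 2) s ⟩
      4 * D ^ 2 * s ^ 7                             ≤⟨ *-monoʳ-≤ (4 * D ^ 2) (^-monoˡ-≤ 7 s≤2r) ⟩
      4 * D ^ 2 * (2 * r) ^ 7                       ≡⟨ cong (4 * D ^ 2 *_) (^-distribʳ-* 2 r 7) ⟩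
      4 * D ^ 2 * (2 ^ 7 * r ^ 7)                     ≡⟨ lem₃ (2 ^ 7) (D ^ 2) (r ^ 7) ⟩
      4 * 2 ^ 7 * D ^ 2 * r ^ 7                           <⟨ *-monoˡ-< (r ^ 7) {{m^n≢0 r 7 {{>-nonZero (≤-<-trans z≤n h)}}}} h ⟩
      r * r ^ 7                                     ≡⟨ ^-distribˡ-+-* r 4 4 ⟩
      r ^ 4 * r ^ 4                                 ≤⟨ *-mono-≤ r⁴≤n r⁴≤n ⟩
      n * n                                         ∎)
      where
      open ≤-Reasoning
      s≤2r : s ≤ 2 * r
      s≤2r = subst (suc r ≤_) (cong (r +_) (sym (+-identityʳ r))) (+-monoˡ-≤ r (≤-<-trans z≤n h))
      lem₁ : ∀ t s → t * (2 * (s * (s * (s * 1)))) * (t * (2 * (s * (s * (s * 1))))) ≡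
        (t * (t * 1)) * (4 * (s * (s * (s * (s * (s * (s * 1)))))))
      lem₁ = solve-∀
      lem₂ : ∀ d s → d * s * (4 * (s * (s * (s * (s * (s * (s * 1))))))) ≡
        4 * d * (s * (s * (s * (s * (s * (s * (s * 1)))))))
      lem₂ = solve-∀
      lem₃ : ∀ a d p → 4 * d * (a * p) ≡ 4 * a * d * p
      lem₃ = solve-∀

  ^-cancelˡ-< : ∀ {a b} k → a ^ k < b ^ k → a < b
  ^-cancelˡ-< {a} {b} k h with a <? b
  ... | yes a<b = a<b
  ... | no a≮b  = ⊥-elim (<⇒≱ h (^-monoˡ-≤ k (≮⇒≥ a≮b)))

  eventually-f<n : ∃ λ N → ∀ n → N ≤ n → f n < n
  -- 12 is the least base b with (b + 1)^8 ≤ 2 b^8.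
  eventually-f<n = threshold (θ⁸-bound 11 (≤ᵇ⇒≤ (13 ^ 8) (2 * 12 ^ 8) _))
    where
    threshold : (∃ λ D → ∀ n .{{_ : NonZero n}} → θ n ^ 8 ≤ D ^ 8 * n) → ∃ λ N → ∀ n → N ≤ n → f n < n
    threshold (D , θ⁸≤) = go (4 * 2 ^ 7 * D ^ 2) ≤-refl
      where
      go : ∀ R → 4 * 2 ^ 7 * D ^ 2 ≤ R → ∃ λ N → ∀ n → N ≤ n → f n < n
      go R D≤R = suc R ^ 4 , λ n N≤n → large n N≤n {{>-nonZero (≤-trans (m^n>0 (suc R) 4) N≤n)}}
        where
        large : ∀ n → suc R ^ 4 ≤ n → .{{_ : NonZero n}} → f n < n
        large n N≤n = f<n D θ⁸≤ n (≤-<-trans D≤R (s≤s⁻¹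
          (^-cancelˡ-< {suc R} {suc (isqrt (isqrt n))} 4 (≤-<-trans N≤n (n<s⁴ D θ⁸≤ n)))))

-- Estimates for the approximants of exp, log and √n.

module Series where
  open import Data.Nat as ℕ using (ℕ; zero; suc; s≤s; z≤n)
  import Data.Nat.Properties as ℕ
  open import Data.Nat.Tactic.RingSolver as ℕSolver using ()
  open import Data.Product using (∃; _×_; _,_)
  open import Data.Rational
  import Data.Rational.Properties as ℚ
  open import Data.Rational.Properties using (module ≤-Reasoning)
  open import Data.Sum using (_⊎_; inj₁; inj₂)
  open import Relation.Binary.PropositionalEquality
    using (_≡_; refl; sym; trans; cong; cong₂; subst; subst₂)
  open import Relation.Nullary.Decidable using (toWitness)
  open import Tactic.RingSolver as RingSolver using ()
  open import Defs using (sum; expTerm; expSum; logSeq; isqrt; sqrtSeq)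
  open Defs.RationalLemmas
  open Defs.ExpLemmas using (expTerm-nonNeg; expTerm-∣∣; sum-mono)
  open Defs.SqrtLemmas
  open Defs.LogLemmas
  open ≤-Reasoning

  0≤1 : 0ℚ ≤ 1ℚ
  0≤1 = 0≤fromℕ 1

  0≤p*p : ∀ p → 0ℚ ≤ p * p
  0≤p*p p with ℚ.≤-total 0ℚ p
  ... | inj₁ 0≤p = 0≤* 0≤p 0≤p
  ... | inj₂ p≤0 = subst (0ℚ ≤_) (lem p) (0≤* (ℚ.neg-antimono-≤ p≤0) (ℚ.neg-antimono-≤ p≤0))
    where
    lem : ∀ p → - p * - p ≡ p * p
    lem = RingSolver.solve-∀ ring

  0≤q-p : ∀ {p q} → p ≤ q → 0ℚ ≤ q - p
  0≤q-p {p} {q} p≤q = subst (_≤ q - p) (ℚ.+-inverseʳ p) (ℚ.+-monoˡ-≤ (- p) p≤q)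

  0≤q-p⇒p≤q : ∀ {p q} → 0ℚ ≤ q - p → p ≤ q
  0≤q-p⇒p≤q {p} {q} h = subst₂ _≤_ (ℚ.+-identityʳ p) (lem p q) (ℚ.+-monoʳ-≤ p h)
    where
    lem : ∀ p q → p + (q - p) ≡ q
    lem = RingSolver.solve-∀ ring

  expSum-mono : ∀ {a b} → 0ℚ ≤ a → a ≤ b → ∀ n → expSum a n ≤ expSum b n
  expSum-mono {a} {b} 0≤a a≤b = sum-≤ λ j → ℚ.≤-trans (p≤∣p∣ (expTerm a j))
    (expTerm-∣∣ (ℚ.≤-trans 0≤a a≤b) (subst (_≤ b) (sym (ℚ.0≤p⇒∣p∣≡p 0≤a)) a≤b) j)

  -- The first two terms of the binomial expansion of (a + b) ^ (j + 1) / (j + 1) !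
  expTerm-+ : ∀ {a b} → 0ℚ ≤ a → 0ℚ ≤ b → ∀ j →
    expTerm a (suc j) + b * expTerm a j ≤ expTerm (a + b) (suc j)
  expTerm-+ {a} {b} _ _ zero = ℚ.≤-reflexive (lem a b)
    where
    lem : ∀ a b → 1ℚ * a * 1ℚ + b * 1ℚ ≡ 1ℚ * (a + b) * 1ℚ
    lem = RingSolver.solve-∀ ring
  expTerm-+ {a} {b} 0≤a 0≤b (suc j) = go (expTerm a j) (recip j) (recip (suc j)) (fromℕ (suc j))
    (expTerm (a + b) (suc j)) (expTerm-nonNeg 0≤a j) (0≤recip (suc j)) (recip-fromℕ j)
    (trans (cong (recip (suc j) *_) (sym (fromℕ-+ 1 (suc j)))) (recip-fromℕ (suc j)))
    (expTerm-+ 0≤a 0≤b j)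
    where
    go : ∀ T r r′ c E → 0ℚ ≤ T → 0ℚ ≤ r′ → r * c ≡ 1ℚ → r′ * (1ℚ + c) ≡ 1ℚ → T * a * r + b * T ≤ E →
      T * a * r * a * r′ + b * (T * a * r) ≤ E * (a + b) * r′
    go T r r′ c E 0≤T 0≤r′ rc r′c h = begin
      T * a * r * a * r′ + b * (T * a * r)
        ≡⟨ cong (λ z → T * a * r * a * r′ + z) (trans (sym (ℚ.*-identityʳ _)) (cong (b * (T * a * r) *_) (sym r′c))) ⟩
      T * a * r * a * r′ + b * (T * a * r) * (r′ * (1ℚ + c))
        ≡⟨ lem₁ T a b r r′ c ⟩
      (T * a * r * a + T * a * r * b + b * T * a * (r * c)) * r′
        ≡⟨ cong (λ z → (T * a * r * a + T * a * r * b + b * T * a * z) * r′) rc ⟩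
      (T * a * r * a + T * a * r * b + b * T * a * 1ℚ) * r′
        ≤⟨ *-monoʳ 0≤r′ (p≤p+q {T * a * r * a + T * a * r * b + b * T * a * 1ℚ} {b * b * T} (0≤* (0≤p*p b) 0≤T)) ⟩
      (T * a * r * a + T * a * r * b + b * T * a * 1ℚ + b * b * T) * r′
        ≡⟨ lem₂ T a b r r′ ⟩
      (T * a * r + b * T) * (a + b) * r′
        ≤⟨ *-monoʳ 0≤r′ (*-monoʳ (0≤+ 0≤a 0≤b) h) ⟩
      E * (a + b) * r′ ∎
      where
      lem₁ : ∀ T a b r r′ c → T * a * r * a * r′ + b * (T * a * r) * (r′ * (1ℚ + c)) ≡
        (T * a * r * a + T * a * r * b + b * T * a * (r * c)) * r′
      lem₁ = RingSolver.solve-∀ ring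
      lem₂ : ∀ T a b r r′ → (T * a * r * a + T * a * r * b + b * T * a * 1ℚ + b * b * T) * r′ ≡
        (T * a * r + b * T) * (a + b) * r′
      lem₂ = RingSolver.solve-∀ ring

  -- A truncated form of exp (a + b) ≥ (1 + b) exp a. The factor b raises degrees by one, so its sum
  -- stops one term earlier.
  expSum-+ : ∀ {a b} → 0ℚ ≤ a → 0ℚ ≤ b → ∀ n →
    expSum a (suc n) + b * expSum a n ≤ expSum (a + b) (suc n)
  expSum-+ {a} {b} _ _ zero = ℚ.≤-reflexive (trans (cong (λ z → 0ℚ + 1ℚ + z) (ℚ.*-zeroʳ b)) (ℚ.+-identityʳ (0ℚ + 1ℚ)))
  expSum-+ {a} {b} 0≤a 0≤b (suc n) = begin
    (expSum a (suc n) + expTerm a (suc n)) + b * (expSum a n + expTerm a n)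
      ≡⟨ lem (expSum a (suc n)) (expTerm a (suc n)) b (expSum a n) (expTerm a n) ⟩
    (expSum a (suc n) + b * expSum a n) + (expTerm a (suc n) + b * expTerm a n)
      ≤⟨ ℚ.+-mono-≤ (expSum-+ 0≤a 0≤b n) (expTerm-+ 0≤a 0≤b n) ⟩
    expSum (a + b) (suc n) + expTerm (a + b) (suc n) ∎
    where
    lem : ∀ p q b r s → (p + q) + b * (r + s) ≡ (p + b * r) + (q + b * s)
    lem = RingSolver.solve-∀ ring

  -- exp (t / (K + 1)) ≥ (1 + 1 / (K + 1)) ^ t
  expSum-power : ∀ K t {k} → t ℕ.< k →
    fromℕ (suc (suc K) ℕ.^ t) ≤ fromℕ (suc K ℕ.^ t) * expSum (fromℕ t * recip K) k
  expSum-power K zero {suc k} _ = subst₂ _≤_ refl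
    (trans (lem (expSum (fromℕ 0 * recip K) (suc k))) refl)
    (sum-mono (expTerm-nonNeg (0≤* (0≤fromℕ 0) (0≤recip K))) {1} {suc k} (s≤s z≤n))
    where
    lem : ∀ x → x ≡ 1ℚ * x
    lem x = sym (ℚ.*-identityˡ x)
  expSum-power K (suc t) {suc k} (s≤s t<k) = begin
    fromℕ (suc (suc K) ℕ.* suc (suc K) ℕ.^ t)       ≡⟨ fromℕ-* (suc (suc K)) (suc (suc K) ℕ.^ t) ⟩
    fromℕ (suc (suc K)) * P                         ≡⟨ cong (_* P) (fromℕ-+ 1 (suc K)) ⟩
    (1ℚ + c) * P                                    ≡⟨ lem₀ c P ⟩
    -- `expSum-+` needs the induction hypothesis at two truncations, `suc k` terms for c and `k`
    -- terms for 1; hence each step of t uses up one term.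
    c * P + P                                       ≤⟨ ℚ.+-mono-≤ (*-monoˡ (0≤fromℕ (suc K)) (expSum-power K t (ℕ.m<n⇒m<1+n t<k)))
                                                         (expSum-power K t t<k) ⟩
    c * (Q * E (suc k)) + Q * E k                   ≡⟨ cong (λ z → c * (Q * E (suc k)) + z)
                                                         (trans (sym (ℚ.*-identityˡ _)) (cong (_* (Q * E k)) (sym (recip-fromℕ K)))) ⟩
    c * (Q * E (suc k)) + r * c * (Q * E k)         ≡⟨ lem₁ c Q r (E (suc k)) (E k) ⟩
    c * Q * (E (suc k) + r * E k)                   ≤⟨ *-monoˡ (0≤* (0≤fromℕ (suc K)) (0≤fromℕ (suc K ℕ.^ t)))
                                                         (expSum-+ {fromℕ t * r} {r} (0≤* (0≤fromℕ t) (0≤recip K)) (0≤recip K) k) ⟩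
    c * Q * expSum (fromℕ t * r + r) (suc k)        ≡⟨ cong₂ (λ u v → u * expSum v (suc k)) (sym (fromℕ-* (suc K) (suc K ℕ.^ t)))
                                                         (trans (lem₂ (fromℕ t) r) (cong (_* r) (sym (fromℕ-+ 1 t)))) ⟩
    fromℕ (suc K ℕ.* suc K ℕ.^ t) * expSum (fromℕ (suc t) * r) (suc k) ∎
    where
    c r P Q : ℚ
    c = fromℕ (suc K)
    r = recip K
    P = fromℕ (suc (suc K) ℕ.^ t)
    Q = fromℕ (suc K ℕ.^ t)
    E : ℕ → ℚ
    E k = expSum (fromℕ t * r) k
    lem₀ : ∀ c P → (1ℚ + c) * P ≡ c * P + P
    lem₀ = RingSolver.solve-∀ ring
    lem₁ : ∀ c Q r E E′ → c * (Q * E) + r * c * (Q * E′) ≡ c * Q * (E + r * E′)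
    lem₁ = RingSolver.solve-∀ ring
    lem₂ : ∀ t r → t * r + r ≡ (1ℚ + t) * r
    lem₂ = RingSolver.solve-∀ ring

  -- Lower bounds for the Riemann sums of the logarithm.

  logSeq-mono : ∀ {m n} k → m ℕ.≤ n → logSeq m k ≤ logSeq n k
  logSeq-mono k m≤n = sum-mono (λ i → 0≤recip (suc k ℕ.+ i)) (ℕ.*-monoˡ-≤ (suc k) (ℕ.∸-monoˡ-≤ 1 m≤n))

  logSeq-nonNeg : ∀ n k → 0ℚ ≤ logSeq n k
  logSeq-nonNeg n k = logSeq-mono {0} {n} k z≤n

  -- Put A = a + 1 and B = b + 1. The part of the sum for A B beyond A is the sum for log B with a
  -- mesh A times finer. Right-endpoint sums of the decreasing 1/t only grow under refinement, so
  -- superadditivity is exact for every k.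
  logSeq-* : ∀ a b k → logSeq (suc a) k + logSeq (suc b) k ≤ logSeq (suc a ℕ.* suc b) k
  logSeq-* a b k = begin
    riemann a k + riemann b k
      ≤⟨ ℚ.+-monoʳ-≤ (riemann a k) (ℚ.≤-trans (riemann-refine b k a)
           (ℚ.≤-reflexive (cong (riemann b) (refine-comm k a)))) ⟩
    riemann a k + riemann b (refine a k)
      ≡⟨ cong (riemann a k +_) (sum-cong (λ i → cong recip (ℕ.+-assoc (suc k) (a ℕ.* suc k) i)) (b ℕ.* suc (refine a k))) ⟩
    riemann a k + sum (λ i → recip (suc k ℕ.+ (a ℕ.* suc k ℕ.+ i))) (b ℕ.* suc (refine a k))
      ≡⟨ sym (sum-+ (λ i → recip (suc k ℕ.+ i)) (a ℕ.* suc k) (b ℕ.* suc (refine a k))) ⟩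
    sum (λ i → recip (suc k ℕ.+ i)) (a ℕ.* suc k ℕ.+ b ℕ.* suc (refine a k))
      ≡⟨ cong (sum (λ i → recip (suc k ℕ.+ i))) (lem a b k) ⟩
    logSeq (suc a ℕ.* suc b) k ∎
    where
    lem : ∀ a b k → a ℕ.* (1 ℕ.+ k) ℕ.+ b ℕ.* (1 ℕ.+ (k ℕ.+ a ℕ.* (1 ℕ.+ k))) ≡ (b ℕ.+ a ℕ.* (1 ℕ.+ b)) ℕ.* (1 ℕ.+ k)
    lem = ℕSolver.solve-∀

  logSeq-square : ∀ {m n} k → 0 ℕ.< m → m ℕ.* m ℕ.≤ n → logSeq m k + logSeq m k ≤ logSeq n k
  logSeq-square {suc m} k _ m²≤n = ℚ.≤-trans (logSeq-* m m k) (logSeq-mono k m²≤n)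

  -- log 2 ≥ ½, since each of its M terms is at least 1/(2M); superadditivity does the rest.
  log-2^ : ∀ t k → fromℕ t * ½ ≤ logSeq (2 ℕ.^ t) k
  log-2^ zero k = logSeq-nonNeg 1 k
  log-2^ (suc t) k = begin
    fromℕ (suc t) * ½                       ≡⟨ cong (_* ½) (fromℕ-+ 1 t) ⟩
    (1ℚ + fromℕ t) * ½                      ≡⟨ lem (fromℕ t) ⟩
    ½ + fromℕ t * ½                         ≤⟨ ℚ.+-mono-≤ ½≤log2 (log-2^ t k) ⟩
    logSeq 2 k + logSeq (2 ℕ.^ t) k         ≤⟨ superadditive (2 ℕ.^ t) {{ℕ.m^n≢0 2 t}} ⟩
    logSeq (2 ℕ.* 2 ℕ.^ t) k                ∎
    where
    lem : ∀ t → (1ℚ + t) * ½ ≡ ½ + t * ½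
    lem = RingSolver.solve-∀ ring
    superadditive : ∀ N .{{_ : ℕ.NonZero N}} → logSeq 2 k + logSeq N k ≤ logSeq (2 ℕ.* N) k
    superadditive (suc N) = logSeq-* 1 N k
    p : ℕ
    p = suc k ℕ.+ k
    ½≡ : ∀ c → c * recip p * fromℕ 2 ≡ 1ℚ → ½ ≡ c * recip p
    ½≡ c h = trans (cong (_* ½) (sym h)) (half (c * recip p))
      where
      half : ∀ x → x * fromℕ 2 * ½ ≡ x
      half = RingSolver.solve-∀ ring
    ½≤log2 : ½ ≤ logSeq 2 k
    ½≤log2 = begin
      ½                                     ≡⟨ ½≡ (fromℕ (suc k)) (trans (swap (fromℕ (suc k)) (recip p) (fromℕ 2))
                                                 (trans (cong (recip p *_) (trans (sym (fromℕ-* (suc k) 2)) (cong fromℕ (double k)))) (recip-fromℕ p))) ⟩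
      fromℕ (suc k) * recip p               ≡⟨ sym (sum-const (recip p) (suc k)) ⟩
      sum (λ _ → recip p) (suc k)           ≤⟨ sum-≤-below (suc k) (λ { i (s≤s i≤k) → recip-anti (ℕ.+-monoʳ-≤ (suc k) i≤k) }) ⟩
      sum (λ i → recip (suc k ℕ.+ i)) (suc k) ≡⟨ cong (sum (λ i → recip (suc k ℕ.+ i))) (sym (ℕ.*-identityˡ (suc k))) ⟩
      logSeq 2 k                            ∎
      where
      swap : ∀ a b c → a * b * c ≡ b * (a * c)
      swap = RingSolver.solve-∀ ring
      double : ∀ k → (1 ℕ.+ k) ℕ.* 2 ≡ 1 ℕ.+ (1 ℕ.+ k ℕ.+ k)
      double = ℕSolver.solve-∀

  -- The tangent of 1 / t at t = D / 2.
  tangent : ∀ {r t e D} → 0ℚ ≤ r → r * t ≡ 1ℚ → e * D ≡ 1ℚ → fromℕ 4 * (D - t) * e * e ≤ r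
  tangent {r} {t} {e} {D} 0≤r rt eD = 0≤q-p⇒p≤q (subst (0ℚ ≤_) eq (0≤* 0≤r (0≤p*p (1ℚ - (e + e) * t))))
    where
    lem₁ : ∀ r t e → r * ((1ℚ - (e + e) * t) * (1ℚ - (e + e) * t)) ≡
      r - fromℕ 4 * e * (r * t) + fromℕ 4 * t * e * e * (r * t)
    lem₁ = RingSolver.solve-∀ ring
    lem₂ : ∀ r t e D → r - fromℕ 4 * (D - t) * e * e ≡ r - fromℕ 4 * e * (e * D) + fromℕ 4 * t * e * e * 1ℚ
    lem₂ = RingSolver.solve-∀ ring
    eq : r * ((1ℚ - (e + e) * t) * (1ℚ - (e + e) * t)) ≡ r - fromℕ 4 * (D - t) * e * e
    eq = trans (lem₁ r t e) (trans (cong₂ (λ u v → r - fromℕ 4 * e * u + fromℕ 4 * t * e * e * v)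
      (trans rt (sym eD)) rt) (sym (lem₂ r t e D)))

  sum-affine : ∀ A e N → sum (λ i → fromℕ 4 * (A - fromℕ i) * e * e) N ≡
    fromℕ 2 * fromℕ N * (A + A - fromℕ N + 1ℚ) * e * e
  sum-affine A e zero = sym (lem A e)
    where
    lem : ∀ A e → fromℕ 2 * 0ℚ * (A + A - 0ℚ + 1ℚ) * e * e ≡ 0ℚ
    lem = RingSolver.solve-∀ ring
  sum-affine A e (suc N) = begin-equality
    sum (λ i → fromℕ 4 * (A - fromℕ i) * e * e) N + fromℕ 4 * (A - fromℕ N) * e * e
      ≡⟨ cong (_+ fromℕ 4 * (A - fromℕ N) * e * e) (sum-affine A e N) ⟩
    fromℕ 2 * fromℕ N * (A + A - fromℕ N + 1ℚ) * e * e + fromℕ 4 * (A - fromℕ N) * e * e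
      ≡⟨ lem A e (fromℕ N) ⟩
    fromℕ 2 * (1ℚ + fromℕ N) * (A + A - (1ℚ + fromℕ N) + 1ℚ) * e * e
      ≡⟨ cong (λ z → fromℕ 2 * z * (A + A - z + 1ℚ) * e * e) (sym (fromℕ-+ 1 N)) ⟩
    fromℕ 2 * fromℕ (suc N) * (A + A - fromℕ (suc N) + 1ℚ) * e * e ∎
    where
    lem : ∀ A e N → fromℕ 2 * N * (A + A - N + 1ℚ) * e * e + fromℕ 4 * (A - N) * e * e ≡
      fromℕ 2 * (1ℚ + N) * (A + A - (1ℚ + N) + 1ℚ) * e * e
    lem = RingSolver.solve-∀ ring

  -- ∑ 1 / (j M + i) over 1 ≤ i ≤ M, against the midpoint value 2 / (2 j + 1) of log (1 + 1 / j).
  block-lower : ∀ j k → fromℕ 2 * recip (2 ℕ.* suc j) ≤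
    sum (λ i → recip (suc j ℕ.* suc k ℕ.+ i)) (suc k) + recip k
  block-lower j k = begin
    fromℕ 2 * u                   ≤⟨ compare ⟩
    fromℕ 2 * M * e + w           ≡⟨ cong (_+ w) (sym midpoint) ⟩
    sum (λ i → fromℕ 4 * (A - fromℕ i) * e * e) (suc k) + w
                                  ≤⟨ ℚ.+-monoˡ-≤ w (sum-≤ term (suc k)) ⟩
    sum (λ i → recip (suc j ℕ.* suc k ℕ.+ i)) (suc k) + w ∎
    where
    d q : ℕ
    q = suc (2 ℕ.* suc j)
    d = q ℕ.* suc k
    u w M e D A J : ℚ
    u = recip (2 ℕ.* suc j)
    w = recip k
    M = fromℕ (suc k)
    e = recip d
    D = fromℕ (suc d)
    J = fromℕ (suc j)
    A = D - J * M - 1ℚ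
    D≡ : D ≡ (1ℚ + fromℕ 2 * J) * M + 1ℚ
    D≡ = trans (trans (fromℕ-+ 1 d) (ℚ.+-comm 1ℚ (fromℕ d))) (cong (_+ 1ℚ) (trans (fromℕ-* q (suc k))
      (cong (_* M) (trans (fromℕ-+ 1 (2 ℕ.* suc j)) (cong (λ z → 1ℚ + z) (fromℕ-* 2 (suc j)))))))
    term : ∀ i → fromℕ 4 * (A - fromℕ i) * e * e ≤ recip (suc j ℕ.* suc k ℕ.+ i)
    term i = subst (λ z → fromℕ 4 * z * e * e ≤ recip p) (trans (cong (λ z → D - z) t≡) (lem D (J * M) (fromℕ i)))
      (tangent {recip p} {fromℕ (suc p)} {e} {D} (0≤recip p) (recip-fromℕ p) (recip-fromℕ d))
      where
      p : ℕ
      p = suc j ℕ.* suc k ℕ.+ i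
      t≡ : fromℕ (suc p) ≡ 1ℚ + (J * M + fromℕ i)
      t≡ = trans (fromℕ-+ 1 p) (cong (λ z → 1ℚ + z) (trans (fromℕ-+ (suc j ℕ.* suc k) i) (cong (_+ fromℕ i) (fromℕ-* (suc j) (suc k)))))
      lem : ∀ D JM i → D - (1ℚ + (JM + i)) ≡ D - JM - 1ℚ - i
      lem = RingSolver.solve-∀ ring
    -- D is the sum of the first and last points JM + 1 and JM + M of the block. So the tangent
    -- touches at their mean D/2, and the deviations cancel.
    midpoint : sum (λ i → fromℕ 4 * (A - fromℕ i) * e * e) (suc k) ≡ fromℕ 2 * M * e
    midpoint = begin-equality
      sum (λ i → fromℕ 4 * (A - fromℕ i) * e * e) (suc k)   ≡⟨ sum-affine A e (suc k) ⟩
      fromℕ 2 * M * (A + A - M + 1ℚ) * e * e                ≡⟨ cong (λ z → fromℕ 2 * M * z * e * e) A≡ ⟩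
      fromℕ 2 * M * D * e * e                               ≡⟨ lem M D e ⟩
      fromℕ 2 * M * e * (e * D)                             ≡⟨ cong (fromℕ 2 * M * e *_) (recip-fromℕ d) ⟩
      fromℕ 2 * M * e * 1ℚ                                  ≡⟨ ℚ.*-identityʳ _ ⟩
      fromℕ 2 * M * e                                       ∎
      where
      lem : ∀ M D e → fromℕ 2 * M * D * e * e ≡ fromℕ 2 * M * e * (e * D)
      lem = RingSolver.solve-∀ ring
      lem′ : ∀ J M → let D = (1ℚ + fromℕ 2 * J) * M + 1ℚ ; A = D - J * M - 1ℚ in A + A - M + 1ℚ ≡ D
      lem′ = RingSolver.solve-∀ ring
      A≡ : A + A - M + 1ℚ ≡ D
      A≡ = subst (λ D → let A = D - J * M - 1ℚ in A + A - M + 1ℚ ≡ D) (sym D≡) (lem′ J M)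
    compare : fromℕ 2 * u ≤ fromℕ 2 * M * e + w
    compare = begin
      fromℕ 2 * u                                       ≡⟨ expand (fromℕ 2) M u e D (fromℕ q) D≡qM (recip-fromℕ d) (recip-fromℕ (2 ℕ.* suc j)) ⟩
      fromℕ 2 * M * e + fromℕ 2 * u * e                 ≤⟨ ℚ.+-monoʳ-≤ (fromℕ 2 * M * e) (*-monoʳ (0≤recip d)
                                                             (*-monoˡ (0≤fromℕ 2) (recip-anti {1} {2 ℕ.* suc j} (s≤s z≤n)))) ⟩
      fromℕ 2 * M * e + fromℕ 2 * recip 1 * e           ≡⟨ cong (fromℕ 2 * M * e +_) (ℚ.*-identityˡ e) ⟩
      fromℕ 2 * M * e + e                               ≤⟨ ℚ.+-monoʳ-≤ (fromℕ 2 * M * e) (recip-anti (ℕ.≤-trans (ℕ.n≤1+n k) (ℕ.m≤n*m (suc k) q))) ⟩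
      fromℕ 2 * M * e + w                               ∎
      where
      D≡qM : D ≡ 1ℚ + fromℕ q * M
      D≡qM = trans (fromℕ-+ 1 d) (cong (λ z → 1ℚ + z) (fromℕ-* q (suc k)))
      expand : ∀ c M u e D q → D ≡ 1ℚ + q * M → e * D ≡ 1ℚ → u * q ≡ 1ℚ → c * u ≡ c * M * e + c * u * e
      expand c M u e D q D≡ eD uq = begin-equality
        c * u                             ≡⟨ sym (ℚ.*-identityʳ (c * u)) ⟩
        c * u * 1ℚ                        ≡⟨ cong (c * u *_) (sym (trans (cong (e *_) (sym D≡)) eD)) ⟩
        c * u * (e * (1ℚ + q * M))        ≡⟨ lem c u e q M ⟩
        c * M * e * (u * q) + c * u * e   ≡⟨ cong (_+ c * u * e) (trans (cong (c * M * e *_) uq) (ℚ.*-identityʳ (c * M * e))) ⟩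
        c * M * e + c * u * e             ∎
        where
        lem : ∀ c u e q M → c * u * (e * (1ℚ + q * M)) ≡ c * M * e * (u * q) + c * u * e
        lem = RingSolver.solve-∀ ring

  -- 24 / 35 = 2 / 5 + 2 / 7 is the midpoint estimate of log 4 - log 2.
  logLower : ℕ → ℚ
  logLower zero    = fromℕ 24 * recip 34
  logLower (suc i) = logLower i + fromℕ 2 * recip (2 ℕ.* (2 ℕ.+ i))

  logSeq-suc : ∀ j k → logSeq (suc (suc j)) k ≡ logSeq (suc j) k + sum (λ i → recip (suc j ℕ.* suc k ℕ.+ i)) (suc k)
  logSeq-suc j k = trans (cong (sum (λ i → recip (suc k ℕ.+ i))) (ℕ.+-comm (suc k) (j ℕ.* suc k)))
    (trans (sum-+ (λ i → recip (suc k ℕ.+ i)) (j ℕ.* suc k) (suc k))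
      (cong (logSeq (suc j) k +_) (sum-cong (λ i → cong recip (sym (ℕ.+-assoc (suc k) (j ℕ.* suc k) i))) (suc k))))

  -- The sum over [2, 4] with mesh 1/M is the sum for log 2 with mesh 1/(2M). The single midpoint
  -- value 2/3 on [1, 2] would be too small for the start of `H-upper`.
  log2-lower : ∀ k → fromℕ 24 * recip 34 ≤ logSeq 2 k + fromℕ 3 * recip k
  log2-lower k = begin
    fromℕ 2 * recip 4 + fromℕ 2 * recip 6 ≤⟨ ℚ.+-mono-≤ (block-lower 1 k) (block-lower 2 k) ⟩
    (block 1 + w) + (block 2 + w)         ≡⟨ lem₁ (block 1) (block 2) w ⟩
    (block 1 + block 2) + (w + w)         ≡⟨ cong (_+ (w + w)) blocks≡ ⟩
    riemann 1 (refine k 1) + (w + w)      ≤⟨ ℚ.+-monoˡ-≤ (w + w) (riemann-upper 1 k 1) ⟩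
    logSeq 2 k + w + (w + w)              ≡⟨ lem₂ (logSeq 2 k) w ⟩
    logSeq 2 k + fromℕ 3 * w              ∎
    where
    w : ℚ
    w = recip k
    block : ℕ → ℚ
    block j = sum (λ i → recip (suc j ℕ.* suc k ℕ.+ i)) (suc k)
    lem₁ : ∀ a b w → (a + w) + (b + w) ≡ (a + b) + (w + w)
    lem₁ = RingSolver.solve-∀ ring
    lem₂ : ∀ a w → a + w + (w + w) ≡ a + fromℕ 3 * w
    lem₂ = RingSolver.solve-∀ ring
    F : ℕ → ℚ
    F i = recip (suc (refine k 1) ℕ.+ i)
    blocks≡ : block 1 + block 2 ≡ riemann 1 (refine k 1)
    blocks≡ = begin-equality
      block 1 + block 2
        ≡⟨ cong₂ _+_ (sum-cong (λ i → cong recip (lem₃ k i)) (suc k)) (sum-cong (λ i → cong recip (lem₄ k i)) (suc k)) ⟩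
      sum F (suc k) + sum (λ i → F (suc k ℕ.+ i)) (suc k)
        ≡⟨ sym (sum-+ F (suc k) (suc k)) ⟩
      sum F (suc k ℕ.+ suc k)
        ≡⟨ cong (sum F) (lem₅ k) ⟩
      riemann 1 (refine k 1) ∎
      where
      lem₃ : ∀ k i → 2 ℕ.* (1 ℕ.+ k) ℕ.+ i ≡ (1 ℕ.+ (1 ℕ.+ k ℕ.* 2)) ℕ.+ i
      lem₃ = ℕSolver.solve-∀
      lem₄ : ∀ k i → 3 ℕ.* (1 ℕ.+ k) ℕ.+ i ≡ (1 ℕ.+ (1 ℕ.+ k ℕ.* 2)) ℕ.+ ((1 ℕ.+ k) ℕ.+ i)
      lem₄ = ℕSolver.solve-∀
      lem₅ : ∀ k → (1 ℕ.+ k) ℕ.+ (1 ℕ.+ k) ≡ 1 ℕ.* (1 ℕ.+ (1 ℕ.+ k ℕ.* 2))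
      lem₅ = ℕSolver.solve-∀

  logLower-≤ : ∀ i k → logLower i ≤ logSeq (2 ℕ.+ i) k + fromℕ (3 ℕ.+ i) * recip k
  logLower-≤ zero k = log2-lower k
  logLower-≤ (suc i) k = begin
    logLower i + fromℕ 2 * recip (2 ℕ.* (2 ℕ.+ i))      ≤⟨ ℚ.+-mono-≤ (logLower-≤ i k) (block-lower (suc i) k) ⟩
    (logSeq (2 ℕ.+ i) k + c * w) + (b + w)              ≡⟨ lem (logSeq (2 ℕ.+ i) k) b c w ⟩
    (logSeq (2 ℕ.+ i) k + b) + (1ℚ + c) * w             ≡⟨ cong₂ (λ u v → u + v * w) (sym (logSeq-suc (suc i) k)) (sym (fromℕ-+ 1 (3 ℕ.+ i))) ⟩
    logSeq (3 ℕ.+ i) k + fromℕ (4 ℕ.+ i) * w            ∎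
    where
    w b c : ℚ
    w = recip k
    b = sum (λ i′ → recip (suc (suc i) ℕ.* suc k ℕ.+ i′)) (suc k)
    c = fromℕ (3 ℕ.+ i)
    lem : ∀ l b c w → (l + c * w) + (b + w) ≡ (l + b) + (1ℚ + c) * w
    lem = RingSolver.solve-∀ ring

  -- Convexity of 1/t at t = 2m + 2: the left side is 2/t, the right side 1/(t - 1) + 1/(t + 1).
  -- This is the induction step of `H-upper`.
  recip-convex : ∀ m → recip m ≤ recip (2 ℕ.* m) + recip (2 ℕ.* suc m)
  recip-convex m = go (recip m) a b (fromℕ (suc m)) A B (0≤* (0≤recip m) (0≤* (0≤recip (2 ℕ.* m)) (0≤recip (2 ℕ.* suc m))))
      A≡ B≡ (recip-fromℕ m) (recip-fromℕ (2 ℕ.* m)) (recip-fromℕ (2 ℕ.* suc m))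
    where
    a b A B : ℚ
    a = recip (2 ℕ.* m)
    b = recip (2 ℕ.* suc m)
    A = fromℕ (suc (2 ℕ.* m))
    B = fromℕ (suc (2 ℕ.* suc m))
    A≡ : A ≡ fromℕ 2 * fromℕ (suc m) - 1ℚ
    A≡ = trans (lem A) (cong (_- 1ℚ) (trans (sym (fromℕ-+ 1 (suc (2 ℕ.* m)))) (trans (cong fromℕ (lemℕ m)) (fromℕ-* 2 (suc m)))))
      where
      lem : ∀ A → A ≡ 1ℚ + A - 1ℚ
      lem = RingSolver.solve-∀ ring
      lemℕ : ∀ m → 1 ℕ.+ (1 ℕ.+ 2 ℕ.* m) ≡ 2 ℕ.* (1 ℕ.+ m)
      lemℕ = ℕSolver.solve-∀
    B≡ : B ≡ fromℕ 2 * fromℕ (suc m) + 1ℚ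
    B≡ = trans (fromℕ-+ 1 (2 ℕ.* suc m)) (trans (ℚ.+-comm 1ℚ (fromℕ (2 ℕ.* suc m))) (cong (_+ 1ℚ) (fromℕ-* 2 (suc m))))
    go : ∀ c a b C A B → 0ℚ ≤ c * (a * b) → A ≡ fromℕ 2 * C - 1ℚ → B ≡ fromℕ 2 * C + 1ℚ →
      c * C ≡ 1ℚ → a * A ≡ 1ℚ → b * B ≡ 1ℚ → c ≤ a + b
    go c a b C A B h A≡ B≡ cC aA bB = begin
      c                                                       ≡⟨ sym (one aA bB c) ⟩
      c * (a * A * (b * B))                                   ≤⟨ p≤p+q h ⟩
      c * (a * A * (b * B)) + c * (a * b)                     ≡⟨ cong₂ (λ A B → c * (a * A * (b * B)) + c * (a * b)) A≡ B≡ ⟩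
      c * (a * (fromℕ 2 * C - 1ℚ) * (b * (fromℕ 2 * C + 1ℚ))) + c * (a * b) ≡⟨ lem₁ c a b C ⟩
      fromℕ 4 * C * a * b * (c * C)                           ≡⟨ cong (fromℕ 4 * C * a * b *_) cC ⟩
      fromℕ 4 * C * a * b * 1ℚ                                ≡⟨ lem₂ C a b ⟩
      a * (b * (fromℕ 2 * C + 1ℚ)) + b * (a * (fromℕ 2 * C - 1ℚ)) ≡⟨ cong₂ (λ A B → a * (b * B) + b * (a * A)) (sym A≡) (sym B≡) ⟩
      a * (b * B) + b * (a * A)                               ≡⟨ cong₂ (λ u v → a * u + b * v) bB aA ⟩
      a * 1ℚ + b * 1ℚ                                         ≡⟨ cong₂ _+_ (ℚ.*-identityʳ a) (ℚ.*-identityʳ b) ⟩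
      a + b                                                   ∎
      where
      one : ∀ {u v} → u ≡ 1ℚ → v ≡ 1ℚ → ∀ c → c * (u * v) ≡ c
      one refl refl c = ℚ.*-identityʳ c
      lem₁ : ∀ c a b C → c * (a * (fromℕ 2 * C - 1ℚ) * (b * (fromℕ 2 * C + 1ℚ))) + c * (a * b) ≡ fromℕ 4 * C * a * b * (c * C)
      lem₁ = RingSolver.solve-∀ ring
      lem₂ : ∀ C a b → fromℕ 4 * C * a * b * 1ℚ ≡ a * (b * (fromℕ 2 * C + 1ℚ)) + b * (a * (fromℕ 2 * C - 1ℚ))
      lem₂ = RingSolver.solve-∀ ring

  -- Harmonic numbers against the logarithm.

  H : ℕ → ℚ
  H = sum recip

  -- 0.6, slightly above Euler's constant (recip n is 1 / (n + 1)).
  γ′ : ℚ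
  γ′ = fromℕ 3 * recip 4

  -- H m - log m - 1 / (2 m + 1) decreases, and falls below 0.6 at m = 5.
  H-upper : ∀ i → H (5 ℕ.+ i) ≤ γ′ + logLower (3 ℕ.+ i) + recip (2 ℕ.* (5 ℕ.+ i))
  H-upper zero = toWitness {a? = H 5 ℚ.≤? γ′ + logLower 3 + recip 10} _
  H-upper (suc i) = begin
    H m + recip m                                       ≤⟨ ℚ.+-mono-≤ (H-upper i) (recip-convex m) ⟩
    γ′ + logLower (3 ℕ.+ i) + a + (a + b)               ≡⟨ lem γ′ (logLower (3 ℕ.+ i)) a b ⟩
    γ′ + (logLower (3 ℕ.+ i) + fromℕ 2 * a) + b         ∎
    where
    m : ℕ
    m = 5 ℕ.+ i
    a b : ℚ
    a = recip (2 ℕ.* m)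
    b = recip (2 ℕ.* suc m)
    lem : ∀ g l a b → g + l + a + (a + b) ≡ g + (l + fromℕ 2 * a) + b
    lem = RingSolver.solve-∀ ring

  logLower′ : ℕ → ℚ
  logLower′ zero    = 0ℚ
  logLower′ (suc i) = logLower i

  -- `nine` is 9/10, the eventual lower bound for the approximants of α ≥ 1; it weakens κ ≤ √n to
  -- 0.9 κ ≤ m + 1. `tenth` is also the room left for the error of the Riemann sums.
  nine tenth : ℚ
  tenth = recip 9
  nine = fromℕ 9 * tenth

  -- With m = i + 1: for m ≥ 5, `H-upper` and (m + 1)/(2m + 1) ≤ 0.8 bound the left side by 0.9 =
  -- 0.9 H(1). Smaller m are evaluated; m = 1 gives equality, 2 (1 - 0.6) + 0.1 = 0.9.
  H-slack : ∀ i → fromℕ (2 ℕ.+ i) * (H (suc i) - γ′ - logLower′ i) + tenth ≤ nine * H (suc i)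
  H-slack 0 = toWitness {a? = fromℕ 2 * (H 1 - γ′ - logLower′ 0) + tenth ℚ.≤? nine * H 1} _
  H-slack 1 = toWitness {a? = fromℕ 3 * (H 2 - γ′ - logLower′ 1) + tenth ℚ.≤? nine * H 2} _
  H-slack 2 = toWitness {a? = fromℕ 4 * (H 3 - γ′ - logLower′ 2) + tenth ℚ.≤? nine * H 3} _
  H-slack 3 = toWitness {a? = fromℕ 5 * (H 4 - γ′ - logLower′ 3) + tenth ℚ.≤? nine * H 4} _
  H-slack (suc (suc (suc (suc i)))) = begin
    fromℕ (suc m) * (H m - γ′ - logLower (3 ℕ.+ i)) + tenth
      ≤⟨ ℚ.+-monoˡ-≤ tenth (*-monoˡ (0≤fromℕ (suc m)) (excess (H m) γ′ (logLower (3 ℕ.+ i)) a (H-upper i))) ⟩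
    fromℕ (suc m) * a + tenth
      ≤⟨ ℚ.+-monoˡ-≤ tenth (ratio (fromℕ (suc m)) a tenth (0≤recip (2 ℕ.* m))
           (subst₂ _≤_ (fromℕ-* 10 (suc m)) (fromℕ-* 8 (suc (2 ℕ.* m))) (fromℕ-mono {10 ℕ.* suc m} {8 ℕ.* suc (2 ℕ.* m)} (10[m+1]≤8[2m+1] i)))
           (recip-fromℕ (2 ℕ.* m))) ⟩
    fromℕ 8 * tenth + tenth
      ≡⟨⟩
    nine * H 1
      ≤⟨ *-monoˡ (0≤* (0≤fromℕ 9) (0≤recip 9)) (sum-mono 0≤recip {1} {m} (s≤s z≤n)) ⟩
    nine * H m ∎
    where
    m : ℕ
    m = 5 ℕ.+ i
    a : ℚ
    a = recip (2 ℕ.* m)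
    excess : ∀ h g l a → h ≤ g + l + a → h - g - l ≤ a
    excess h g l a h≤ = subst₂ _≤_ (lem₁ h g l) (lem₂ g l a) (ℚ.+-monoˡ-≤ (- g - l) h≤)
      where
      lem₁ : ∀ h g l → h + (- g - l) ≡ h - g - l
      lem₁ = RingSolver.solve-∀ ring
      lem₂ : ∀ g l a → g + l + a + (- g - l) ≡ a
      lem₂ = RingSolver.solve-∀ ring
    ratio : ∀ c a t {q} → 0ℚ ≤ a → fromℕ 10 * c ≤ fromℕ 8 * q → a * q ≡ 1ℚ → c * a ≤ fromℕ 8 * tenth
    ratio c a t {q} 0≤a h aq = begin
      c * a                           ≡⟨ lem₁ c a ⟩
      fromℕ 10 * c * a * tenth        ≤⟨ *-monoʳ (0≤recip 9) (*-monoʳ 0≤a h) ⟩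
      fromℕ 8 * q * a * tenth         ≡⟨ lem₂ q a tenth ⟩
      fromℕ 8 * (a * q) * tenth       ≡⟨ cong (λ z → fromℕ 8 * z * tenth) aq ⟩
      fromℕ 8 * tenth                 ∎
      where
      lem₁ : ∀ c a → c * a ≡ fromℕ 10 * c * a * recip 9
      lem₁ = RingSolver.solve-∀ ring
      lem₂ : ∀ q a t → fromℕ 8 * q * a * t ≡ fromℕ 8 * (a * q) * t
      lem₂ = RingSolver.solve-∀ ring
    10[m+1]≤8[2m+1] : ∀ i → 10 ℕ.* (6 ℕ.+ i) ℕ.≤ 8 ℕ.* (1 ℕ.+ 2 ℕ.* (5 ℕ.+ i))
    10[m+1]≤8[2m+1] i = ℕ.≤-trans (ℕ.m≤m+n _ (28 ℕ.+ 6 ℕ.* i)) (ℕ.≤-reflexive (lem i))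
      where
      lem : ∀ i → 10 ℕ.* (6 ℕ.+ i) ℕ.+ (28 ℕ.+ 6 ℕ.* i) ≡ 8 ℕ.* (1 ℕ.+ 2 ℕ.* (5 ℕ.+ i))
      lem = ℕSolver.solve-∀

  logLower′-≤ : ∀ i k → logLower′ i ≤ logSeq (suc i) k + fromℕ (2 ℕ.+ i) * recip k
  logLower′-≤ zero k = 0≤+ (logSeq-nonNeg 1 k) (0≤* (0≤fromℕ 2) (0≤recip k))
  logLower′-≤ (suc i) k = logLower-≤ i k

  -- The excess of H over ½ ℓ + 0.6 may be positive for small m; this keeps κ times the excess below
  -- H whenever 0.9 κ ≤ m + 1.
  HarmonicBound : ℕ → ℚ → Set
  HarmonicBound m ℓ = fromℕ (suc m) * (H m - γ′ - ½ * ℓ) ≤ nine * H m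

  -- `H-slack` for Riemann sums: ½ log n ≥ log m holds at every k, and `logLower′` exceeds the sum
  -- for log m by at most (m + 1)/(k + 1). Multiplied by m + 1, this error is at most 0.1 for large
  -- k.
  harmonic-bound : ∀ {m n} → 0 ℕ.< m → m ℕ.* m ℕ.≤ n →
    ∃ λ N → ∀ k → N ℕ.≤ k → HarmonicBound m (logSeq n k)
  harmonic-bound {m@(suc i)} {n} 0<m m²≤n =
    let c = fromℕ (suc m)
        N , small = archimedean-recip (c * c) {tenth} (recip-pos 9)
    in N , λ k N≤k → go c (H m) γ′ (logLower′ i) (logSeq m k) (logSeq n k) (recip k) tenth (nine * H m)
      (0≤fromℕ (suc m)) (logLower′-≤ i k) (logSeq-square k 0<m m²≤n) (small k N≤k) (H-slack i)
    where
    go : ∀ c h g l x ℓ w t b → 0ℚ ≤ c → l ≤ x + c * w → x + x ≤ ℓ → c * c * w ≤ t →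
      c * (h - g - l) + t ≤ b → c * (h - g - ½ * ℓ) ≤ b
    go c h g l x ℓ w t b 0≤c l≤ 2x≤ℓ ccw≤ slack = begin
      c * (h - g - ½ * ℓ)               ≤⟨ *-monoˡ {c} {h - g - ½ * ℓ} {h - g - x} 0≤c (ℚ.+-monoʳ-≤ (h - g) (ℚ.neg-antimono-≤ {x} {½ * ℓ} x≤½ℓ)) ⟩
      c * (h - g - x)                   ≤⟨ *-monoˡ {c} {h - g - x} {h - g + (- l + c * w)} 0≤c (ℚ.+-monoʳ-≤ (h - g) -x≤) ⟩
      c * (h - g + (- l + c * w))       ≡⟨ lem₁ c h g l w ⟩
      c * (h - g - l) + c * c * w       ≤⟨ ℚ.+-monoʳ-≤ (c * (h - g - l)) ccw≤ ⟩
      c * (h - g - l) + t               ≤⟨ slack ⟩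
      b                                 ∎
      where
      half : ∀ x → x ≡ ½ * (x + x)
      half = RingSolver.solve-∀ ring
      x≤½ℓ : x ≤ ½ * ℓ
      x≤½ℓ = ℚ.≤-trans (ℚ.≤-reflexive (half x)) (*-monoˡ {½} {x + x} {ℓ} (ℚ.<⇒≤ 0<½) 2x≤ℓ)
      lem₀ : ∀ x y → - x ≡ - (x + y) + y
      lem₀ = RingSolver.solve-∀ ring
      -x≤ : - x ≤ - l + c * w
      -x≤ = ℚ.≤-trans (ℚ.≤-reflexive (lem₀ x (c * w))) (ℚ.+-monoˡ-≤ (c * w) (ℚ.neg-antimono-≤ {l} {x + c * w} l≤))
      lem₁ : ∀ c h g l w → c * (h - g + (- l + c * w)) ≡ c * (h - g - l) + c * c * w
      lem₁ = RingSolver.solve-∀ ring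

  -- K + 1 is q rounded down, but at least 1.
  bracket : ∀ q → ∃ λ K → q ≤ fromℕ (2 ℕ.+ K) × (K ≡ 0 ⊎ fromℕ (suc K) ≤ q)
  bracket q = let N , q≤N = archimedean q in go N (ℚ.≤-trans q≤N (fromℕ-mono (ℕ.m≤n+m N 2)))
    where
    go : ∀ N → q ≤ fromℕ (2 ℕ.+ N) → ∃ λ K → q ≤ fromℕ (2 ℕ.+ K) × (K ≡ 0 ⊎ fromℕ (suc K) ≤ q)
    go zero h = 0 , h , inj₁ refl
    go (suc N) h with ℚ.≤-total q (fromℕ (2 ℕ.+ N))
    ... | inj₁ q≤ = go N q≤
    ... | inj₂ ≤q = suc N , h , inj₂ ≤q

  m≤sqrtSeq : ∀ {m n} k → m ℕ.* m ℕ.≤ n → fromℕ m ≤ sqrtSeq n k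
  m≤sqrtSeq {m} {n} k m²≤n = begin
    fromℕ m                           ≡⟨ lem (fromℕ m) (fromℕ (suc k)) (recip k) (recip-fromℕ k) ⟩
    fromℕ m * fromℕ (suc k) * recip k ≡⟨ cong (_* recip k) (sym (fromℕ-* m (suc k))) ⟩
    fromℕ (m ℕ.* suc k) * recip k     ≤⟨ *-monoʳ (0≤recip k) (fromℕ-mono {m ℕ.* suc k} {isqrt N} (ℕ.s≤s⁻¹ (square-cancel-< (ℕ.≤-<-trans mM² (isqrt-upper N))))) ⟩
    fromℕ (isqrt N) * recip k         ≡⟨ sym (/-recip (isqrt N) k) ⟩
    sqrtSeq n k                       ∎
    where
    N : ℕ
    N = n ℕ.* (suc k ℕ.* suc k)
    mM² : (m ℕ.* suc k) ℕ.* (m ℕ.* suc k) ℕ.≤ N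
    mM² = ℕ.≤-trans (ℕ.≤-reflexive (square m (suc k))) (ℕ.*-monoˡ-≤ (suc k ℕ.* suc k) m²≤n)
      where
      square : ∀ m k → (m ℕ.* k) ℕ.* (m ℕ.* k) ≡ m ℕ.* m ℕ.* (k ℕ.* k)
      square = ℕSolver.solve-∀
    lem : ∀ m c r → r * c ≡ 1ℚ → m ≡ m * c * r
    lem m c r rc = trans (sym (ℚ.*-identityʳ m)) (trans (cong (m *_) (trans (sym rc) (ℚ.*-comm r c))) (sym (ℚ.*-assoc m c r)))

  sqrtSeq≤ : ∀ {m n} k → n ℕ.< m ℕ.* m → sqrtSeq n k ≤ fromℕ m
  sqrtSeq≤ {m} {n} k n<m² = begin
    sqrtSeq n k                       ≡⟨ /-recip (isqrt N) k ⟩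
    fromℕ (isqrt N) * recip k         ≤⟨ *-monoʳ (0≤recip k) (fromℕ-mono {isqrt N} {m ℕ.* suc k} (ℕ.<⇒≤ (square-cancel-< (ℕ.≤-<-trans (isqrt-lower N) N<)))) ⟩
    fromℕ (m ℕ.* suc k) * recip k     ≡⟨ cong (_* recip k) (fromℕ-* m (suc k)) ⟩
    fromℕ m * fromℕ (suc k) * recip k ≡⟨ lem (fromℕ m) (fromℕ (suc k)) (recip k) (recip-fromℕ k) ⟩
    fromℕ m                           ∎
    where
    N : ℕ
    N = n ℕ.* (suc k ℕ.* suc k)
    N< : N ℕ.< (m ℕ.* suc k) ℕ.* (m ℕ.* suc k)
    N< = ℕ.<-≤-trans (ℕ.*-monoˡ-< (suc k ℕ.* suc k) n<m²) (ℕ.≤-reflexive (square m (suc k)))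
      where
      square : ∀ m k → m ℕ.* m ℕ.* (k ℕ.* k) ≡ (m ℕ.* k) ℕ.* (m ℕ.* k)
      square = ℕSolver.solve-∀
    lem : ∀ m c r → r * c ≡ 1ℚ → m * c * r ≡ m
    lem m c r rc = trans (ℚ.*-assoc m c r) (trans (cong (m *_) (trans (ℚ.*-comm c r) rc)) (ℚ.*-identityʳ m))

  0≤sqrtSeq : ∀ n k → 0ℚ ≤ sqrtSeq n k
  0≤sqrtSeq n k = m≤sqrtSeq {0} {n} k z≤n

-- The bound for f(n) at a single approximant.

module RationalBound where
  open import Data.Nat as ℕ using (ℕ; zero; suc; z≤n)
  import Data.Nat.DivMod as ℕ
  import Data.Nat.Properties as ℕ
  open import Data.Product using (∃; _×_; _,_)
  open import Data.Rational
  import Data.Rational.Properties as ℚ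
  open import Data.Rational.Properties using (module ≤-Reasoning)
  open import Data.Sum using (_⊎_; inj₁; inj₂)
  open import Relation.Binary.PropositionalEquality
    using (_≡_; refl; sym; trans; cong; subst)
  open import Tactic.RingSolver as RingSolver using ()
  open import Defs using (f; θ; logSeq; isqrt; sqrtSeq)
  open Defs.RationalLemmas
  open Defs.SequenceLemmas using (inverse; inverse-*; inverse-pos)
  open Defs.SqrtLemmas using (isqrt-lower; isqrt-upper)
  open Counting using (blockCount; reach; f-bound)
  open Series
  open ≤-Reasoning

  -- Written term for term like `g` and `h`, factors 1 included, so that the approximants of these
  -- reals reduce to them.
  gApprox hApprox : ℕ → (s ℓ a : ℚ) → ℚ
  gApprox n s ℓ a = 1ℚ * inverse a * s * ℓ
    + fromℕ 2 * (1ℚ + γ′ * inverse a) * s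
    + fromℕ 2 * (fromℕ 2 * fromℕ n - 1ℚ) * a * inverse (fromℕ 2 * s - a)
  hApprox n s ℓ a = 1ℚ * inverse (fromℕ 2 * a) * s * ℓ
    + (1ℚ + γ′ * inverse a) * s
    + (fromℕ 2 * fromℕ n - 1ℚ) * a * inverse (fromℕ 2 * s - a)

  blockCount≤KH+m : ∀ K m → fromℕ (blockCount K m) ≤ fromℕ K * H m + fromℕ m
  blockCount≤KH+m K zero = ℚ.≤-reflexive (sym (trans (cong (_+ 0ℚ) (ℚ.*-zeroʳ (fromℕ K))) refl))
  blockCount≤KH+m K (suc m) = begin
    fromℕ (suc (K ℕ./ suc m) ℕ.+ blockCount K m)          ≡⟨ trans (fromℕ-+ (suc (K ℕ./ suc m)) (blockCount K m))
                                                               (cong (_+ fromℕ (blockCount K m)) (fromℕ-+ 1 (K ℕ./ suc m))) ⟩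
    (1ℚ + fromℕ (K ℕ./ suc m)) + fromℕ (blockCount K m)   ≤⟨ ℚ.+-mono-≤ (ℚ.+-monoʳ-≤ 1ℚ quotient) (blockCount≤KH+m K m) ⟩
    (1ℚ + fromℕ K * recip m) + (fromℕ K * H m + fromℕ m)  ≡⟨ lem (fromℕ K) (recip m) (H m) (fromℕ m) ⟩
    fromℕ K * (H m + recip m) + (1ℚ + fromℕ m)            ≡⟨ cong (λ z → fromℕ K * (H m + recip m) + z) (sym (fromℕ-+ 1 m)) ⟩
    fromℕ K * (H m + recip m) + fromℕ (suc m)             ∎
    where
    lem : ∀ K r h m → (1ℚ + K * r) + (K * h + m) ≡ K * (h + r) + (1ℚ + m)
    lem = RingSolver.solve-∀ ring
    quotient : fromℕ (K ℕ./ suc m) ≤ fromℕ K * recip m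
    quotient = begin
      fromℕ (K ℕ./ suc m)                                 ≡⟨ sym (ℚ.*-identityʳ (fromℕ (K ℕ./ suc m))) ⟩
      fromℕ (K ℕ./ suc m) * 1ℚ                            ≡⟨ cong (fromℕ (K ℕ./ suc m) *_) (sym (trans (ℚ.*-comm (fromℕ (suc m)) (recip m)) (recip-fromℕ m))) ⟩
      fromℕ (K ℕ./ suc m) * (fromℕ (suc m) * recip m)     ≡⟨ sym (ℚ.*-assoc (fromℕ (K ℕ./ suc m)) (fromℕ (suc m)) (recip m)) ⟩
      fromℕ (K ℕ./ suc m) * fromℕ (suc m) * recip m       ≡⟨ cong (_* recip m) (sym (fromℕ-* (K ℕ./ suc m) (suc m))) ⟩
      fromℕ (K ℕ./ suc m ℕ.* suc m) * recip m             ≤⟨ *-monoʳ (0≤recip m) (fromℕ-mono {K ℕ./ suc m ℕ.* suc m} {K} (ℕ.m/n*n≤m K (suc m))) ⟩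
      fromℕ K * recip m                                   ∎

  0≤H : ∀ m → 0ℚ ≤ H m
  0≤H m = Defs.ExpLemmas.sum-mono 0≤recip {0} {m} z≤n

  -- κ (H - E) = κ (½ ℓ + 0.6) where E is small by the harmonic bound.
  blocks-part : ∀ {K m ℓ κ s} → 0ℚ ≤ ℓ → 0ℚ ≤ κ → κ * nine ≤ fromℕ (suc m) → fromℕ m ≤ s → HarmonicBound m ℓ →
    K ≡ 0 ⊎ fromℕ (suc K) ≤ κ → fromℕ K * H m + fromℕ m ≤ κ * (½ * ℓ + γ′) + s
  -- An approximate κ may fall below 1, so K = 0 comes without K + 1 ≤ κ; the harmonic sum then
  -- disappears.
  blocks-part {m = m} {ℓ} {κ} {s} 0≤ℓ 0≤κ _ m≤s _ (inj₁ refl) = ℚ.+-mono-≤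
    (subst (_≤ κ * (½ * ℓ + γ′)) (sym (ℚ.*-zeroˡ (H m)))
      (0≤* 0≤κ (0≤+ (0≤* (ℚ.<⇒≤ 0<½) 0≤ℓ) (0≤* (0≤fromℕ 3) (0≤recip 4))))) m≤s
  blocks-part {K} {m} {ℓ} {κ} {s} 0≤ℓ 0≤κ κ≤ m≤s hb (inj₂ K<κ) = ℚ.+-mono-≤ (begin
    fromℕ K * H m                   ≡⟨ lem₁ (fromℕ K) (H m) ⟩
    (1ℚ + fromℕ K) * H m - H m      ≡⟨ cong (λ z → z * H m - H m) (sym (fromℕ-+ 1 K)) ⟩
    fromℕ (suc K) * H m - H m       ≤⟨ ℚ.+-monoˡ-≤ (- H m) (*-monoʳ (0≤H m) K<κ) ⟩
    κ * H m - H m                   ≡⟨ lem₂ κ (H m) γ′ ℓ ⟩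
    κ * (½ * ℓ + γ′) + (κ * E - H m) ≤⟨ ℚ.+-monoʳ-≤ (κ * (½ * ℓ + γ′)) (ℚ.≤-trans (ℚ.+-monoˡ-≤ (- H m) (κE≤H (ℚ.≤-total 0ℚ E)))
                                          (ℚ.≤-reflexive (ℚ.+-inverseʳ (H m)))) ⟩
    κ * (½ * ℓ + γ′) + 0ℚ           ≡⟨ ℚ.+-identityʳ _ ⟩
    κ * (½ * ℓ + γ′)                ∎) m≤s
    where
    E : ℚ
    E = H m - γ′ - ½ * ℓ
    lem₁ : ∀ K h → K * h ≡ (1ℚ + K) * h - h
    lem₁ = RingSolver.solve-∀ ring
    lem₂ : ∀ κ h g l → κ * h - h ≡ κ * (½ * l + g) + (κ * (h - g - ½ * l) - h)
    lem₂ = RingSolver.solve-∀ ring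
    κE≤H : 0ℚ ≤ E ⊎ E ≤ 0ℚ → κ * E ≤ H m
    κE≤H (inj₂ E≤0) = ℚ.≤-trans (*-monoˡ 0≤κ E≤0) (ℚ.≤-trans (ℚ.≤-reflexive (ℚ.*-zeroʳ κ)) (0≤H m))
    κE≤H (inj₁ 0≤E) = ℚ.*-cancelˡ-≤-pos nine (begin
      nine * (κ * E)      ≡⟨ lem₃ nine κ E ⟩
      κ * nine * E        ≤⟨ *-monoʳ 0≤E κ≤ ⟩
      fromℕ (suc m) * E   ≤⟨ hb ⟩
      nine * H m          ∎)
      where
      lem₃ : ∀ t κ E → t * (κ * E) ≡ κ * t * E
      lem₃ = RingSolver.solve-∀ ring

  -- From κ ≤ K + 2 the divisor 3 + 2K is at least 2κ - 1 = (2s - a)/a.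
  reach-part : ∀ {n m K s a κ} (n<[1+m]² : n ℕ.< suc m ℕ.* suc m) → 0 ℕ.< n → 0ℚ ≤ a → κ * a ≡ s → κ ≤ fromℕ (2 ℕ.+ K) →
    0ℚ < fromℕ 2 * s - a → fromℕ (reach n m K n<[1+m]²) ≤ (fromℕ 2 * fromℕ n - 1ℚ) * a * inverse (fromℕ 2 * s - a)
  reach-part {n} {m} {K} {s} {a} {κ} n<[1+m]² 0<n 0≤a κa≡s κ≤ 0<b = begin
    z                               ≡⟨ sym (trans (ℚ.*-assoc z b (inverse b)) (trans (cong (z *_) (trans (ℚ.*-comm b (inverse b)) (inverse-* 0<b))) (ℚ.*-identityʳ z))) ⟩
    z * b * inverse b               ≤⟨ *-monoʳ (ℚ.<⇒≤ (inverse-pos 0<b)) (begin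
      z * b                                         ≡⟨ cong (λ s → z * (fromℕ 2 * s - a)) (sym κa≡s) ⟩
      z * (fromℕ 2 * (κ * a) - a)                   ≡⟨ cong (z *_) (lem₁ κ a) ⟩
      z * ((fromℕ 2 * κ - 1ℚ) * a)                  ≤⟨ *-monoˡ (0≤fromℕ Z) (*-monoʳ 0≤a (ℚ.+-monoˡ-≤ (- 1ℚ) (*-monoˡ (0≤fromℕ 2) κ≤))) ⟩
      z * ((fromℕ 2 * fromℕ (2 ℕ.+ K) - 1ℚ) * a)    ≡⟨ trans (cong (λ u → z * ((fromℕ 2 * u - 1ℚ) * a)) (fromℕ-+ 2 K)) (lem₂ z (fromℕ K) a) ⟩
      z * (fromℕ 3 + fromℕ 2 * fromℕ K) * a         ≡⟨ cong (λ u → z * u * a) (sym (trans (fromℕ-+ 3 (2 ℕ.* K)) (cong (λ u → fromℕ 3 + u) (fromℕ-* 2 K)))) ⟩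
      z * fromℕ (3 ℕ.+ 2 ℕ.* K) * a                 ≡⟨ cong (_* a) (sym (fromℕ-* Z (3 ℕ.+ 2 ℕ.* K))) ⟩
      fromℕ (Z ℕ.* (3 ℕ.+ 2 ℕ.* K)) * a             ≤⟨ *-monoʳ 0≤a (fromℕ-mono {Z ℕ.* (3 ℕ.+ 2 ℕ.* K)} {2 ℕ.* n ℕ.∸ 1} (ℕ.m/n*n≤m (2 ℕ.* n ℕ.∸ 1) (3 ℕ.+ 2 ℕ.* K))) ⟩
      fromℕ (2 ℕ.* n ℕ.∸ 1) * a                     ≡⟨ cong (_* a) pred≡ ⟩
      (fromℕ 2 * fromℕ n - 1ℚ) * a                  ∎) ⟩
    (fromℕ 2 * fromℕ n - 1ℚ) * a * inverse b ∎
    where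
    Z : ℕ
    Z = reach n m K n<[1+m]²
    z b : ℚ
    z = fromℕ Z
    b = fromℕ 2 * s - a
    lem₁ : ∀ κ a → fromℕ 2 * (κ * a) - a ≡ (fromℕ 2 * κ - 1ℚ) * a
    lem₁ = RingSolver.solve-∀ ring
    lem₂ : ∀ z K a → z * ((fromℕ 2 * (fromℕ 2 + K) - 1ℚ) * a) ≡ z * (fromℕ 3 + fromℕ 2 * K) * a
    lem₂ = RingSolver.solve-∀ ring
    pred≡ : fromℕ (2 ℕ.* n ℕ.∸ 1) ≡ fromℕ 2 * fromℕ n - 1ℚ
    pred≡ = trans (lem₃ (fromℕ (2 ℕ.* n ℕ.∸ 1))) (cong (_- 1ℚ) (trans (sym (fromℕ-+ (2 ℕ.* n ℕ.∸ 1) 1))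
      (trans (cong fromℕ (ℕ.m∸n+n≡m (ℕ.≤-trans 0<n (ℕ.m≤n*m n 2)))) (fromℕ-* 2 n))))
      where
      lem₃ : ∀ x → x ≡ x + 1ℚ - 1ℚ
      lem₃ = RingSolver.solve-∀ ring

  f≤½θgApprox : ∀ n k a → 0 ℕ.< n → nine ≤ a → 0ℚ < fromℕ 2 * sqrtSeq n k - a → HarmonicBound (isqrt n) (logSeq n k) →
    fromℕ (f n) ≤ ½ * fromℕ (θ n) * gApprox n (sqrtSeq n k) (logSeq n k) a
  f≤½θgApprox n k a 0<n 9/10≤a 0<b hb = go (bracket κ)
    where
    m : ℕ
    m = isqrt n
    s ℓ v κ u z : ℚ
    s = sqrtSeq n k
    ℓ = logSeq n k
    v = inverse a
    κ = s * v
    u = fromℕ 2 * fromℕ n - 1ℚ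
    z = inverse (fromℕ 2 * s - a)
    0<nine : 0ℚ < nine
    0<nine = ℚ.positive⁻¹ nine
    0<a : 0ℚ < a
    0<a = ℚ.<-≤-trans 0<nine 9/10≤a
    0≤v : 0ℚ ≤ v
    0≤v = ℚ.<⇒≤ (inverse-pos 0<a)
    0≤s : 0ℚ ≤ s
    0≤s = 0≤sqrtSeq n k
    κa≡s : κ * a ≡ s
    κa≡s = trans (ℚ.*-assoc s v a) (trans (cong (s *_) (inverse-* 0<a)) (ℚ.*-identityʳ s))
    κ≤ : κ * nine ≤ fromℕ (suc m)
    κ≤ = ℚ.≤-trans (*-monoˡ {κ} {nine} {a} (0≤* {s} {v} 0≤s 0≤v) 9/10≤a) (ℚ.≤-trans (ℚ.≤-reflexive κa≡s) (sqrtSeq≤ {suc m} k (isqrt-upper n)))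
    go : ∃ (λ K → κ ≤ fromℕ (2 ℕ.+ K) × (K ≡ 0 ⊎ fromℕ (suc K) ≤ κ)) →
      fromℕ (f n) ≤ ½ * fromℕ (θ n) * gApprox n s ℓ a
    go (K , κ≤K+2 , K≡0⊎K<κ) = begin
      fromℕ (f n)                                           ≤⟨ fromℕ-mono {f n} {θ n ℕ.* (B ℕ.+ Z)} (f-bound n m K (isqrt-upper n)) ⟩
      fromℕ (θ n ℕ.* (B ℕ.+ Z))                             ≡⟨ trans (fromℕ-* (θ n) (B ℕ.+ Z)) (cong (fromℕ (θ n) *_) (fromℕ-+ B Z)) ⟩
      fromℕ (θ n) * (fromℕ B + fromℕ Z)                     ≤⟨ *-monoˡ {fromℕ (θ n)} {fromℕ B + fromℕ Z} {(κ * (½ * ℓ + γ′) + s) + u * a * z} (0≤fromℕ (θ n)) (ℚ.+-mono-≤ {fromℕ B} {κ * (½ * ℓ + γ′) + s} {fromℕ Z} {u * a * z}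
        (ℚ.≤-trans (blockCount≤KH+m K m) (blocks-part {K} {m} {ℓ} {κ} {s} (logSeq-nonNeg n k) (0≤* {s} {v} 0≤s 0≤v) κ≤
          (m≤sqrtSeq {m} {n} k (isqrt-lower n)) hb K≡0⊎K<κ))
        (reach-part {n} {m} {K} {s} {a} {κ} (isqrt-upper n) 0<n (ℚ.<⇒≤ 0<a) κa≡s κ≤K+2 0<b)) ⟩
      fromℕ (θ n) * ((κ * (½ * ℓ + γ′) + s) + u * a * z)    ≡⟨ lem (fromℕ (θ n)) s v ℓ γ′ u a z ⟩
      ½ * fromℕ (θ n) * gApprox n s ℓ a                     ∎
      where
      B Z : ℕ
      B = blockCount K m
      Z = reach n m K (isqrt-upper n)
      lem : ∀ t s v ℓ g u a z → t * ((s * v * (½ * ℓ + g) + s) + u * a * z) ≡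
        ½ * t * (1ℚ * v * s * ℓ + fromℕ 2 * (1ℚ + g * v) * s + fromℕ 2 * u * a * z)
      lem = RingSolver.solve-∀ ring

-- θ(n) against n^ε, and g against h.

module ExponentialBound where
  open import Data.Nat as ℕ using (ℕ; suc)
  import Data.Nat.Properties as ℕ
  open import Data.Rational
  import Data.Rational.Properties as ℚ
  open import Data.Rational.Properties using (module ≤-Reasoning)
  open import Relation.Binary.PropositionalEquality
    using (_≡_; sym; trans; cong; subst)
  open import Tactic.RingSolver as RingSolver using ()
  open import Defs using (expSum; logSeq)
  open Defs.RationalLemmas
  open Defs.SequenceLemmas using (inverse; inverse-*; inverse-pos)
  open Series
  open RationalBound
  open ≤-Reasoning

  -- Brings the integral divisor bound into exponential form, by (1 + 1/(K + 1))^t ≤ exp (t/(K + 1))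
  -- ≤ exp x; more than t terms of the series suffice.
  exp-lower : ∀ {c D} K t {x k} → c ℕ.* suc K ℕ.^ t ℕ.≤ D ℕ.* suc (suc K) ℕ.^ t → t ℕ.< k →
    fromℕ t * recip K ≤ x → fromℕ c ≤ fromℕ D * expSum x k
  exp-lower {c} {D} K t {x} {k} c≤ t<k t/K≤x = ℚ.*-cancelʳ-≤-pos P {{positive 0<P}} (begin
    fromℕ c * P                                 ≡⟨ sym (fromℕ-* c (suc K ℕ.^ t)) ⟩
    fromℕ (c ℕ.* suc K ℕ.^ t)                   ≤⟨ fromℕ-mono {c ℕ.* suc K ℕ.^ t} {D ℕ.* suc (suc K) ℕ.^ t} c≤ ⟩
    fromℕ (D ℕ.* suc (suc K) ℕ.^ t)             ≡⟨ fromℕ-* D (suc (suc K) ℕ.^ t) ⟩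
    fromℕ D * fromℕ (suc (suc K) ℕ.^ t)         ≤⟨ *-monoˡ (0≤fromℕ D) (expSum-power K t t<k) ⟩
    fromℕ D * (P * expSum (fromℕ t * recip K) k) ≤⟨ *-monoˡ (0≤fromℕ D) (*-monoˡ (ℚ.<⇒≤ 0<P)
                                                   (expSum-mono (0≤* (0≤fromℕ t) (0≤recip K)) t/K≤x k)) ⟩
    fromℕ D * (P * expSum x k)                  ≡⟨ lem (fromℕ D) P (expSum x k) ⟩
    fromℕ D * expSum x k * P                    ∎)
    where
    P : ℚ
    P = fromℕ (suc K ℕ.^ t)
    0<P : 0ℚ < P
    0<P = ℚ.<-≤-trans (ℚ.positive⁻¹ 1ℚ) (fromℕ-mono {1} {suc K ℕ.^ t} (ℕ.m^n>0 (suc K) t))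
    lem : ∀ D P E → D * (P * E) ≡ D * E * P
    lem = RingSolver.solve-∀ ring

  -- 2^t ≤ n and log 2 ≥ ½ give t/2 ≤ log n. The ½ in the condition on K compensates for this, and δ
  -- is a rational lower bound for ε.
  exponent-lower : ∀ {n t K δ e} k → 2 ℕ.^ t ℕ.≤ n → recip K ≤ δ * ½ → 0ℚ ≤ δ → δ ≤ e → fromℕ t * recip K ≤ e * logSeq n k
  exponent-lower {n} {t} {K} {δ} {e} k 2^t≤n 1/K≤ 0≤δ δ≤e = begin
    fromℕ t * recip K         ≤⟨ *-monoˡ (0≤fromℕ t) 1/K≤ ⟩
    fromℕ t * (δ * ½)         ≡⟨ lem (fromℕ t) δ ⟩
    δ * (fromℕ t * ½)         ≤⟨ *-monoˡ 0≤δ (ℚ.≤-trans (log-2^ t k) (logSeq-mono k 2^t≤n)) ⟩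
    δ * logSeq n k            ≤⟨ *-monoʳ (logSeq-nonNeg n k) δ≤e ⟩
    e * logSeq n k            ∎
    where
    lem : ∀ t δ → t * (δ * ½) ≡ δ * (t * ½)
    lem = RingSolver.solve-∀ ring

  inverse-double : ∀ {a} → 0ℚ < a → inverse (fromℕ 2 * a) ≡ ½ * inverse a
  inverse-double {a} 0<a = go a (inverse a) (inverse (fromℕ 2 * a)) (inverse-* 0<a) (inverse-* (0<* (ℚ.positive⁻¹ (fromℕ 2)) 0<a))
    where
    go : ∀ a v x → v * a ≡ 1ℚ → x * (fromℕ 2 * a) ≡ 1ℚ → x ≡ ½ * v
    go a v x va xa = trans (sym (ℚ.*-identityʳ x)) (trans (cong (x *_) (sym va))
      (trans (lem x v a) (trans (cong (_* (½ * v)) xa) (ℚ.*-identityˡ (½ * v)))))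
      where
      lem : ∀ x v a → x * (v * a) ≡ x * (fromℕ 2 * a) * (½ * v)
      lem = RingSolver.solve-∀ ring

  g≡2h : ∀ n s ℓ {a} → 0ℚ < a → gApprox n s ℓ a ≡ fromℕ 2 * hApprox n s ℓ a
  g≡2h n s ℓ {a} 0<a = go (inverse a) (inverse (fromℕ 2 * a)) (fromℕ 2 * fromℕ n - 1ℚ) (inverse (fromℕ 2 * s - a)) γ′ (inverse-double 0<a)
    where
    lem : ∀ v u z g s ℓ a → 1ℚ * v * s * ℓ + fromℕ 2 * (1ℚ + g * v) * s + fromℕ 2 * u * a * z ≡
      fromℕ 2 * (1ℚ * (½ * v) * s * ℓ + (1ℚ + g * v) * s + u * a * z)
    lem = RingSolver.solve-∀ ring
    go : ∀ v v₂ u z g → v₂ ≡ ½ * v → 1ℚ * v * s * ℓ + fromℕ 2 * (1ℚ + g * v) * s + fromℕ 2 * u * a * z ≡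
      fromℕ 2 * (1ℚ * v₂ * s * ℓ + (1ℚ + g * v) * s + u * a * z)
    go v v₂ u z g v₂≡ = trans (lem v u z g s ℓ a)
      (cong (λ w → fromℕ 2 * (1ℚ * w * s * ℓ + (1ℚ + g * v) * s + u * a * z)) (sym v₂≡))

  0≤h : ∀ n {s ℓ a} → 0 ℕ.< n → 0ℚ ≤ s → 0ℚ ≤ ℓ → 0ℚ < a → 0ℚ < fromℕ 2 * s - a → 0ℚ ≤ hApprox n s ℓ a
  0≤h n {s} {ℓ} {a} 0<n 0≤s 0≤ℓ 0<a 0<b = go (inverse a) (inverse (fromℕ 2 * a)) (inverse (fromℕ 2 * s - a))
      (ℚ.<⇒≤ (inverse-pos 0<a)) (ℚ.<⇒≤ (inverse-pos (0<* (ℚ.positive⁻¹ (fromℕ 2)) 0<a))) (ℚ.<⇒≤ (inverse-pos 0<b))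
      (fromℕ 2 * fromℕ n - 1ℚ) 0≤2n-1
    where
    0≤2n-1 : 0ℚ ≤ fromℕ 2 * fromℕ n - 1ℚ
    0≤2n-1 = 0≤q-p {1ℚ} {fromℕ 2 * fromℕ n} (subst (1ℚ ≤_) (fromℕ-* 2 n)
      (fromℕ-mono {1} {2 ℕ.* n} (ℕ.≤-trans 0<n (ℕ.m≤n*m n 2))))
    go : ∀ v v₂ z → 0ℚ ≤ v → 0ℚ ≤ v₂ → 0ℚ ≤ z → ∀ u → 0ℚ ≤ u →
      0ℚ ≤ 1ℚ * v₂ * s * ℓ + (1ℚ + γ′ * v) * s + u * a * z
    go v v₂ z 0≤v 0≤v₂ 0≤z u 0≤u = 0≤+ {1ℚ * v₂ * s * ℓ + (1ℚ + γ′ * v) * s} {u * a * z} (0≤+ {1ℚ * v₂ * s * ℓ} {(1ℚ + γ′ * v) * s}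
      (0≤* {1ℚ * v₂ * s} {ℓ} (0≤* {1ℚ * v₂} {s} (0≤* {1ℚ} {v₂} 0≤1 0≤v₂) 0≤s) 0≤ℓ)
      (0≤* {1ℚ + γ′ * v} {s} (0≤+ {1ℚ} {γ′ * v} 0≤1 (0≤* {γ′} {v} (0≤* {fromℕ 3} {recip 4} (0≤fromℕ 3) (0≤recip 4)) 0≤v)) 0≤s))
      (0≤* {u * a} {z} (0≤* {u} {a} 0≤u (ℚ.<⇒≤ 0<a)) 0≤z)

  ½θg≤Ch : ∀ {g h θ C} → g ≡ fromℕ 2 * h → 0ℚ ≤ h → θ ≤ C → ½ * θ * g ≤ C * h
  ½θg≤Ch {g} {h} {θ} {C} g≡ 0≤h θ≤C = begin
    ½ * θ * g             ≡⟨ cong (½ * θ *_) g≡ ⟩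
    ½ * θ * (fromℕ 2 * h) ≡⟨ lem θ h ⟩
    θ * h                 ≤⟨ *-monoʳ 0≤h θ≤C ⟩
    C * h                 ∎
    where
    lem : ∀ θ h → ½ * θ * (fromℕ 2 * h) ≡ θ * h
    lem = RingSolver.solve-∀ ring

-- From approximants to real inequalities.

module Reals where
  open import Data.Nat as ℕ using (ℕ; suc; _⊔_)
  import Data.Nat.Properties as ℕ
  open import Data.Product using (∃; _×_; _,_)
  open import Data.Rational as ℚ using (ℚ; 0ℚ; 1ℚ; ½)
  import Data.Rational.Properties as ℚ
  open import Relation.Binary.PropositionalEquality using (_≡_; refl; sym; subst)
  open import Relation.Nullary using (¬_)
  open import Tactic.RingSolver as RingSolver using ()
  open import Defs
  open RationalLemmas
  open SqrtLemmas using (isqrt-lower; isqrt-upper)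
  open DivisorBound using (θ-bound)
  open Series
  open RationalBound
  open ExponentialBound

  eventually-≤ : ∀ {x y} → (∃ λ N → ∀ k → N ℕ.≤ k → approx x k ℚ.≤ approx y k) → x ≤ y
  eventually-≤ {x} {y} (N , h) = ≤-intro λ ε 0<ε → N , λ k N≤k →
    ℚ.≤-trans (h k N≤k) (p≤p+q {approx y k} {ε} (ℚ.<⇒≤ 0<ε))

  module _ (n : ℕ) (α : ℝ) (1<n : 1 ℕ.< n) (1≤α : 1ℝ ≤ α) (α≤√n : α ≤ √ n) where

    0<n : 0 ℕ.< n
    0<n = ℕ.<⇒≤ 1<n

    -- The conditions on the k-th approximants under which the rational estimates apply; `regular`
    -- secures them for all large k.
    Regular : ℕ → Set
    Regular k = nine ℚ.≤ approx α k × 0ℚ ℚ.< fromℕ 2 ℚ.* sqrtSeq n k ℚ.- approx α k × HarmonicBound (isqrt n) (logSeq n k)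

    regular : ∃ λ N → ∀ k → N ℕ.≤ k → Regular k
    regular =
      let L , 1≤a = ≤-elim 1≤α tenth (recip-pos 9)
          δ , 0<δ , M , δ≤b = <-elim (2√n-α>0 α 1≤α n α≤√n)
          N , hb = harmonic-bound {isqrt n} {n} (0<isqrt 0<n) (isqrt-lower n)
      in (L ⊔ M) ⊔ N , λ k k≥ →
        let k≥L⊔M = ℕ.m⊔n≤o⇒m≤o (L ⊔ M) N k≥ in
        9/10≤ (approx α k) (1≤a k (ℕ.m⊔n≤o⇒m≤o L M k≥L⊔M)) ,
        positive-gap δ (fromℕ 2 ℚ.* sqrtSeq n k ℚ.- approx α k) 0<δ (δ≤b k (ℕ.m⊔n≤o⇒n≤o L M k≥L⊔M)) ,
        hb k (ℕ.m⊔n≤o⇒n≤o (L ⊔ M) N k≥)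
      where
      0<isqrt : ∀ {n} → 0 ℕ.< n → 0 ℕ.< isqrt n
      0<isqrt {n} 0<n = ℕ.n≢0⇒n>0 λ m≡0 → ℕ.<-irrefl refl
        (ℕ.<-≤-trans (subst (λ m → n ℕ.< suc m ℕ.* suc m) m≡0 (isqrt-upper n)) 0<n)
      9/10≤ : ∀ a → 1ℚ ℚ.≤ a ℚ.+ tenth → nine ℚ.≤ a
      9/10≤ a h = subst (nine ℚ.≤_) (lem a) (ℚ.+-monoˡ-≤ (ℚ.- tenth) h)
        where
        lem : ∀ a → a ℚ.+ recip 9 ℚ.- recip 9 ≡ a
        lem = RingSolver.solve-∀ ring
      positive-gap : ∀ δ b → 0ℚ ℚ.< δ → 0ℚ ℚ.+ δ ℚ.≤ b → 0ℚ ℚ.< b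
      positive-gap δ b 0<δ h = ℚ.<-≤-trans 0<δ (subst (ℚ._≤ b) (ℚ.+-identityˡ δ) h)

    0<approx : ∀ {k} → Regular k → 0ℚ ℚ.< approx α k
    0<approx (9/10≤a , _) = ℚ.<-≤-trans (ℚ.positive⁻¹ nine) 9/10≤a

    h-nonNeg : ∀ k → Regular k → 0ℚ ℚ.≤ approx (h n α 1≤α α≤√n) k
    h-nonNeg k r@(_ , 0<b , _) = 0≤h n {sqrtSeq n k} {logSeq n k} {approx α k} 0<n (0≤sqrtSeq n k) (logSeq-nonNeg n k) (0<approx r) 0<b

    g-double : ∀ k → Regular k → approx (g n α 1≤α α≤√n) k ≡ fromℕ 2 ℚ.* approx (h n α 1≤α α≤√n) k
    g-double k r = g≡2h n (sqrtSeq n k) (logSeq n k) {approx α k} (0<approx r)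

    f-upper : ∀ k → Regular k →
      fromℕ (f n) ℚ.≤ ½ ℚ.* fromℕ (θ n) ℚ.* approx (g n α 1≤α α≤√n) k
    f-upper k (9/10≤a , 0<b , hb) = f≤½θgApprox n k (approx α k) 0<n 9/10≤a 0<b hb

    f≤½θg : ℕ→ℝ (f n) ≤ ℚ→ℝ ½ * ℕ→ℝ (θ n) * g n α 1≤α α≤√n
    f≤½θg = let N , reg = regular in eventually-≤ (N , λ k N≤k → f-upper k (reg k N≤k))

    f≤½[θ+1]g : ℕ→ℝ (f n) ≤ ℚ→ℝ ½ * (ℕ→ℝ (θ n) + 1ℝ) * g n α 1≤α α≤√n
    f≤½[θ+1]g = let N , reg = regular in eventually-≤ (N , λ k N≤k →
      let r = reg k N≤k in ℚ.≤-trans (f-upper k r) (enlarge (fromℕ (θ n)) (approx (g n α 1≤α α≤√n) k)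
        (subst (0ℚ ℚ.≤_) (sym (g-double k r)) (0≤* {fromℕ 2} {approx (h n α 1≤α α≤√n) k} (0≤fromℕ 2) (h-nonNeg k r)))))
      where
      enlarge : ∀ θ g → 0ℚ ℚ.≤ g → ½ ℚ.* θ ℚ.* g ℚ.≤ ½ ℚ.* (θ ℚ.+ 1ℚ) ℚ.* g
      enlarge θ g 0≤g = *-monoʳ {g} 0≤g (*-monoˡ {½} (ℚ.<⇒≤ 0<½) (p≤p+q {θ} {1ℚ} 0≤1))

    module _ (x : ℝ) (θ≤x : ∃ λ N → ∀ k → N ℕ.≤ k → fromℕ (θ n) ℚ.≤ approx x k) where

      ½θg≤xh : ℚ→ℝ ½ * ℕ→ℝ (θ n) * g n α 1≤α α≤√n ≤ x * h n α 1≤α α≤√n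
      ½θg≤xh = let M , reg = regular ; N , θ≤ = θ≤x in eventually-≤ (M ⊔ N , λ k k≥ →
        let r = reg k (ℕ.m⊔n≤o⇒m≤o M N k≥) in
        ½θg≤Ch {approx (g n α 1≤α α≤√n) k} {approx (h n α 1≤α α≤√n) k} {fromℕ (θ n)} {approx x k}
          (g-double k r) (h-nonNeg k r) (θ≤ k (ℕ.m⊔n≤o⇒n≤o M N k≥)))

      ½[θ+1]g≤[x+1]h : ℚ→ℝ ½ * (ℕ→ℝ (θ n) + 1ℝ) * g n α 1≤α α≤√n ≤ (x + 1ℝ) * h n α 1≤α α≤√n
      ½[θ+1]g≤[x+1]h = let M , reg = regular ; N , θ≤ = θ≤x in eventually-≤ (M ⊔ N , λ k k≥ →
        let r = reg k (ℕ.m⊔n≤o⇒m≤o M N k≥) in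
        ½θg≤Ch {approx (g n α 1≤α α≤√n) k} {approx (h n α 1≤α α≤√n) k} {fromℕ (θ n) ℚ.+ 1ℚ} {approx x k ℚ.+ 1ℚ}
          (g-double k r) (h-nonNeg k r) (ℚ.+-monoˡ-≤ 1ℚ (θ≤ k (ℕ.m⊔n≤o⇒n≤o M N k≥))))

  θ≤Cn^ε : ∀ (ε : ℝ) → 0ℝ < ε → ∃ λ (C : ℝ) → ∀ n → 0 ℕ.< n →
    ∃ λ N → ∀ k → N ℕ.≤ k → fromℕ (θ n) ℚ.≤ approx (C * n ^ ε) k
  θ≤Cn^ε ε 0<ε =
    let δ , 0<δ , M , δ≤ε = <-elim 0<ε
        K , 1/K≤ = archimedean-recip 1ℚ (half-pos 0<δ)
        D , bound = θ-bound K
    -- K and hence D come from ε alone; only t, and with it the threshold for k, depends on n.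
    in ℕ→ℝ D , λ n 0<n →
    let t , 2^t≤n , θ≤ = bound n {{ℕ.>-nonZero 0<n}}
    in M ⊔ suc t , λ k k≥ → exp-lower {θ n} {D} K t {approx ε k ℚ.* logSeq n k} {k} θ≤ (ℕ.m⊔n≤o⇒n≤o M (suc t) k≥)
      (exponent-lower {n} {t} {K} {δ} {approx ε k} k 2^t≤n
        (subst (ℚ._≤ δ ℚ.* ½) (ℚ.*-identityˡ (recip K)) (1/K≤ K ℕ.≤-refl)) (ℚ.<⇒≤ 0<δ)
        (subst (ℚ._≤ approx ε k) (ℚ.+-identityˡ δ) (δ≤ε k (ℕ.m⊔n≤o⇒m≤o M (suc t) k≥))))

open import Defs
open import Data.Nat as ℕ using (ℕ)
import Data.Nat.Properties as ℕ
open import Data.Product using (∃; _×_; _,_)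
open import Data.Rational using (½)
open import Relation.Nullary using (¬_)

theorem3 : (∀ (ε : ℝ) → 0ℝ < ε →
    ∃ λ (C : ℝ) →
    ∀ (n : ℕ) (α : ℝ) → 1 ℕ.< n → (1≤α : 1ℝ ≤ α) (α≤√n : α ≤ √ n) →
    (¬ IsSquare n →
    (ℕ→ℝ (f n) ≤ ℚ→ℝ ½ * ℕ→ℝ (θ n) * g n α 1≤α α≤√n) ×
    (ℚ→ℝ ½ * ℕ→ℝ (θ n) * g n α 1≤α α≤√n ≤ C * n ^ ε * h n α 1≤α α≤√n)) ×
    (IsSquare n →
    (ℕ→ℝ (f n) ≤ ℚ→ℝ ½ * (ℕ→ℝ (θ n) + 1ℝ) * g n α 1≤α α≤√n) ×
    (ℚ→ℝ ½ * (ℕ→ℝ (θ n) + 1ℝ) * g n α 1≤α α≤√n ≤ (C * n ^ ε + 1ℝ) * h n α 1≤α α≤√n))) ×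
    (∃ λ (N : ℕ) → ∀ (n : ℕ) → N ℕ.≤ n → f n ℕ.< n)
theorem3 =
  (λ ε 0<ε → let C , θ≤ = Reals.θ≤Cn^ε ε 0<ε in C , λ n α 1<n 1≤α α≤√n →
    let θ≤Cn^ε = θ≤ n (ℕ.<⇒≤ 1<n) in
    (λ _ → Reals.f≤½θg n α 1<n 1≤α α≤√n , Reals.½θg≤xh n α 1<n 1≤α α≤√n (C * n ^ ε) θ≤Cn^ε) ,
    (λ _ → Reals.f≤½[θ+1]g n α 1<n 1≤α α≤√n , Reals.½[θ+1]g≤[x+1]h n α 1<n 1≤α α≤√n (C * n ^ ε) θ≤Cn^ε)) ,
  Asymptotics.eventually-f<n
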